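{- There exists an absolute constant $C>0$ such that for every bipartite graph $H$ there is $s_0=s_0(H)$ with the following property. For every integer $s\ge s_0$ and every graph $G$ which contains no copy of $K_{s,s}$ as a subgraph and contains no induced subgraph isomorphic to a subdivision of $H$, the average degree of $G$ is at most $s^{C|V(H)|}$.
   Context: A subdivision of $H$ is a graph obtained from $H$ by replacing each edge by a path (of length at least one) between its endpoints, the paths having pairwise disjoint interiors which avoid $V(H)$. The average degree of $G$ is $2|E(G)|/|V(G)|$. -}

module Defs where

open import Data.Nat using (ℕ; zero; suc; _+_; _*_; _<_)
open import Data.Bool using (Bool; true; false; if_then_else_)
open import Data.Fin using (Fin; zero; suc; inject₁; fromℕ; toℕ)
open import Data.Product using (Σ; ∃; ∃-syntax; _×_; _,_)
open import Data.Sum using (_⊎_)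
open import Relation.Binary.PropositionalEquality using (_≡_; _≢_)
open import Function.Definitions using (Injective)

record Graph (n : ℕ) : Set where
  field
    adj   : Fin n → Fin n → Bool
    sym   : ∀ x y → adj x y ≡ adj y x
    irrefl : ∀ x → adj x x ≡ false
open Graph public

Adj : ∀ {n} → Graph n → Fin n → Fin n → Set
Adj G x y = adj G x y ≡ true

ΣFin : (n : ℕ) → (Fin n → ℕ) → ℕ
ΣFin zero    f = 0
ΣFin (suc n) f = f zero + ΣFin n (λ i → f (suc i))

-- Sum of degrees = 2|E(G)|.  Average degree ≤ d  ⇔  degSum G ≤ d * n.
degSum : ∀ {n} → Graph n → ℕ
degSum {n} G = ΣFin n (λ x → ΣFin n (λ y → if adj G x y then 1 else 0))

Bipartite : ∀ {h} → Graph h → Set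
Bipartite {h} H = Σ (Fin h → Bool) λ col → (∀ (u v : Fin h) → Adj H u v → col u ≢ col v)

ContainsKss : ∀ {n} → ℕ → Graph n → Set
ContainsKss {n} s G =
  Σ (Fin s → Fin n) λ f → Σ (Fin s → Fin n) λ g →
    Injective _≡_ _≡_ f × Injective _≡_ _≡_ g ×
    (∀ i j → f i ≢ g j) × (∀ i j → Adj G (f i) (g j))

record PathIn (m : ℕ) : Set where
  field
    len   : ℕ                       -- number of interior vertices k
    vtx   : Fin (suc (suc len)) → Fin m

open PathIn public

interior : ∀ {m} (P : PathIn m) → Fin (len P) → Fin m
interior P j = vtx P (suc (inject₁ j))

record IsSubdivision {h m : ℕ} (S : Graph m) (H : Graph h) : Set where
  field
    branch     : Fin h → Fin m
    branch-inj : Injective _≡_ _≡_ branch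
    path       : (u v : Fin h) → toℕ u < toℕ v → Adj H u v → PathIn m
    path-inj   : ∀ u v p e → Injective _≡_ _≡_ (vtx (path u v p e))
    path-start : ∀ u v p e → vtx (path u v p e) zero ≡ branch u
    path-end   : ∀ u v p e → vtx (path u v p e) (fromℕ (suc (len (path u v p e)))) ≡ branch v
    interior-avoids-branch : ∀ u v p e j w → interior (path u v p e) j ≢ branch w
    interiors-disjoint :
      ∀ u v p e u′ v′ p′ e′ j j′ →
      interior (path u v p e) j ≡ interior (path u′ v′ p′ e′) j′ →
      u ≡ u′ × v ≡ v′
    covers : ∀ (x : Fin m) →
      (∃[ w ] x ≡ branch w) ⊎
      (∃[ u ] ∃[ v ] Σ (toℕ u < toℕ v) λ p → Σ (Adj H u v) λ e →
         ∃[ j ] x ≡ interior (path u v p e) j)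
    edges-sound : ∀ u v p e (i : Fin (suc (len (path u v p e)))) →
      Adj S (vtx (path u v p e) (inject₁ i)) (vtx (path u v p e) (suc i))
    edges-complete : ∀ (x y : Fin m) → Adj S x y →
      ∃[ u ] ∃[ v ] Σ (toℕ u < toℕ v) λ p → Σ (Adj H u v) λ e →
        ∃[ i ] ((x ≡ vtx (path u v p e) (inject₁ i) × y ≡ vtx (path u v p e) (suc i))
              ⊎ (y ≡ vtx (path u v p e) (inject₁ i) × x ≡ vtx (path u v p e) (suc i)))

ContainsInducedSubdivision : ∀ {h n} → Graph h → Graph n → Set
ContainsInducedSubdivision {h} {n} H G =
  ∃[ m ] Σ (Graph m) λ S → IsSubdivision S H ×
    Σ (Fin m → Fin n) λ φ → Injective _≡_ _≡_ φ ×
      (∀ x y → adj G (φ x) (φ y) ≡ adj S x y)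

{-# OPTIONS --safe #-}
-- Suppose first that some large set Y is dense to many vertices: they all see a 1/s
-- fraction of Y.  Dependent random choice gives a large set of vertices all of whose
-- h-tuples have many common neighbours in Y.  As G has no K_{s,s}, fewer than s vertices
-- dominate all but a 1/2s fraction of a given large set; comparing the numbers of
-- independent k-tuples for consecutive k, one finds an independent h-tuple no entry of
-- which dominates the relevant part of Y, and then an induced copy of H.
--
-- Otherwise G is locally sparse.  A minimal vertex set W of average degree at least 2d has
-- minimum degree at least d and an orientation of indegree at most 3d, and half of its
-- vertices have degree at most 12d.  If most pairs in the neighbourhood of such a vertex
-- have many common neighbours, the same embedding yields an induced 1-subdivision of H.
-- If not, a random sample of density about 1/d contains an independent set B together with
-- independent vertices which have exactly two neighbours in B each, no two of them the
-- same pair: an induced 1-subdivision of a graph F on B of large average degree.  By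
-- Mader's theorem F contains a subdivision of the complete graph on h vertices, and every
-- subgraph of F becomes induced in the 1-subdivision of F.

module Submission where

open import Defs
open import Data.Nat using (ℕ; zero; suc; _+_; _*_; _∸_; _^_; _≤_; _<_; z≤n; s≤s; _≤?_; _<?_; >-nonZero)
open import Data.Nat.Properties hiding (_≟_; suc-injective)
open import Data.Nat.Tactic.RingSolver using (solve-∀)
open import Data.Bool using (Bool; true; false; if_then_else_)
open import Data.Fin using (Fin; zero; suc; toℕ; inject₁; fromℕ; inject≤; combine; remQuot; fromℕ<)
open import Data.Fin.Properties using (combine-injective; _≟_; suc-injective; inject≤-injective; remQuot-combine; toℕ<n; toℕ-injective; toℕ-fromℕ<; any?)
open import Data.Vec using (Vec; []; _∷_; lookup; insertAt)
open import Data.Vec.Properties using (insertAt-lookup)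
open import Data.List using (List; []; _∷_; length; _∷ʳ_)
open import Data.List.Relation.Unary.Any using (here; there)
open import Data.List.Relation.Unary.All using (All; []; _∷_)
open import Data.List.Relation.Unary.AllPairs using ([]; _∷_)
open import Data.List.Relation.Unary.Unique.Propositional using (Unique)
open import Data.List.Membership.Propositional using (_∈_; _∉_)
import Data.List.Relation.Unary.All as All
import Data.List.Relation.Unary.All.Properties as All
import Data.List.Relation.Unary.AllPairs.Properties as AllPairs
import Data.List.Membership.DecPropositional as DecMembership
open import Data.Product using (Σ; ∃-syntax; _×_; _,_; proj₁; proj₂)
open import Data.Sum using (_⊎_; inj₁; inj₂; [_,_]′)
open import Data.Empty using (⊥; ⊥-elim)
open import Relation.Nullary using (¬_; Dec; yes; no)
open import Relation.Binary.Definitions using (tri<; tri≈; tri>)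
open import Relation.Nullary.Decidable using (⌊_⌋; _×-dec_; _⊎-dec_)
open import Relation.Binary.PropositionalEquality using (_≡_; _≢_; refl; trans; cong; cong₂; subst; subst₂; module ≡-Reasoning) renaming (sym to ≡-sym)
open import Function using (_∘_; id)
open import Function.Definitions using (Injective)

-- The exponent must be linear in `h`, and this shapes the proof. If vertices missing less than a
-- 1/l fraction of a large set are rare, then every forced non-adjacency, and every vertex added to
-- an independent set, costs a factor l. Excluding K_{s,s} gives l = 2s. This is affordable for h
-- patterns on an h-tuple, where the cost is (2s)^(2h), but the h² middle vertices of a
-- 1-subdivision would cost a power of s quadratic in h. In the locally sparse case even a vertex
-- seeing a 1/s fraction of a large set is rare, so l = 2 is available; the h² patterns then cost
-- 2^(h²), which depends on `H` alone and is absorbed by s₀, as is Mader's bound 2^(h²) h. The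
-- comparison of tuple counts makes one entry of a random tuple, given the others, take γ values on
-- average, more than the few dominating vertices can spoil. The sample has two densities, 1/(κd)
-- for the ends and L/(κd) for the middle vertices, with L large, because the good triples have to
-- outnumber K times the sampled ends.

private variable
  n k m N : ℕ
  V : Set

-- Inequalities between natural numbers

≡≤ : ∀ {a b c : ℕ} → a ≡ b → b ≤ c → a ≤ c
≡≤ refl p = p

*-swap : ∀ a b c → a * (b * c) ≡ b * (a * c)
*-swap = solve-∀

infixr 2 _∙_
_∙_ : {A : Set} {x y z : A} → x ≡ y → y ≡ z → x ≡ z
_∙_ = trans

-- Linear arithmetic: the equation is meant for the ring solver.
≤-by : ∀ {l r} → l ≤ r → (e : ℕ) {a b : ℕ} → a + r + e ≡ b + l → a ≤ b
≤-by {l} {r} l≤r e {a} {b} eq = +-cancelʳ-≤ r a b (begin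
  a + r ≤⟨ m≤m+n (a + r) e ⟩
  a + r + e ≡⟨ eq ⟩
  b + l ≤⟨ +-monoʳ-≤ b l≤r ⟩
  b + r ∎)
  where open ≤-Reasoning

≤-cancel : ∀ c {a b} → 0 < c → c * a ≤ c * b → a ≤ b
≤-cancel (suc c) {a} {b} _ = *-cancelˡ-≤ {a} {b} (suc c)

*-pos : ∀ {a b} → 0 < a → 0 < b → 0 < a * b
*-pos {suc a} {suc b} _ _ = s≤s z≤n

pos-*⁻ˡ : ∀ {a b} → 0 < a * b → 0 < a
pos-*⁻ˡ {suc a} _ = s≤s z≤n

^-pos : ∀ {a} → 0 < a → ∀ k → 0 < a ^ k
^-pos a>0 zero = s≤s z≤n
^-pos a>0 (suc k) = *-pos a>0 (^-pos a>0 k)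

-- Boolean connectives and decidable predicates

infixr 6 _∧_
infixr 5 _∨_
infixr 5 _⇒_
infix 7 _==_
infix 4 _<ᵇ_

-- The operations below are opaque so that the unifier treats them as injective.

opaque
  _∧_ _∨_ _⇒_ : Bool → Bool → Bool
  true ∧ b = b
  false ∧ b = false
  true ∨ b = true
  false ∨ b = b
  true ⇒ b = b
  false ⇒ b = true

  not : Bool → Bool
  not true = false
  not false = true

  ⇒-elim : ∀ {a b} → a ⇒ b ≡ true → a ≡ true → b ≡ true
  ⇒-elim {true} p refl = p

  ⇒-false : ∀ {a b} → a ≡ false → a ⇒ b ≡ true
  ⇒-false refl = refl

  ⇒-intro : ∀ {a b} → (a ≡ true → b ≡ true) → a ⇒ b ≡ true
  ⇒-intro {true} f = f refl
  ⇒-intro {false} f = refl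

  ∧-elim : ∀ {a b} → a ∧ b ≡ true → a ≡ true × b ≡ true
  ∧-elim {true} {true} _ = refl , refl

  ∧-fst : ∀ {a b} → a ∧ b ≡ true → a ≡ true
  ∧-fst p = proj₁ (∧-elim p)

  ∧-snd : ∀ {a b} → a ∧ b ≡ true → b ≡ true
  ∧-snd {a} p = proj₂ (∧-elim {a} p)

  ∧-intro : ∀ {a b} → a ≡ true → b ≡ true → a ∧ b ≡ true
  ∧-intro refl refl = refl

  ∨-elim : ∀ {a b} → a ∨ b ≡ true → a ≡ true ⊎ b ≡ true
  ∨-elim {true} _ = inj₁ refl
  ∨-elim {false} p = inj₂ p

  ∨-introˡ : ∀ {a b} → a ≡ true → a ∨ b ≡ true
  ∨-introˡ refl = refl

  ∨-introʳ : ∀ {a b} → b ≡ true → a ∨ b ≡ true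
  ∨-introʳ {true} _ = refl
  ∨-introʳ {false} p = p

  ∨-false : ∀ {a b} → a ∨ b ≡ false → a ≡ false × b ≡ false
  ∨-false {false} p = refl , p

  not-elim : ∀ {a} → not a ≡ true → a ≡ false
  not-elim {false} _ = refl

  not-intro : ∀ {a} → a ≡ false → not a ≡ true
  not-intro refl = refl

  not-false : ∀ {a} → not a ≡ false → a ≡ true
  not-false {true} _ = refl

  true≢false : ∀ {a} {X : Set} → a ≡ true → a ≡ false → X
  true≢false refl ()

  ≢true : ∀ {a} → ¬ (a ≡ true) → a ≡ false
  ≢true {true} p = ⊥-elim (p refl)
  ≢true {false} _ = refl

  bool : ∀ a → a ≡ true ⊎ a ≡ false
  bool true = inj₁ refl
  bool false = inj₂ refl

  bool-ext : ∀ {a b} → (a ≡ true → b ≡ true) → (b ≡ true → a ≡ true) → a ≡ b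
  bool-ext {true} f g = ≡-sym (f refl)
  bool-ext {false} {true} f g = g refl
  bool-ext {false} {false} f g = refl

  _<ᵇ_ : ℕ → ℕ → Bool
  a <ᵇ b = ⌊ a <? b ⌋

  <ᵇ-elim : ∀ {a b} → (a <ᵇ b) ≡ true → a < b
  <ᵇ-elim {a} {b} p with a <? b
  ... | yes q = q

  <ᵇ-intro : ∀ {a b} → a < b → (a <ᵇ b) ≡ true
  <ᵇ-intro {a} {b} p with a <? b
  ... | yes _ = refl
  ... | no q = ⊥-elim (q p)

  <ᵇ-false : ∀ {a b} → (a <ᵇ b) ≡ false → b ≤ a
  <ᵇ-false {a} {b} p with a <? b
  ... | no q = ≮⇒≥ q

  _==_ : Fin n → Fin n → Bool
  x == y = ⌊ x ≟ y ⌋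

  ==-elim : {x y : Fin n} → x == y ≡ true → x ≡ y
  ==-elim {x = x} {y} p with x ≟ y
  ... | yes q = q

  ==-false : {x y : Fin n} → x == y ≡ false → x ≢ y
  ==-false {x = x} {y} p with x ≟ y
  ... | no q = q

  ==-refl : (x : Fin n) → x == x ≡ true
  ==-refl x with x ≟ x
  ... | yes _ = refl
  ... | no q = ⊥-elim (q refl)

  ≢-== : {x y : Fin n} → x ≢ y → x == y ≡ false
  ≢-== {x = x} {y} p with x ≟ y
  ... | yes q = ⊥-elim (p q)
  ... | no _ = refl

  allF : (Fin k → Bool) → Bool
  allF {zero} p = true
  allF {suc k} p = p zero ∧ allF (p ∘ suc)

  allF-suc : (p : Fin (suc k) → Bool) → allF p ≡ p zero ∧ allF (p ∘ suc)
  allF-suc p = refl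

  allF-elim : {p : Fin k → Bool} → allF p ≡ true → ∀ i → p i ≡ true
  allF-elim q zero = ∧-fst q
  allF-elim q (suc i) = allF-elim (∧-snd q) i

  allF-intro : {p : Fin k → Bool} → (∀ i → p i ≡ true) → allF p ≡ true
  allF-intro {zero} q = refl
  allF-intro {suc k} q = ∧-intro (q zero) (allF-intro (q ∘ suc))

  allF-false : {p : Fin k → Bool} → allF p ≡ false → ∃[ i ] p i ≡ false
  allF-false {suc k} {p} q with bool (p zero)
  ... | inj₂ e = zero , e
  ... | inj₁ e rewrite e with allF-false q
  ...   | i , e′ = suc i , e′

  allF-cong : {p q : Fin k → Bool} → (∀ i → p i ≡ q i) → allF p ≡ allF q
  allF-cong {zero} e = refl
  allF-cong {suc k} e = cong₂ _∧_ (e zero) (allF-cong (e ∘ suc))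

  -- Finite sums

  ι : Bool → ℕ
  ι b = if b then 1 else 0

  ∑ : (Fin n → ℕ) → ℕ
  ∑ {n} f = ΣFin n f

  ∑-empty : (f : Fin 0 → ℕ) → ∑ f ≡ 0
  ∑-empty f = refl

  ∑-cong : {f g : Fin n → ℕ} → (∀ i → f i ≡ g i) → ∑ f ≡ ∑ g
  ∑-cong {zero} e = refl
  ∑-cong {suc n} e = cong₂ _+_ (e zero) (∑-cong (e ∘ suc))

  ∑-mono : {f g : Fin n → ℕ} → (∀ i → f i ≤ g i) → ∑ f ≤ ∑ g
  ∑-mono {zero} e = z≤n
  ∑-mono {suc n} e = +-mono-≤ (e zero) (∑-mono (e ∘ suc))

  ∑-+ : (f g : Fin n → ℕ) → ∑ (λ i → f i + g i) ≡ ∑ f + ∑ g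
  ∑-+ {zero} f g = refl
  ∑-+ {suc n} f g = cong (f zero + g zero +_) (∑-+ (f ∘ suc) (g ∘ suc)) ∙
    lemma (f zero) (g zero) _ _
    where lemma : ∀ a b c d → a + b + (c + d) ≡ a + c + (b + d)
          lemma = solve-∀

  ∑-* : ∀ c (f : Fin n → ℕ) → ∑ (λ i → c * f i) ≡ c * ∑ f
  ∑-* {zero} c f = ≡-sym (*-zeroʳ c)
  ∑-* {suc n} c f = cong (c * f zero +_) (∑-* c (f ∘ suc)) ∙ ≡-sym (*-distribˡ-+ c (f zero) _)

  ∑-*ʳ : ∀ (f : Fin n → ℕ) c → ∑ (λ i → f i * c) ≡ ∑ f * c
  ∑-*ʳ f c = ∑-cong (λ i → *-comm (f i) c) ∙ ∑-* c f ∙ *-comm c (∑ f)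

  ∑-const : ∀ n c → ∑ {n} (λ _ → c) ≡ n * c
  ∑-const zero c = refl
  ∑-const (suc n) c = cong (c +_) (∑-const n c)

  ∑-zero : {f : Fin n → ℕ} → (∀ i → f i ≡ 0) → ∑ f ≡ 0
  ∑-zero {n} e = ∑-cong e ∙ ∑-const n 0 ∙ *-zeroʳ n

  ∑-swap : (f : Fin n → Fin m → ℕ) → ∑ (λ i → ∑ (f i)) ≡ ∑ (λ j → ∑ (λ i → f i j))
  ∑-swap {zero} {m} f = ≡-sym (∑-zero {m} {λ _ → 0} (λ _ → refl))
  ∑-swap {suc n} f = cong (∑ (f zero) +_) (∑-swap (f ∘ suc)) ∙ ≡-sym (∑-+ (f zero) _)

  term≤∑ : (f : Fin n → ℕ) → ∀ i → f i ≤ ∑ f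
  term≤∑ f zero = m≤m+n _ _
  term≤∑ f (suc i) = ≤-trans (term≤∑ (f ∘ suc) i) (m≤n+m _ _)

  ∑-<⇒∃ : {f g : Fin n → ℕ} → ∑ f < ∑ g → ∃[ i ] f i < g i
  ∑-<⇒∃ {suc n} {f} {g} p with f zero <? g zero
  ... | yes q = zero , q
  ... | no q with ∑-<⇒∃ {f = f ∘ suc} {g ∘ suc}
        (+-cancelˡ-< (f zero) _ _ (≤-trans p (+-monoˡ-≤ _ (≮⇒≥ q))))
  ...   | i , r = suc i , r

  ι-true : ∀ {a} → a ≡ true → ι a ≡ 1
  ι-true refl = refl

  ι-false : ∀ {a} → a ≡ false → ι a ≡ 0
  ι-false refl = refl

  ι≤1 : ∀ b → ι b ≤ 1
  ι≤1 true = ≤-refl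
  ι≤1 false = z≤n

  ι-mono : ∀ {a b} → (a ≡ true → b ≡ true) → ι a ≤ ι b
  ι-mono {true} f = ≤-reflexive (cong ι (≡-sym (f refl)))
  ι-mono {false} f = z≤n

  ι-∧ : ∀ a b → ι (a ∧ b) ≡ ι a * ι b
  ι-∧ true b = ≡-sym (+-identityʳ _)
  ι-∧ false b = refl

  ι-pos : ∀ {a} → 0 < ι a → a ≡ true
  ι-pos {true} _ = refl

  ι*-mono : ∀ {a x y} → (a ≡ true → x ≤ y) → ι a * x ≤ ι a * y
  ι*-mono {true} f = *-monoʳ-≤ 1 (f refl)
  ι*-mono {false} f = z≤n

  ι*-cong : ∀ {a x y} → (a ≡ true → x ≡ y) → ι a * x ≡ ι a * y
  ι*-cong {true} f = cong (1 *_) (f refl)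
  ι*-cong {false} f = refl

  ι*≤ : ∀ a x → ι a * x ≤ x
  ι*≤ true x = ≤-reflexive (+-identityʳ x)
  ι*≤ false x = z≤n

-- Finite sets

VSet : ℕ → Set
VSet n = Fin n → Bool

_⊆_ : VSet n → VSet n → Set
P ⊆ Q = ∀ x → P x ≡ true → Q x ≡ true

_∩_ : VSet n → VSet n → VSet n
(P ∩ Q) x = P x ∧ Q x

_-_ : VSet n → Fin n → VSet n
(P - v) x = P x ∧ not (x == v)

# : VSet n → ℕ
# P = ∑ (λ x → ι (P x))

opaque
  unfolding ∑

  #-mono : {P Q : VSet n} → P ⊆ Q → # P ≤ # Q
  #-mono s = ∑-mono (λ x → ι-mono (s x))

  #-cong : {P Q : VSet n} → (∀ x → P x ≡ Q x) → # P ≡ # Q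
  #-cong e = ∑-cong (λ x → cong ι (e x))

  #≤n : (P : VSet n) → # P ≤ n
  #≤n {n} P = ≤-trans (∑-mono (λ x → ι≤1 (P x))) (≤-reflexive (∑-const n 1 ∙ *-identityʳ n))

  #-pos⇒∃ : {P : VSet n} → 0 < # P → ∃[ x ] P x ≡ true
  #-pos⇒∃ {n} {P} p with ∑-<⇒∃ {f = λ _ → 0} {g = λ x → ι (P x)} (subst (_< # P) (≡-sym (∑-zero {n} {λ _ → 0} (λ _ → refl))) p)
  ... | x , q = x , ι-pos q

  ∃⇒#-pos : {P : VSet n} → ∀ x → P x ≡ true → 0 < # P
  ∃⇒#-pos {P = P} x p = ≡≤ (≡-sym (cong ι p)) (term≤∑ (λ x → ι (P x)) x)

  #-<⇒∃ : {P Q : VSet n} → # P < # Q → ∃[ x ] Q x ≡ true × P x ≡ false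
  #-<⇒∃ {P = P} {Q} p with ∑-<⇒∃ {f = λ x → ι (P x)} {g = λ x → ι (Q x)} p
  ... | x , q = x , ι-pos (≤-trans (s≤s z≤n) q) , lemma (P x) (Q x) q
    where lemma : ∀ a b → ι a < ι b → a ≡ false
          lemma false b _ = refl
          lemma true true (s≤s ())

  #-cover : {P Q R : VSet n} → (∀ x → P x ≡ true → Q x ≡ true ⊎ R x ≡ true) → # P ≤ # Q + # R
  #-cover {P = P} {Q} {R} c = ≤-trans (∑-mono lemma) (≤-reflexive (∑-+ (λ x → ι (Q x)) _))
    where
    lemma : ∀ x → ι (P x) ≤ ι (Q x) + ι (R x)
    lemma x with bool (P x)
    ... | inj₂ e rewrite e = z≤n
    ... | inj₁ e with c x e
    ...   | inj₁ q = ≤-trans (ι≤1 (P x)) (≡≤ (≡-sym (cong ι q)) (m≤m+n _ _))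
    ...   | inj₂ q = ≤-trans (ι≤1 (P x)) (≡≤ (≡-sym (cong ι q)) (m≤n+m _ _))

  #-cover∑ : {P : VSet n} {Q : Fin k → VSet n} → (∀ x → P x ≡ true → ∃[ i ] Q i x ≡ true) → # P ≤ ∑ (λ i → # (Q i))
  #-cover∑ {P = P} {Q} c = ≤-trans (∑-mono lemma) (≤-reflexive (∑-swap (λ x i → ι (Q i x))))
    where
    lemma : ∀ x → ι (P x) ≤ ∑ (λ i → ι (Q i x))
    lemma x with bool (P x)
    ... | inj₂ e rewrite e = z≤n
    ... | inj₁ e with c x e
    ...   | i , q = ≤-trans (ι≤1 (P x)) (≡≤ (≡-sym (cong ι q)) (term≤∑ _ i))

  #-disjoint : {P Q R : VSet n} → P ⊆ R → Q ⊆ R → (∀ x → P x ≡ true → Q x ≡ true → ⊥) → # P + # Q ≤ # R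
  #-disjoint {P = P} {Q} {R} p q d = ≡≤ (≡-sym (∑-+ (λ x → ι (P x)) _)) (∑-mono lemma)
    where
    lemma : ∀ x → ι (P x) + ι (Q x) ≤ ι (R x)
    lemma x with bool (P x) | bool (Q x)
    ... | inj₁ a | inj₁ b = ⊥-elim (d x a b)
    ... | inj₁ a | inj₂ b rewrite a | b | p x a = ≤-refl
    ... | inj₂ a | inj₁ b rewrite a | b | q x b = ≤-refl
    ... | inj₂ a | inj₂ b rewrite a | b = z≤n

  ∑-δ : (f : Fin n → ℕ) (v : Fin n) → ∑ (λ x → ι (x == v) * f x) ≡ f v
  ∑-δ {suc n} f zero = cong₂ _+_ (+-identityʳ (f zero)) (∑-zero {f = λ i → ι (suc i == zero) * f (suc i)} (λ i → refl)) ∙ +-identityʳ _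
  ∑-δ {suc n} f (suc v) = ∑-cong (λ i → cong (λ b → ι b * f (suc i)) (lemma i)) ∙ ∑-δ (f ∘ suc) v
    where lemma : ∀ i → (suc i == suc v) ≡ (i == v)
          lemma i = bool-ext (λ p → subst (λ w → (i == w) ≡ true) (suc-injective (==-elim p)) (==-refl i))
                             (λ p → subst (λ w → (suc i == suc w) ≡ true) (==-elim p) (==-refl (suc i)))

  ∑-split : (f : Fin n → ℕ) (v : Fin n) → ∑ f ≡ f v + ∑ (λ x → ι (not (x == v)) * f x)
  ∑-split f v = ∑-cong lemma ∙ ∑-+ (λ x → ι (x == v) * f x) _ ∙ cong (_+ ∑ (λ x → ι (not (x == v)) * f x)) (∑-δ f v)
    where lemma : ∀ x → f x ≡ ι (x == v) * f x + ι (not (x == v)) * f x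
          lemma x with x == v
          ... | true = ≡-sym (cong₂ _+_ (+-identityʳ (f x)) refl ∙ +-identityʳ _)
          ... | false = ≡-sym (+-identityʳ (f x))

  #-singleton : (v : Fin n) → # (_== v) ≡ 1
  #-singleton v = ∑-cong (λ x → ≡-sym (*-identityʳ (ι (x == v)))) ∙ ∑-δ (λ _ → 1) v

  #-remove : (P : VSet n) (v : Fin n) → P v ≡ true → # P ≡ suc (# (P - v))
  #-remove P v p = ∑-split (λ x → ι (P x)) v ∙ cong₂ _+_ (cong ι p)
    (∑-cong (λ x → *-comm (ι (not (x == v))) _ ∙ ≡-sym (ι-∧ (P x) _)))

  -⊆ : (P : VSet n) (v : Fin n) → (P - v) ⊆ P
  -⊆ P v x p = ∧-fst p

  -∌ : (P : VSet n) (v : Fin n) → (P - v) v ≡ false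
  -∌ P v = ≢true (λ p → true≢false (==-refl v) (not-elim (∧-snd {P v} p)))

  -∋ : (P : VSet n) {v x : Fin n} → P x ≡ true → x ≢ v → (P - v) x ≡ true
  -∋ P p q = ∧-intro p (not-intro (≢-== q))

  enumerate : (P : VSet n) → Σ (Fin (# P) → Fin n) λ φ → Injective _≡_ _≡_ φ ×
    (∀ i → P (φ i) ≡ true) × (∀ x → P x ≡ true → ∃[ i ] φ i ≡ x)
  enumerate {zero} P = (λ ()) , (λ { {()} }) , (λ ()) , (λ ())
  enumerate {suc n} P with P zero in eq | enumerate (P ∘ suc)
  ... | false | φ , inj , mem , sur = suc ∘ φ , inj ∘ suc-injective , mem , sur′
    where
    sur′ : ∀ x → P x ≡ true → ∃[ i ] suc (φ i) ≡ x
    sur′ zero p = true≢false p eq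
    sur′ (suc x) p with sur x p
    ... | i , refl = i , refl
  ... | true | φ , inj , mem , sur = φ′ , inj′ , mem′ , sur′
    where
    φ′ : Fin (suc (# (P ∘ suc))) → Fin (suc n)
    φ′ zero = zero
    φ′ (suc i) = suc (φ i)
    inj′ : Injective _≡_ _≡_ φ′
    inj′ {zero} {zero} _ = refl
    inj′ {suc i} {suc j} e = cong suc (inj (suc-injective e))
    mem′ : ∀ i → P (φ′ i) ≡ true
    mem′ zero = eq
    mem′ (suc i) = mem i
    sur′ : ∀ x → P x ≡ true → ∃[ i ] φ′ i ≡ x
    sur′ zero p = zero , refl
    sur′ (suc x) p with sur x p
    ... | i , refl = suc i , refl

  choose : (P : VSet n) → k ≤ # P → Σ (Fin k → Fin n) λ φ → Injective _≡_ _≡_ φ × (∀ i → P (φ i) ≡ true)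
  choose P k≤ with enumerate P
  ... | φ , inj , mem , _ = (λ i → φ (inject≤ i k≤)) , (λ e → inject≤-injective k≤ k≤ _ _ (inj e)) , (λ i → mem _)

  image-count : (φ : Fin k → Fin n) → # (λ x → not (allF (λ i → not (x == φ i)))) ≤ k
  image-count {k} φ = ≤-trans (#-cover∑ {Q = λ i x → x == φ i} cov)
    (≤-reflexive (∑-cong (λ i → #-singleton (φ i)) ∙ ∑-const k 1 ∙ *-identityʳ k))
    where
    cov : ∀ x → not (allF (λ i → not (x == φ i))) ≡ true → ∃[ i ] x == φ i ≡ true
    cov x p with allF-false (not-elim p)
    ... | i , e = i , not-false e

  subset-of-size : ∀ d (P : VSet n) → # P ≡ d + k → Σ (VSet n) λ Q → Q ⊆ P × # Q ≡ k
  subset-of-size zero P e = P , (λ _ p → p) , e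
  subset-of-size (suc d) P e with #-pos⇒∃ {P = P} (subst (0 <_) (≡-sym e) (s≤s z≤n))
  ... | v , pv with subset-of-size d (P - v) (+-cancelˡ-≡ 1 _ _ (≡-sym (#-remove P v pv) ∙ e))
  ...   | Q , Q⊆ , #Q = Q , (λ x q → -⊆ P v x (Q⊆ x q)) , #Q

⇒-antitone : ∀ {a b c} → (b ≡ true → a ≡ true) → a ⇒ c ≡ true → b ⇒ c ≡ true
⇒-antitone f p = ⇒-intro (λ b → ⇒-elim p (f b))

-- Sums over tuples

opaque
  unfolding ∑

  ∑V : (Vec (Fin n) k → ℕ) → ℕ
  ∑V {k = zero} F = F []
  ∑V {k = suc k} F = ∑ (λ x → ∑V (λ t → F (x ∷ t)))

  ∑V-suc : (F : Vec (Fin n) (suc k) → ℕ) → ∑V F ≡ ∑ (λ x → ∑V (λ t → F (x ∷ t)))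
  ∑V-suc F = refl

  ∑V-cong : {F H : Vec (Fin n) k → ℕ} → (∀ t → F t ≡ H t) → ∑V F ≡ ∑V H
  ∑V-cong {k = zero} e = e []
  ∑V-cong {k = suc k} e = ∑-cong (λ x → ∑V-cong (λ t → e (x ∷ t)))

  ∑V-mono : {F H : Vec (Fin n) k → ℕ} → (∀ t → F t ≤ H t) → ∑V F ≤ ∑V H
  ∑V-mono {k = zero} e = e []
  ∑V-mono {k = suc k} e = ∑-mono (λ x → ∑V-mono (λ t → e (x ∷ t)))

  ∑V-+ : (F H : Vec (Fin n) k → ℕ) → ∑V (λ t → F t + H t) ≡ ∑V F + ∑V H
  ∑V-+ {k = zero} F H = refl
  ∑V-+ {k = suc k} F H = ∑-cong (λ x → ∑V-+ (λ t → F (x ∷ t)) (λ t → H (x ∷ t))) ∙ ∑-+ (λ x → ∑V (λ t → F (x ∷ t))) _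

  ∑V-* : ∀ c (F : Vec (Fin n) k → ℕ) → ∑V (λ t → c * F t) ≡ c * ∑V F
  ∑V-* {k = zero} c F = refl
  ∑V-* {k = suc k} c F = ∑-cong (λ x → ∑V-* c (λ t → F (x ∷ t))) ∙ ∑-* c (λ x → ∑V (λ t → F (x ∷ t)))

  ∑V-*ʳ : ∀ (F : Vec (Fin n) k → ℕ) c → ∑V (λ t → F t * c) ≡ ∑V F * c
  ∑V-*ʳ F c = ∑V-cong (λ t → *-comm (F t) c) ∙ ∑V-* c F ∙ *-comm c (∑V F)

  ∑V-swap : (F : Vec (Fin n) k → Fin m → ℕ) → ∑V (λ t → ∑ (F t)) ≡ ∑ (λ y → ∑V (λ t → F t y))
  ∑V-swap {k = zero} F = refl
  ∑V-swap {k = suc k} F = ∑-cong (λ x → ∑V-swap (λ t → F (x ∷ t))) ∙ ∑-swap (λ x y → ∑V (λ t → F (x ∷ t) y))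

  ∑V-*-swap : (c : Vec (Fin n) k → ℕ) (F : Vec (Fin n) k → Fin m → Fin N → ℕ) →
    ∑V (λ t → c t * ∑ (λ i → ∑ (F t i))) ≡ ∑ (λ i → ∑ (λ j → ∑V (λ t → c t * F t i j)))
  ∑V-*-swap c F = ∑V-cong (λ t → ≡-sym (∑-* (c t) (λ i → ∑ (F t i))) ∙ ∑-cong (λ i → ≡-sym (∑-* (c t) (F t i)))) ∙
    ∑V-swap (λ t i → ∑ (λ j → c t * F t i j)) ∙ ∑-cong (λ i → ∑V-swap (λ t j → c t * F t i j))

  ∑V-*-bound : (c : Vec (Fin n) k → ℕ) (F : Vec (Fin n) k → Fin m → Fin N → ℕ) {b : ℕ} →
    (∀ i j → ∑V (λ t → c t * F t i j) ≤ b) → ∑V (λ t → c t * ∑ (λ i → ∑ (F t i))) ≤ m * (N * b)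
  ∑V-*-bound {m = m} {N} c F {b} p = ≡≤ (∑V-*-swap c F)
    (≤-trans (∑-mono (λ i → ∑-mono (p i))) (≤-reflexive (∑-cong {m} (λ i → ∑-const N b) ∙ ∑-const m (N * b))))

  ∑V-<⇒∃ : {F H : Vec (Fin n) k → ℕ} → ∑V F < ∑V H → ∃[ t ] F t < H t
  ∑V-<⇒∃ {k = zero} p = [] , p
  ∑V-<⇒∃ {k = suc k} {F = F} {H} p with ∑-<⇒∃ {f = λ x → ∑V (λ t → F (x ∷ t))} {g = λ x → ∑V (λ t → H (x ∷ t))} p
  ... | x , q with ∑V-<⇒∃ {F = λ t → F (x ∷ t)} {H = λ t → H (x ∷ t)} q
  ...   | t , r = x ∷ t , r

  term≤∑V : (F : Vec (Fin n) k → ℕ) → ∀ t → F t ≤ ∑V F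
  term≤∑V {k = zero} F [] = ≤-refl
  term≤∑V {k = suc k} F (x ∷ t) = ≤-trans (term≤∑V (λ t → F (x ∷ t)) t) (term≤∑ (λ x → ∑V (λ t → F (x ∷ t))) x)

  -- Summing over the entry in position `i` innermost is how one conditions on all other entries,
  -- both for bad tuples and for random colourings.
  ∑V-insertAt : (i : Fin (suc k)) (F : Vec (Fin n) (suc k) → ℕ) → ∑V F ≡ ∑V (λ t → ∑ (λ x → F (insertAt t i x)))
  ∑V-insertAt zero F = ≡-sym (∑V-swap (λ t x → F (x ∷ t)))
  ∑V-insertAt {k = suc k} (suc i) F = ∑-cong (λ x → ∑V-insertAt i (λ t → F (x ∷ t)))

insertAt-other : ∀ {A : Set} (t : Vec A k) i {x y : A} u → u ≢ i → lookup (insertAt t i x) u ≡ lookup (insertAt t i y) u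
insertAt-other t zero zero p = ⊥-elim (p refl)
insertAt-other t zero (suc u) p = refl
insertAt-other (z ∷ t) (suc i) zero p = refl
insertAt-other (z ∷ t) (suc i) (suc u) p = insertAt-other t i u (p ∘ cong suc)

opaque
  unfolding ∑

  -- A non-empty sum offers an index to work with; in `few-bad` it is the entry by which the set `W`
  -- is written down.
  ∑-bound : {f : Fin n → ℕ} {c : ℕ} → (Fin n → ∑ f ≤ c) → ∑ f ≤ c
  ∑-bound {zero} b = z≤n
  ∑-bound {suc n} b = b zero

  ∧-rearrange : ∀ z g a r o → (z ∧ (g ∧ a)) ∧ (r ∧ o) ≡ o ∧ (((z ∧ a) ∧ r) ∧ g)
  ∧-rearrange false g a r false = refl
  ∧-rearrange false g a r true = refl
  ∧-rearrange true false a r false = refl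
  ∧-rearrange true false true true true = refl
  ∧-rearrange true false true false true = refl
  ∧-rearrange true false false r true = refl
  ∧-rearrange true true false r false = refl
  ∧-rearrange true true false r true = refl
  ∧-rearrange true true true true true = refl
  ∧-rearrange true true true false true = refl
  ∧-rearrange true true true true false = refl
  ∧-rearrange true true true false false = refl

AM-GM : ∀ a b → 2 * a * b ≤ a * a + b * b
AM-GM a b with ≤-total a b
... | inj₁ p with m≤n⇒∃[o]m+o≡n p
...   | c , refl = ≤-trans (m≤m+n _ (c * c)) (≤-reflexive (lemma a c))
  where lemma : ∀ a c → 2 * a * (a + c) + c * c ≡ a * a + (a + c) * (a + c)
        lemma = solve-∀
AM-GM a b | inj₂ p with m≤n⇒∃[o]m+o≡n p
...   | c , refl = ≤-trans (m≤m+n _ (c * c)) (≤-reflexive (lemma b c))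
  where lemma : ∀ b c → 2 * (b + c) * b + c * c ≡ (b + c) * (b + c) + b * b
        lemma = solve-∀

-- Tuples whose entries lie in Z and are pairwise related by Γ

module Tuples {n : ℕ} (Γ : Fin n → Fin n → Bool) (Z : VSet n) where

  -- The candidates for a new first entry; `# (R t)` plays the part of a degree of the tuple `t`.
  R : Vec (Fin n) k → VSet n
  R t x = Z x ∧ allF (λ i → Γ x (lookup t i))

  Ω : Vec (Fin n) k → Bool
  Ω [] = true
  Ω (x ∷ t) = R t x ∧ Ω t

  #Ω : ℕ → ℕ
  #Ω k = ∑V {k = k} (λ t → ι (Ω t))

  pairs : VSet n → ℕ
  pairs P = ∑ (λ y → ∑ (λ x → ι ((P y ∧ P x) ∧ Γ y x)))

  R-insertAt : ∀ (t : Vec (Fin n) k) i x y → R (insertAt t i x) y ≡ true → R t y ≡ true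
  R-insertAt t i x y p = ∧-intro (∧-fst {Z y} p) (allF-intro (go t i (allF-elim (∧-snd {Z y} p))))
    where
    go : ∀ {k} (t : Vec (Fin n) k) i → (∀ u → Γ y (lookup (insertAt t i x) u) ≡ true) → ∀ u → Γ y (lookup t u) ≡ true
    go t zero q u = q (suc u)
    go (z ∷ t) (suc i) q zero = q zero
    go (z ∷ t) (suc i) q (suc u) = go t i (λ u → q (suc u)) u

  Ω-insertAt : ∀ (t : Vec (Fin n) k) i x → Ω (insertAt t i x) ≡ true → Ω t ≡ true
  Ω-insertAt t zero x p = ∧-snd p
  Ω-insertAt (y ∷ t) (suc i) x p = ∧-intro (R-insertAt t i x y (∧-fst p)) (Ω-insertAt t i x (∧-snd p))

  Ω-mem : ∀ (t : Vec (Fin n) k) → Ω t ≡ true → ∀ u → Z (lookup t u) ≡ true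
  Ω-mem (x ∷ t) p zero = ∧-fst (∧-fst p)
  Ω-mem (x ∷ t) p (suc u) = Ω-mem t (∧-snd p) u

  Ω-related : (∀ x y → Γ x y ≡ true → Γ y x ≡ true) → ∀ (t : Vec (Fin n) k) → Ω t ≡ true → ∀ u v → u ≢ v → Γ (lookup t u) (lookup t v) ≡ true
  Ω-related sy (x ∷ t) p zero zero q = ⊥-elim (q refl)
  Ω-related sy (x ∷ t) p zero (suc v) q = allF-elim (∧-snd (∧-fst {R t x} p)) v
  Ω-related sy (x ∷ t) p (suc u) zero q = sy _ _ (allF-elim (∧-snd (∧-fst {R t x} p)) u)
  Ω-related sy (x ∷ t) p (suc u) (suc v) q = Ω-related sy t (∧-snd p) u v (q ∘ cong suc)

  #Ω-suc : ∀ k → #Ω (suc k) ≡ ∑V {k = k} (λ t → ι (Ω t) * # (R t))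
  #Ω-suc k = ∑V-suc (λ t → ι (Ω t)) ∙ ≡-sym (∑V-swap {k = k} (λ t x → ι (R t x ∧ Ω t))) ∙ ∑V-cong {k = k} (λ t →
    ∑-cong (λ x → ι-∧ (R t x) (Ω t) ∙ *-comm (ι (R t x)) _) ∙ ∑-* (ι (Ω t)) (λ x → ι (R t x)))

  -- Two new first entries both lie in `R t` and are related to each other. Hence a quadratic lower
  -- bound on `pairs` bounds the second moment of `# (R t)` by the count two lengths further.
  #Ω-suc-suc : ∀ k → #Ω (suc (suc k)) ≡ ∑V {k = k} (λ t → ι (Ω t) * pairs (R t))
  #Ω-suc-suc k = ∑V-suc (λ t → ι (Ω t)) ∙
    ∑-cong (λ y → ∑V-suc (λ t → ι (Ω (y ∷ t))) ∙ ≡-sym (∑V-swap {k = k} (λ t x → ι (Ω (y ∷ x ∷ t))))) ∙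
    ≡-sym (∑V-swap {k = k} (λ t y → ∑ (λ x → ι (Ω (y ∷ x ∷ t))))) ∙ ∑V-cong {k = k} (λ t →
    ∑-cong (λ y → ∑-cong (λ x → cong ι (cong (λ b → (Z y ∧ b) ∧ Ω (x ∷ t)) (allF-suc (λ i → Γ y (lookup (x ∷ t) i))) ∙ ∧-rearrange (Z y) (Γ y x) (allF (λ i → Γ y (lookup t i))) (R t x) (Ω t)) ∙ ι-∧ (Ω t) _)
      ∙ ∑-* (ι (Ω t)) (λ x → ι ((R t y ∧ R t x) ∧ Γ y x))) ∙ ∑-* (ι (Ω t)) (λ y → ∑ (λ x → ι ((R t y ∧ R t x) ∧ Γ y x))))

  opaque
    unfolding ∑V

    #Ω-zero : #Ω 0 ≡ 1
    #Ω-zero = refl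

    #Ω-one : #Ω 1 ≡ # Z
    #Ω-one = ∑-cong (λ x → cong ι (lemma (Z x)))
      where lemma : ∀ b → (b ∧ true) ∧ true ≡ b
            lemma true = refl
            lemma false = refl

  -- The average number of extensions of a tuple drops by at most the factor 2λ′ from one
  -- length to the next: extensions of t by two related vertices are counted by pairs (R t),
  -- which is at least quadratic in # (R t).
  module Growth {λ′ ν : ℕ} (λ′>0 : 0 < λ′)
    (Ψ : ∀ P → P ⊆ Z → # P * # P ≤ λ′ * pairs P + ν) where

    growth : ∀ r γ → 0 < γ → 2 * ν ≤ γ * γ → (2 * λ′) ^ r * γ ≤ # Z → γ * #Ω r ≤ #Ω (suc r) × 0 < #Ω r
    growth zero γ γ>0 _ γ≤Z rewrite #Ω-zero | #Ω-one =
      ≡≤ (*-identityʳ γ) (≡≤ (≡-sym (+-identityʳ γ)) γ≤Z) , s≤s z≤n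
    -- The shorter length is used with a threshold larger by the factor 2λ′ that this step loses:
    -- (2λ′)^(r+1) γ = (2λ′)^r γ′.
    growth (suc r) γ γ>0 ν≤ γ≤Z with growth r (2 * λ′ * γ) γ′>0
        (≤-trans ν≤ (*-mono-≤ γ≤γ′ γ≤γ′)) (≡≤ (lemma ((2 * λ′) ^ r) (2 * λ′) γ) γ≤Z)
      where
      γ′>0 : 0 < 2 * λ′ * γ
      γ′>0 = *-pos (*-pos {2} (s≤s z≤n) λ′>0) γ>0
      γ≤γ′ : γ ≤ 2 * λ′ * γ
      γ≤γ′ = ≡≤ (≡-sym (+-identityʳ γ)) (*-monoˡ-≤ γ (*-pos {2} (s≤s z≤n) λ′>0))
      lemma : ∀ p q g → p * (q * g) ≡ q * p * g
      lemma = solve-∀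
    ... | IH , pos = ≤-cancel (2 * λ′) (*-pos {2} (s≤s z≤n) λ′>0) final , pos′
      where
      γ′ = 2 * λ′ * γ
      γ≤γ′ : γ ≤ γ′
      γ≤γ′ = ≡≤ (≡-sym (+-identityʳ γ)) (*-monoˡ-≤ γ (*-pos {2} (s≤s z≤n) λ′>0))
      a = #Ω r
      b = #Ω (suc r)
      c = #Ω (suc (suc r))
      pos′ : 0 < b
      pos′ = ≤-trans (*-pos (≤-trans γ>0 γ≤γ′) pos) IH
      Q : ℕ
      Q = ∑V {k = r} (λ t → ι (Ω t) * (# (R t) * # (R t)))
      upper : Q ≤ λ′ * c + ν * a
      upper = begin
        Q ≤⟨ ∑V-mono (λ t → *-monoʳ-≤ (ι (Ω t)) (Ψ (R t) (λ x p → ∧-fst p))) ⟩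
        ∑V (λ t → ι (Ω t) * (λ′ * pairs (R t) + ν)) ≡⟨ ∑V-cong (λ t → lemma (ι (Ω t)) λ′ (pairs (R t)) ν) ⟩
        ∑V (λ t → λ′ * (ι (Ω t) * pairs (R t)) + ν * ι (Ω t)) ≡⟨ ∑V-+ (λ t → λ′ * (ι (Ω t) * pairs (R t))) _ ⟩
        ∑V (λ t → λ′ * (ι (Ω t) * pairs (R t))) + ∑V (λ t → ν * ι (Ω t)) ≡⟨ cong₂ _+_ (∑V-* λ′ (λ t → ι (Ω t) * pairs (R t)) ∙ cong (λ′ *_) (≡-sym (#Ω-suc-suc r))) (∑V-* ν (λ t → ι (Ω t))) ⟩
        λ′ * c + ν * a ∎
        where
        open ≤-Reasoning
        lemma : ∀ o l p v → o * (l * p + v) ≡ l * (o * p) + v * o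
        lemma = solve-∀
      -- The tangent 2γ′x ≤ x² + γ′² replaces Cauchy-Schwarz without any division. By induction γ′a
      -- ≤ b, so the error γ′²a is at most half of the left side.
      lower : 2 * γ′ * b ≤ Q + γ′ * γ′ * a
      lower = begin
        2 * γ′ * b ≡⟨ cong (2 * γ′ *_) (#Ω-suc r) ∙ ≡-sym (∑V-* (2 * γ′) (λ t → ι (Ω t) * # (R t))) ⟩
        ∑V (λ t → 2 * γ′ * (ι (Ω t) * # (R t))) ≤⟨ ∑V-mono (λ t → ≡≤ (l₁ γ′ (ι (Ω t)) (# (R t))) (*-monoʳ-≤ (ι (Ω t)) (AM-GM (# (R t)) γ′))) ⟩
        ∑V (λ t → ι (Ω t) * (# (R t) * # (R t) + γ′ * γ′)) ≡⟨ ∑V-cong (λ t → l₂ (ι (Ω t)) (# (R t)) γ′) ⟩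
        ∑V (λ t → ι (Ω t) * (# (R t) * # (R t)) + γ′ * γ′ * ι (Ω t)) ≡⟨ ∑V-+ (λ t → ι (Ω t) * (# (R t) * # (R t))) _ ∙ cong (Q +_) (∑V-* (γ′ * γ′) (λ t → ι (Ω t))) ⟩
        Q + γ′ * γ′ * a ∎
        where
        open ≤-Reasoning
        l₁ : ∀ g o x → 2 * g * (o * x) ≡ o * (2 * x * g)
        l₁ = solve-∀
        l₂ : ∀ o x g → o * (x * x + g * g) ≡ o * (x * x) + g * g * o
        l₂ = solve-∀
      ga : γ′ * γ′ * a ≤ γ′ * b
      ga = ≡≤ (*-assoc γ′ γ′ a) (*-monoʳ-≤ γ′ IH)
      νa : 2 * ν * a ≤ γ′ * b
      νa = ≤-trans (*-monoˡ-≤ a (≤-trans ν≤ (*-mono-≤ γ≤γ′ γ≤γ′))) ga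
      total : γ′ * b ≤ λ′ * c + ν * a
      total = ≤-by (+-mono-≤ lower (+-mono-≤ ga upper)) 0 (l (γ′ * b) Q (γ′ * γ′ * a) (λ′ * c) (ν * a) ∙ cong (λ z → λ′ * c + ν * a + (z + (γ′ * γ′ * a + Q))) (≡-sym (*-assoc 2 γ′ b)))
        where l : ∀ x q y p v → x + (q + y + (x + (p + v))) + 0 ≡ p + v + (2 * x + (y + q))
              l = solve-∀
      final : 2 * λ′ * (γ * b) ≤ 2 * λ′ * c
      final = ≤-by (+-mono-≤ total (+-mono-≤ total νa)) 0 (l λ′ γ b c ν a)
        where l : ∀ l g b c v a → 2 * l * (g * b) + (l * c + v * a + (l * c + v * a + 2 * l * g * b)) + 0 ≡ 2 * l * c + (2 * l * g * b + (2 * l * g * b + 2 * v * a))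
              l = solve-∀

-- Closed neighbourhoods and the domination condition

module Domination {n : ℕ} (G : Graph n) where

  adj⁼ : Fin n → Fin n → Bool
  adj⁼ x y = adj G x y ∨ (x == y)

  adj⁼-false : ∀ {x y} → adj⁼ x y ≡ false → adj G x y ≡ false × x ≢ y
  adj⁼-false p = proj₁ (∨-false p) , ==-false (proj₂ (∨-false p))

  adj⁼-false-intro : ∀ {x y} → adj G x y ≡ false → x ≢ y → adj⁼ x y ≡ false
  adj⁼-false-intro p q = ≢true (λ r → [ (λ a → true≢false a p) , (λ e → q (==-elim e)) ]′ (∨-elim r))

  adj⁼-sym : ∀ {x y} → adj⁼ x y ≡ false → adj⁼ y x ≡ false
  adj⁼-sym {x} {y} p with adj⁼-false p
  ... | a , b = adj⁼-false-intro (trans (sym G y x) a) (b ∘ ≡-sym)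

  _∖_ : VSet n → Fin n → VSet n
  (W ∖ x) y = W y ∧ not (adj⁼ x y)

  Dominating : ℕ → VSet n → VSet n
  Dominating l W x = l * # (W ∖ x) <ᵇ # W

  -- The form in which sparsity of `G` enters the embedding, with l = 2s in the dense case and l = 2
  -- in the locally sparse one.
  Dom : ℕ → ℕ → ℕ → Set
  Dom l w τ = ∀ W → w ≤ # W → # (Dominating l W) ≤ τ

  -- Each of the s vertices misses less than 1/2s of `W`, so together they miss at most half of it.
  -- Closed neighbourhoods also count the s vertices themselves; from |W| ≥ 4s at least 2s - s
  -- common neighbours remain.
  dominated⇒Kss : ∀ s W → 4 * s ≤ # W → (f : Fin s → Fin n) → Injective _≡_ _≡_ f →
    (∀ i → Dominating (2 * s) W (f i) ≡ true) → ContainsKss s G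
  dominated⇒Kss s W 4s≤W f f-inj f-dom = f , g , f-inj , proj₁ (proj₂ chosen) ,
    (λ i j e → true≢false (subst (λ z → adj G (f i) z ≡ true) (≡-sym e) (edge i j)) (irrefl G (f i))) , edge
    where
    C : VSet n
    C y = W y ∧ allF (λ i → adj G (f i) y)
    missed : ∀ s {f : Fin s → Fin n} → (∀ i → Dominating (2 * s) W (f i) ≡ true) → 2 * ∑ (λ i → # (W ∖ f i)) ≤ # W
    missed zero {f} _ = ≡≤ (cong (2 *_) (∑-empty (λ i → # (W ∖ f i)))) z≤n
    missed (suc s) {f} d = ≤-cancel (suc s) (s≤s z≤n) (begin
      suc s * (2 * ∑ (λ i → # (W ∖ f i))) ≡⟨ l (suc s) (∑ (λ i → # (W ∖ f i))) ∙ ≡-sym (∑-* (2 * suc s) (λ i → # (W ∖ f i))) ⟩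
      ∑ (λ i → 2 * suc s * # (W ∖ f i)) ≤⟨ ∑-mono (λ i → <⇒≤ (<ᵇ-elim (d i))) ⟩
      ∑ {suc s} (λ i → # W) ≡⟨ ∑-const (suc s) (# W) ⟩
      suc s * # W ∎)
      where open ≤-Reasoning
            l : ∀ a b → a * (2 * b) ≡ 2 * a * b
            l = solve-∀
    cover : # W ≤ # C + (s + ∑ (λ i → # (W ∖ f i)))
    cover = ≤-trans (#-cover {Q = C} {R = λ y → W y ∧ not (C y)} split) (+-monoʳ-≤ (# C)
      (≤-trans (#-cover {Q = λ x → not (allF (λ i → not (x == f i)))} {R = λ x → not (allF (λ i → not ((W ∖ f i) x)))} split′)
        (+-mono-≤ (image-count f) (#-cover∑ {Q = λ i → W ∖ f i} split″))))
      where
      split : ∀ x → W x ≡ true → C x ≡ true ⊎ (W x ∧ not (C x)) ≡ true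
      split x w with bool (C x)
      ... | inj₁ c = inj₁ c
      ... | inj₂ c = inj₂ (∧-intro w (not-intro c))
      split′ : ∀ x → W x ∧ not (C x) ≡ true → not (allF (λ i → not (x == f i))) ≡ true ⊎ not (allF (λ i → not ((W ∖ f i) x))) ≡ true
      split′ x p with bool (allF (λ i → not (x == f i)))
      ... | inj₂ q = inj₁ (not-intro q)
      ... | inj₁ q with bool (allF (λ i → adj G (f i) x))
      ...   | inj₁ a = true≢false (∧-intro (∧-fst p) a) (not-elim (∧-snd p))
      ...   | inj₂ a with allF-false a
      ...     | i , e = inj₂ (not-intro (≢true (λ r → true≢false (∧-intro (∧-fst p)
                  (not-intro (adj⁼-false-intro e (λ { refl → true≢false (==-refl (f i)) (not-elim (allF-elim q i)) })))) (not-elim (allF-elim r i)))))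
      split″ : ∀ x → not (allF (λ i → not ((W ∖ f i) x))) ≡ true → ∃[ i ] (W ∖ f i) x ≡ true
      split″ x p with allF-false (not-elim p)
      ... | i , e = i , not-false e
    s≤C : s ≤ # C
    s≤C = ≤-cancel 2 (s≤s z≤n) (≤-by (+-mono-≤ 4s≤W (+-mono-≤ cover (+-mono-≤ cover (missed s f-dom)))) 0
      (l s (# C) (# W) (∑ (λ i → # (W ∖ f i)))))
      where l : ∀ s c w e → 2 * s + (w + (c + (s + e) + (c + (s + e) + w))) + 0 ≡ 2 * c + (4 * s + (w + (w + 2 * e)))
            l = solve-∀
    chosen : Σ (Fin s → Fin n) λ g → Injective _≡_ _≡_ g × (∀ i → C (g i) ≡ true)
    chosen = choose C s≤C
    g = proj₁ chosen
    edge : ∀ i j → adj G (f i) (g j) ≡ true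
    edge i j = allF-elim (∧-snd {W (g j)} (proj₂ (proj₂ chosen) j)) i

  Kss-free⇒Dom : ∀ s → ¬ ContainsKss s G → Dom (2 * s) (4 * s) s
  Kss-free⇒Dom s free W 4s≤W with # (Dominating (2 * s) W) ≤? s
  ... | yes p = p
  ... | no p = ⊥-elim (free (dominated⇒Kss s W 4s≤W (proj₁ f) (proj₁ (proj₂ f)) (proj₂ (proj₂ f))))
    where f = choose (Dominating (2 * s) W) (<⇒≤ (≰⇒> p))

  module Greedy {l w τ β : ℕ} (dom : Dom l w τ) (l>0 : 0 < l) (w≤β : w ≤ β) where

    β≤ : ∀ m → β ≤ l ^ m * β
    β≤ m = ≡≤ (≡-sym (+-identityʳ β)) (*-monoˡ-≤ β (^-pos l>0 m))

    -- Greedy choice: fewer than β vertices dominate one of the later sets, and any other vertex of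
    -- the first set leaves to each of them a 1/l fraction outside its closed neighbourhood. The
    -- sets may overlap; it is the closed neighbourhoods that make the chosen vertices distinct.
    transversal : ∀ m → m * τ < β → (W : Fin m → VSet n) → (∀ i → l ^ m * β ≤ # (W i)) →
      Σ (Fin m → Fin n) λ z → (∀ i → W i (z i) ≡ true) × (∀ i j → i ≢ j → adj⁼ (z i) (z j) ≡ false)
    transversal zero _ W _ = (λ ()) , (λ ()) , (λ ())
    transversal (suc m) mτ<β W big = z , z∈ , z-indep
      where
      bad : VSet n
      bad x = not (allF (λ i → not (Dominating l (W (suc i)) x)))
      #bad : # bad ≤ m * τ
      #bad = ≤-trans (#-cover∑ {Q = λ i → Dominating l (W (suc i))} cov)
        (≤-trans (∑-mono (λ i → dom (W (suc i)) (≤-trans w≤β (≤-trans (β≤ (suc m)) (big (suc i)))))) (≤-reflexive (∑-const m τ)))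
        where
        cov : ∀ x → bad x ≡ true → ∃[ i ] Dominating l (W (suc i)) x ≡ true
        cov x p with allF-false (not-elim p)
        ... | i , e = i , not-false e
      pick : ∃[ x ] W zero x ≡ true × bad x ≡ false
      pick = #-<⇒∃ (≤-<-trans #bad (≤-trans (≤-<-trans (m≤n+m (m * τ) τ) mτ<β) (≤-trans (β≤ (suc m)) (big zero))))
      z₀ = proj₁ pick
      good : ∀ i → # (W (suc i)) ≤ l * # (W (suc i) ∖ z₀)
      good i = <ᵇ-false (not-elim (allF-elim (not-false (proj₂ (proj₂ pick))) i))
      rest = transversal m (≤-<-trans (m≤n+m (m * τ) τ) mτ<β) (λ i → W (suc i) ∖ z₀)
        (λ i → ≤-cancel l l>0 (≡≤ (≡-sym (*-assoc l (l ^ m) β)) (≤-trans (big (suc i)) (good i))))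
      z : Fin (suc m) → Fin n
      z zero = z₀
      z (suc i) = proj₁ rest i
      z∈ : ∀ i → W i (z i) ≡ true
      z∈ zero = proj₁ (proj₂ pick)
      z∈ (suc i) = ∧-fst (proj₁ (proj₂ rest) i)
      z₀-indep : ∀ i → adj⁼ z₀ (z (suc i)) ≡ false
      z₀-indep i = not-elim (∧-snd {W (suc i) (z (suc i))} (proj₁ (proj₂ rest) i))
      z-indep : ∀ i j → i ≢ j → adj⁼ (z i) (z j) ≡ false
      z-indep zero zero p = ⊥-elim (p refl)
      z-indep zero (suc j) p = z₀-indep j
      z-indep (suc i) zero p = adj⁼-sym (z₀-indep i)
      z-indep (suc i) (suc j) p = proj₂ (proj₂ rest) i j (p ∘ cong suc)

  joined : (Fin k → Bool) → Vec (Fin n) k → VSet n → VSet n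
  joined S t Y y = Y y ∧ allF (λ u → S u ⇒ adj G (lookup t u) y)

  Embedding : (Fin n → Fin n → Bool) → VSet n → (Fin m → Fin k → Bool) → VSet n → Set
  Embedding {m} {k} Γ Z S Y = ∃[ t ] Tuples.Ω Γ Z {k} t ≡ true × Σ (Fin m → Fin n) λ z →
    (∀ j → Y (z j) ≡ true) × (∀ i j → i ≢ j → adj⁼ (z i) (z j) ≡ false) ×
    (∀ j u → S j u ≡ true → adj G (lookup t u) (z j) ≡ true) ×
    (∀ j u → S j u ≡ false → adj⁼ (lookup t u) (z j) ≡ false)

  -- A random tuple of `Ω` works. Given its other entries, an entry takes at least γ > mhτ values on
  -- average, by `growth`, while for each of the mh pairs of a pattern and a position at most τ
  -- values are bad. Without bad entries each pattern set loses at most a factor l per entry, and a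
  -- transversal of these sets finishes.
  module PatternEmbedding {r m l w τ λ′ ν β γ : ℕ} (dom : Dom l w τ) (l>0 : 0 < l) (λ′>0 : 0 < λ′)
    (Γ : Fin n → Fin n → Bool) (Z : VSet n)
    (Ψ : ∀ P → P ⊆ Z → # P * # P ≤ λ′ * Tuples.pairs Γ Z P + ν)
    (S : Fin m → Fin (suc r) → Bool) (Y : VSet n)
    (rich : ∀ t → Tuples.Ω Γ Z t ≡ true → ∀ j → l ^ suc r * (l ^ m * β) ≤ # (joined (S j) t Y))
    (w≤β : w ≤ β) (mτ<β : m * τ < β)
    (2ν≤γ² : 2 * ν ≤ γ * γ) (mhτ<γ : m * (suc r * τ) < γ) (γ≤Z : (2 * λ′) ^ r * γ ≤ # Z) where

    h : ℕ
    h = suc r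

    open Tuples Γ Z
    open Greedy {l} {w} {τ} {β} dom l>0 w≤β
    open Growth λ′>0 Ψ

    -- The non-adjacencies are imposed one entry at a time; every step which is not bad
    -- keeps a 1/l fraction.
    pat : Fin m → ℕ → Vec (Fin n) h → VSet n
    pat j k t y = joined (S j) t Y y ∧ allF (λ u → ((toℕ u <ᵇ k) ∧ not (S j u)) ⇒ not (adj⁼ (lookup t u) y))

    -- The guard says w ≤ `# (pat j (toℕ k) t)`, the range in which `Dom` applies; in `pat-big` it
    -- always holds.
    bad : Fin m → Fin h → Vec (Fin n) h → Bool
    bad j k t = not (S j k) ∧ ((w <ᵇ suc (# (pat j (toℕ k) t))) ∧ Dominating l (pat j (toℕ k) t) (lookup t k))

    -- Adjacency to entry `k` is not demanded, and non-adjacency has been imposed on earlier entries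
    -- only. So the set which entry `k` must not dominate is determined by the other entries.
    pat-insertAt : ∀ j k → S j k ≡ false → ∀ t x x′ y → pat j (toℕ k) (insertAt t k x) y ≡ pat j (toℕ k) (insertAt t k x′) y
    pat-insertAt j k jk t x x′ y = cong₂ _∧_ (cong (Y y ∧_) (allF-cong e₁)) (allF-cong e₂)
      where
      e₁ : ∀ u → S j u ⇒ adj G (lookup (insertAt t k x) u) y ≡ S j u ⇒ adj G (lookup (insertAt t k x′) u) y
      e₁ u with u ≟ k
      ... | yes refl = ⇒-false jk ∙ ≡-sym (⇒-false jk)
      ... | no u≢k = cong (λ v → S j u ⇒ adj G v y) (insertAt-other t k u u≢k)
      e₂ : ∀ u → ((toℕ u <ᵇ toℕ k) ∧ not (S j u)) ⇒ not (adj⁼ (lookup (insertAt t k x) u) y) ≡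
                 ((toℕ u <ᵇ toℕ k) ∧ not (S j u)) ⇒ not (adj⁼ (lookup (insertAt t k x′) u) y)
      e₂ u with u ≟ k
      ... | yes refl = ⇒-false k≮k ∙ ≡-sym (⇒-false k≮k)
        where k≮k = ≢true (λ p → <-irrefl refl (<ᵇ-elim {toℕ k} (∧-fst p)))
      ... | no u≢k = cong (λ v → ((toℕ u <ᵇ toℕ k) ∧ not (S j u)) ⇒ not (adj⁼ v y)) (insertAt-other t k u u≢k)

    -- Fixing all entries but the `k`-th fixes the set `W`, which at most τ values of the `k`-th
    -- entry dominate; the other entries again form a tuple of `Ω`.
    few-bad : ∀ j k → ∑V (λ t → ι (Ω t) * ι (bad j k t)) ≤ τ * #Ω r
    few-bad j k = begin
      ∑V (λ t → ι (Ω t) * ι (bad j k t)) ≡⟨ ∑V-insertAt k _ ⟩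
      ∑V (λ t → ∑ (λ x → ι (Ω (insertAt t k x)) * ι (bad j k (insertAt t k x)))) ≤⟨ ∑V-mono section ⟩
      ∑V (λ t → τ * ι (Ω t)) ≡⟨ ∑V-* τ (λ t → ι (Ω t)) ⟩
      τ * #Ω r ∎
      where
      open ≤-Reasoning
      bads : ∀ t → ∑ (λ x → ι (bad j k (insertAt t k x))) ≤ τ
      bads t = ∑-bound λ x₀ → main x₀
        where
        main : Fin n → ∑ (λ x → ι (bad j k (insertAt t k x))) ≤ τ
        main x₀ with bool (S j k)
        ... | inj₁ jk = ≡≤ (∑-zero (λ x → ι-false (≢true (λ q → true≢false jk (not-elim (∧-fst q)))))) z≤n
        ... | inj₂ jk = go (w ≤? # W)
          where
          W = pat j (toℕ k) (insertAt t k x₀)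
          same : ∀ x → # (pat j (toℕ k) (insertAt t k x)) ≡ # W
          same x = #-cong (pat-insertAt j k jk t x x₀)
          go : Dec (w ≤ # W) → ∑ (λ x → ι (bad j k (insertAt t k x))) ≤ τ
          go (yes p) = ≤-trans (#-mono {P = λ x → bad j k (insertAt t k x)} {Q = Dominating l W} sub) (dom W p)
            where
            sub : (λ x → bad j k (insertAt t k x)) ⊆ Dominating l W
            sub x q = subst (λ v → Dominating l W v ≡ true) (insertAt-lookup t k x)
              (trans (cong₂ (λ a b → l * a <ᵇ b) (#-cong (λ y → cong (_∧ not (adj⁼ (lookup (insertAt t k x) k) y)) (≡-sym (pat-insertAt j k jk t x x₀ y)))) (≡-sym (same x)))
                (∧-snd (∧-snd {not (S j k)} q)))
          go (no p) = ≡≤ (∑-zero (λ x → ι-false (≢true {bad j k (insertAt t k x)} (λ q →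
            p (subst (w ≤_) (same x) (≤-pred (<ᵇ-elim (∧-fst (∧-snd {not (S j k)} q))))))))) z≤n
      section : ∀ t → ∑ (λ x → ι (Ω (insertAt t k x)) * ι (bad j k (insertAt t k x))) ≤ τ * ι (Ω t)
      section t = ≤-trans (∑-mono (λ x → *-monoˡ-≤ (ι (bad j k (insertAt t k x))) (ι-mono (Ω-insertAt t k x))))
        (≡≤ (∑-* (ι (Ω t)) (λ x → ι (bad j k (insertAt t k x))))
        (≤-trans (*-monoʳ-≤ (ι (Ω t)) (bads t)) (≤-reflexive (*-comm (ι (Ω t)) τ))))

    badness : Vec (Fin n) h → ℕ
    badness t = ∑ (λ j → ∑ (λ k → ι (bad j k t)))

    few : ∑V {k = h} (λ t → ι (Ω t) * badness t) < #Ω h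
    few = ≤-<-trans (∑V-*-bound {k = h} (λ t → ι (Ω t)) (λ t j k → ι (bad j k t)) few-bad)
      (≤-trans (≤-<-trans (≤-reflexive (lemma m h τ (#Ω r))) (*-monoˡ-< (#Ω r) {{>-nonZero (proj₂ gr)}} mhτ<γ)) (proj₁ gr))
      where
      gr : γ * #Ω r ≤ #Ω (suc r) × 0 < #Ω r
      gr = growth r γ (≤-<-trans z≤n mhτ<γ) 2ν≤γ² γ≤Z
      lemma : ∀ a b c d → a * (b * (c * d)) ≡ a * (b * c) * d
      lemma = solve-∀

    good-tuple : ∃[ t ] Ω {k = h} t ≡ true × badness t ≡ 0
    good-tuple = t , Ωt , n<1⇒n≡0 (subst₂ _<_ (cong (λ z → z * badness t) (ι-true Ωt) ∙ +-identityʳ (badness t)) (ι-true Ωt) q)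
      where
      found : ∃[ t ] ι (Ω t) * badness t < ι (Ω t)
      found = ∑V-<⇒∃ {k = h} {F = λ t → ι (Ω t) * badness t} {H = λ t → ι (Ω t)} few
      t = proj₁ found
      q = proj₂ found
      Ωt = ι-pos (≤-<-trans z≤n q)

    not-bad : ∀ t → badness t ≡ 0 → ∀ j k → bad j k t ≡ false
    not-bad t b≡0 j k = ≢true (λ p → 1+n≰n {0} (begin
      1 ≡⟨ ≡-sym (ι-true p) ⟩
      ι (bad j k t) ≤⟨ term≤∑ (λ k → ι (bad j k t)) k ⟩
      ∑ (λ k → ι (bad j k t)) ≤⟨ term≤∑ (λ j → ∑ (λ k → ι (bad j k t))) j ⟩
      badness t ≡⟨ b≡0 ⟩
      0 ∎))
      where open ≤-Reasoning

    -- `e` counts the entries still to be treated, each of which may cost a factor l; the factor l^m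
    -- β is reserved for the transversal.
    pat-big : ∀ t → Ω {k = h} t ≡ true → (∀ j k → bad j k t ≡ false) → ∀ j e k → e + k ≡ h → l ^ e * (l ^ m * β) ≤ # (pat j k t)
    pat-big t Ωt nb j e zero eq = ≤-trans (subst (λ e → l ^ e * (l ^ m * β) ≤ # (joined (S j) t Y)) (trans (≡-sym eq) (+-identityʳ e)) (rich t Ωt j))
      (#-mono {P = joined (S j) t Y} {Q = pat j 0 t} (λ y p → ∧-intro p (allF-intro (λ u → ⇒-intro (λ q → ⊥-elim (n≮0 (<ᵇ-elim {toℕ u} (∧-fst q))))))))
    pat-big t Ωt nb j e (suc k) eq = ≤-cancel l l>0 (≡≤ (≡-sym (*-assoc l (l ^ e) _)) (≤-trans prev step))
      where
      prev : l ^ suc e * (l ^ m * β) ≤ # (pat j k t)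
      prev = pat-big t Ωt nb j (suc e) k (trans (≡-sym (+-suc e k)) eq)
      k<h : k < h
      k<h = ≤-trans (m≤n+m (suc k) e) (≤-reflexive eq)
      κ = fromℕ< k<h
      κ≡k : toℕ κ ≡ k
      κ≡k = toℕ-fromℕ< k<h
      w≤ : w ≤ # (pat j k t)
      w≤ = ≤-trans w≤β (≤-trans (β≤ m) (≤-trans (≡≤ (≡-sym (+-identityʳ _)) (*-monoˡ-≤ _ (^-pos l>0 (suc e)))) prev))
      <suc : ∀ u → (toℕ u <ᵇ suc k) ≡ true → (toℕ u <ᵇ k) ≡ true ⊎ u ≡ κ
      <suc u p with m≤n⇒m<n∨m≡n (≤-pred (<ᵇ-elim {toℕ u} p))
      ... | inj₁ q = inj₁ (<ᵇ-intro q)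
      ... | inj₂ q = inj₂ (toℕ-injective (trans q (≡-sym κ≡k)))
      step : # (pat j k t) ≤ l * # (pat j (suc k) t)
      step with bool (S j κ)
      ... | inj₁ jκ = ≤-trans (#-mono {Q = pat j (suc k) t} sub) (≡≤ (≡-sym (+-identityʳ _)) (*-monoˡ-≤ _ l>0))
        where
        sub : pat j k t ⊆ pat j (suc k) t
        sub y p = ∧-intro (∧-fst p) (allF-intro (λ u → ⇒-antitone
          (λ q → ∧-intro ([ id , (λ { refl → true≢false jκ (not-elim (∧-snd {toℕ u <ᵇ suc k} q)) }) ]′ (<suc u (∧-fst q))) (∧-snd {toℕ u <ᵇ suc k} q))
          (allF-elim (∧-snd {joined (S j) t Y y} p) u)))
      ... | inj₂ jκ = ≤-trans big (*-monoʳ-≤ l (#-mono {Q = pat j (suc k) t} sub))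
        where
        big : # (pat j k t) ≤ l * # (pat j k t ∖ lookup t κ)
        big = <ᵇ-false (≢true (λ q → true≢false (∧-intro (not-intro jκ) (∧-intro
          (<ᵇ-intro (s≤s (subst (λ i → w ≤ # (pat j i t)) (≡-sym κ≡k) w≤)))
          (subst (λ i → Dominating l (pat j i t) (lookup t κ) ≡ true) (≡-sym κ≡k) q))) (nb j κ)))
        sub : (pat j k t ∖ lookup t κ) ⊆ pat j (suc k) t
        sub y p = ∧-intro (∧-fst pk) (allF-intro (λ u → ⇒-intro (λ q →
          [ (λ u<k → ⇒-elim (allF-elim (∧-snd {joined (S j) t Y y} pk) u) (∧-intro u<k (∧-snd {toℕ u <ᵇ suc k} q)))
          , (λ { refl → ∧-snd {pat j k t y} p }) ]′ (<suc u (∧-fst q)))))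
          where pk = ∧-fst p

    pattern-embedding : Embedding Γ Z S Y
    pattern-embedding = from-good (proj₁ good-tuple) (proj₁ (proj₂ good-tuple)) (proj₂ (proj₂ good-tuple))
      where
      from-good : ∀ t → Ω {k = h} t ≡ true → badness t ≡ 0 → Embedding Γ Z S Y
      from-good t Ωt b≡0 = t , Ωt , z ,
        (λ j → ∧-fst (joined-z j)) , proj₂ (proj₂ chosen) ,
        (λ j u p → ⇒-elim (allF-elim (∧-snd {Y (z j)} (joined-z j)) u) p) ,
        (λ j u p → not-elim (⇒-elim (allF-elim (∧-snd {joined (S j) t Y (z j)} (z∈ j)) u) (∧-intro (<ᵇ-intro (toℕ<n u)) (not-intro p))))
        where
        chosen = transversal m mτ<β (λ j → pat j h t)
          (λ j → ≡≤ (≡-sym (+-identityʳ _)) (pat-big t Ωt (not-bad t b≡0) j 0 h refl))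
        z : Fin m → Fin n
        z = proj₁ chosen
        z∈ : ∀ j → pat j h t (z j) ≡ true
        z∈ = proj₁ (proj₂ chosen)
        joined-z : ∀ j → joined (S j) t Y (z j) ≡ true
        joined-z j = ∧-fst (z∈ j)

-- Paths given by their interior vertices

vtxOf : V → (ℓ : List V) → V → Fin (suc (suc (length ℓ))) → V
vtxOf x ℓ y zero = x
vtxOf x [] y (suc zero) = y
vtxOf x (z ∷ ℓ) y (suc i) = vtxOf z ℓ y i

-- Consecutive vertices form an inductive family instead of being given by positions, so that
-- prolonging and weaving paths needs no index arithmetic.
data Step {V : Set} : V → List V → V → V → V → Set where
  last : ∀ {x y} → Step x [] y x y
  here : ∀ {x y z ℓ} → Step x (z ∷ ℓ) y x z
  there : ∀ {x y z ℓ p q} → Step z ℓ y p q → Step x (z ∷ ℓ) y p q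

vtxOf-end : ∀ (x : V) ℓ y → vtxOf x ℓ y (fromℕ (suc (length ℓ))) ≡ y
vtxOf-end x [] y = refl
vtxOf-end x (z ∷ ℓ) y = vtxOf-end z ℓ y

vtxOf-interior : ∀ (x : V) ℓ y j → vtxOf x ℓ y (suc (inject₁ j)) ∈ ℓ
vtxOf-interior x (z ∷ ℓ) y zero = here refl
vtxOf-interior x (z ∷ ℓ) y (suc j) = there (vtxOf-interior z ℓ y j)

interior-onto : ∀ (x : V) ℓ y {z} → z ∈ ℓ → ∃[ j ] z ≡ vtxOf x ℓ y (suc (inject₁ j))
interior-onto x (w ∷ ℓ) y (here refl) = zero , refl
interior-onto x (w ∷ ℓ) y (there p) with interior-onto w ℓ y p
... | j , e = suc j , e

vtxOf-step : ∀ (x : V) ℓ y i → Step x ℓ y (vtxOf x ℓ y (inject₁ i)) (vtxOf x ℓ y (suc i))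
vtxOf-step x [] y zero = last
vtxOf-step x (z ∷ ℓ) y zero = here
vtxOf-step x (z ∷ ℓ) y (suc i) = there (vtxOf-step z ℓ y i)

step-index : ∀ {x : V} {ℓ y p q} → Step x ℓ y p q → ∃[ i ] p ≡ vtxOf x ℓ y (inject₁ i) × q ≡ vtxOf x ℓ y (suc i)
step-index last = zero , refl , refl
step-index here = zero , refl , refl
step-index (there s) with step-index s
... | i , e , e′ = suc i , e , e′

vtxOf-tail : ∀ (x : V) ℓ y j → vtxOf x ℓ y (suc j) ∈ ℓ ⊎ vtxOf x ℓ y (suc j) ≡ y
vtxOf-tail x [] y zero = inj₂ refl
vtxOf-tail x (z ∷ ℓ) y zero = inj₁ (here refl)
vtxOf-tail x (z ∷ ℓ) y (suc j) with vtxOf-tail z ℓ y j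
... | inj₁ p = inj₁ (there p)
... | inj₂ e = inj₂ e

vtxOf-injective : ∀ (x : V) ℓ y → x ∉ ℓ → y ∉ ℓ → x ≢ y → Unique ℓ → Injective _≡_ _≡_ (vtxOf x ℓ y)
vtxOf-injective x ℓ y x∉ y∉ x≢y u {zero} {zero} e = refl
vtxOf-injective x ℓ y x∉ y∉ x≢y u {zero} {suc j} e with vtxOf-tail x ℓ y j
... | inj₁ p = ⊥-elim (x∉ (subst (_∈ ℓ) (≡-sym e) p))
... | inj₂ q = ⊥-elim (x≢y (trans e q))
vtxOf-injective x ℓ y x∉ y∉ x≢y u {suc i} {zero} e with vtxOf-tail x ℓ y i
... | inj₁ p = ⊥-elim (x∉ (subst (_∈ ℓ) e p))
... | inj₂ q = ⊥-elim (x≢y (trans (≡-sym e) q))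
vtxOf-injective x [] y x∉ y∉ x≢y u {suc zero} {suc zero} e = refl
vtxOf-injective x (z ∷ ℓ) y x∉ y∉ x≢y (z# ∷ u) {suc i} {suc j} e =
  cong suc (vtxOf-injective z ℓ y (λ p → All.lookup z# p refl) (y∉ ∘ there) (λ q → y∉ (here (≡-sym q))) u e)

Edge : ∀ {h} → Graph h → Fin h → Fin h → Set
Edge H u v = toℕ u < toℕ v × Adj H u v

-- β gives the branch vertices and ℓ the interiors of the paths.

Covered : ∀ {h n} → Graph h → (Fin h → Fin n) → (Fin h → Fin h → List (Fin n)) → Fin n → Set
Covered H β ℓ x = (∃[ w ] x ≡ β w) ⊎ (∃[ u ] ∃[ v ] Edge H u v × x ∈ ℓ u v)

Consecutive : ∀ {h n} → Graph h → (Fin h → Fin n) → (Fin h → Fin h → List (Fin n)) → Fin n → Fin n → Set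
Consecutive H β ℓ x y = ∃[ u ] ∃[ v ] Edge H u v × (Step (β u) (ℓ u v) (β v) x y ⊎ Step (β u) (ℓ u v) (β v) y x)

-- The subgraph induced on the covered vertices is the subdivision: by `complete` it has no edges
-- besides those of the paths. Its adjacency is pulled back along an enumeration, so the copy is
-- induced by definition.
module Assemble {n h : ℕ} (G : Graph n) (H : Graph h) (β : Fin h → Fin n) (β-inj : Injective _≡_ _≡_ β)
  (ℓ : Fin h → Fin h → List (Fin n))
  (unique : ∀ u v → Edge H u v → Unique (ℓ u v))
  (avoid : ∀ u v → Edge H u v → ∀ w → β w ∉ ℓ u v)
  (disjoint : ∀ u v u′ v′ → Edge H u v → Edge H u′ v′ → ∀ x → x ∈ ℓ u v → x ∈ ℓ u′ v′ → u ≡ u′ × v ≡ v′)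
  (sound : ∀ u v → Edge H u v → ∀ p q → Step (β u) (ℓ u v) (β v) p q → Adj G p q)
  (complete : ∀ x y → Covered H β ℓ x → Covered H β ℓ y → Adj G x y → Consecutive H β ℓ x y) where

  open DecMembership (_≟_ {n}) using (_∈?_)

  covered? : ∀ x → Dec (Covered H β ℓ x)
  covered? x = any? (λ w → x ≟ β w) ⊎-dec any? (λ u → any? (λ v → ((toℕ u <? toℕ v) ×-dec (adj H u v Data.Bool.≟ true)) ×-dec (x ∈? ℓ u v)))

  U : VSet n
  U x = ⌊ covered? x ⌋

  U-elim : ∀ {x} → U x ≡ true → Covered H β ℓ x
  U-elim {x} p with covered? x
  ... | yes c = c

  U-intro : ∀ {x} → Covered H β ℓ x → U x ≡ true
  U-intro {x} c with covered? x
  ... | yes _ = refl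
  ... | no q = ⊥-elim (q c)

  module Enumerated (m : ℕ) (φ : Fin m → Fin n) (φ-inj : Injective _≡_ _≡_ φ) (φ∈ : ∀ i → U (φ i) ≡ true) (φ-onto : ∀ x → U x ≡ true → ∃[ i ] φ i ≡ x) where

    S : Graph m
    S = record { adj = λ i j → adj G (φ i) (φ j) ; sym = λ i j → sym G (φ i) (φ j) ; irrefl = λ i → irrefl G (φ i) }

    index : ∀ {x} → Covered H β ℓ x → Fin m
    index c = proj₁ (φ-onto _ (U-intro c))

    φ-index : ∀ {x} (c : Covered H β ℓ x) → φ (index c) ≡ x
    φ-index c = proj₂ (φ-onto _ (U-intro c))

    index-≡ : ∀ {x y} {c : Covered H β ℓ x} {d : Covered H β ℓ y} → x ≡ y → index c ≡ index d
    index-≡ {c = c} {d} e = φ-inj (trans (φ-index c) (trans e (≡-sym (φ-index d))))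

    index-inj : ∀ {x y} {c : Covered H β ℓ x} {d : Covered H β ℓ y} → index c ≡ index d → x ≡ y
    index-inj {c = c} {d} e = trans (≡-sym (φ-index c)) (trans (cong φ e) (φ-index d))

    vertex : ∀ u v → Fin (suc (suc (length (ℓ u v)))) → Fin n
    vertex u v = vtxOf (β u) (ℓ u v) (β v)

    vertex-covered : ∀ u v → Edge H u v → ∀ i → Covered H β ℓ (vertex u v i)
    vertex-covered u v e zero = inj₁ (u , refl)
    vertex-covered u v e (suc i) with vtxOf-tail (β u) (ℓ u v) (β v) i
    ... | inj₁ p = inj₂ (u , v , e , p)
    ... | inj₂ q = inj₁ (v , q)

    branch-covered : ∀ w → Covered H β ℓ (β w)
    branch-covered w = inj₁ (w , refl)

    interior-∈ : ∀ u v j → vertex u v (suc (inject₁ j)) ∈ ℓ u v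
    interior-∈ u v j = vtxOf-interior (β u) (ℓ u v) (β v) j

    at : ∀ {x} i → φ i ≡ x → (c : Covered H β ℓ x) → i ≡ index c
    at i e c = φ-inj (trans e (≡-sym (φ-index c)))

    subdivision : IsSubdivision S H
    subdivision = record
      { branch = λ w → index (branch-covered w)
      ; branch-inj = λ e → β-inj (index-inj e)
      ; path = λ u v p e → record { len = length (ℓ u v) ; vtx = λ i → index (vertex-covered u v (p , e) i) }
      ; path-inj = λ u v p e q → vtxOf-injective (β u) (ℓ u v) (β v) (avoid u v (p , e) u) (avoid u v (p , e) v)
          (λ r → <-irrefl (cong toℕ (β-inj r)) p) (unique u v (p , e)) (index-inj q)
      ; path-start = λ u v p e → index-≡ refl
      ; path-end = λ u v p e → index-≡ (vtxOf-end (β u) (ℓ u v) (β v))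
      ; interior-avoids-branch = λ u v p e j w q → avoid u v (p , e) w (subst (_∈ ℓ u v) (index-inj q) (interior-∈ u v j))
      ; interiors-disjoint = λ u v p e u′ v′ p′ e′ j j′ q → disjoint u v u′ v′ (p , e) (p′ , e′) _
          (interior-∈ u v j) (subst (_∈ ℓ u′ v′) (≡-sym (index-inj q)) (interior-∈ u′ v′ j′))
      ; covers = covers′
      ; edges-sound = λ u v p e i → trans (cong₂ (adj G) (φ-index (vertex-covered u v (p , e) (inject₁ i))) (φ-index (vertex-covered u v (p , e) (suc i))))
          (sound u v (p , e) _ _ (vtxOf-step (β u) (ℓ u v) (β v) i))
      ; edges-complete = complete′
      }
      where
      covers′ : ∀ x → (∃[ w ] x ≡ index (branch-covered w)) ⊎
        (∃[ u ] ∃[ v ] Σ (toℕ u < toℕ v) λ p → Σ (Adj H u v) λ e → ∃[ j ] x ≡ index (vertex-covered u v (p , e) (suc (inject₁ j))))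
      covers′ x with U-elim (φ∈ x)
      ... | inj₁ (w , e) = inj₁ (w , at x e _)
      ... | inj₂ (u , v , (p , e) , x∈) with interior-onto (β u) (ℓ u v) (β v) x∈
      ...   | j , q = inj₂ (u , v , p , e , j , at x q _)
      complete′ : ∀ x y → Adj S x y → ∃[ u ] ∃[ v ] Σ (toℕ u < toℕ v) λ p → Σ (Adj H u v) λ e → ∃[ i ]
        ((x ≡ index (vertex-covered u v (p , e) (inject₁ i)) × y ≡ index (vertex-covered u v (p , e) (suc i)))
        ⊎ (y ≡ index (vertex-covered u v (p , e) (inject₁ i)) × x ≡ index (vertex-covered u v (p , e) (suc i))))
      complete′ x y a with complete (φ x) (φ y) (U-elim (φ∈ x)) (U-elim (φ∈ y)) a
      ... | u , v , (p , e) , inj₁ s with step-index s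
      ...   | i , q , r = u , v , p , e , i , inj₁ (at x q _ , at y r _)
      complete′ x y a | u , v , (p , e) , inj₂ s with step-index s
      ...   | i , q , r = u , v , p , e , i , inj₂ (at y q _ , at x r _)

    contained : ContainsInducedSubdivision H G
    contained = m , S , subdivision , φ , φ-inj , (λ x y → refl)

  contains : ContainsInducedSubdivision H G
  contains = go (enumerate U)
    where
    go : (Σ (Fin (# U) → Fin n) λ φ → Injective _≡_ _≡_ φ × (∀ i → U (φ i) ≡ true) × (∀ x → U x ≡ true → ∃[ i ] φ i ≡ x)) → ContainsInducedSubdivision H G
    go (φ , inj , mem , onto) = Enumerated.contained (# U) φ inj mem onto

Step-∷ʳ : ∀ {x : V} ℓ {v y p q} → Step x (ℓ ∷ʳ v) y p q → Step x ℓ v p q ⊎ (p ≡ v × q ≡ y)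
Step-∷ʳ [] here = inj₁ last
Step-∷ʳ [] (there last) = inj₂ (refl , refl)
Step-∷ʳ (z ∷ ℓ) here = inj₁ here
Step-∷ʳ (z ∷ ℓ) (there s) with Step-∷ʳ ℓ s
... | inj₁ t = inj₁ (there t)
... | inj₂ e = inj₂ e

-- Degree sums inside vertex sets

module DegreeSums {n : ℕ} (F : Graph n) where

  deg : VSet n → Fin n → ℕ
  deg P x = # (P ∩ adj F x)

  D : VSet n → ℕ
  D P = ∑ (λ x → ι (P x) * deg P x)

  D-≤ : ∀ P → D P ≤ # P * # P
  D-≤ P = ≤-trans (∑-mono (λ x → *-monoʳ-≤ (ι (P x)) (#-mono {P = P ∩ adj F x} {Q = P} (λ y p → ∧-fst p))))
    (≤-reflexive (∑-*ʳ (λ x → ι (P x)) (# P)))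

  -- `D` is twice the number of edges inside the set: an edge at `v` is counted from both of its
  -- ends.
  D-remove : ∀ P v → P v ≡ true → D P ≡ D (P - v) + 2 * deg P v
  D-remove P v Pv = begin
    D P ≡⟨ ∑-split (λ x → ι (P x) * deg P x) v ⟩
    ι (P v) * deg P v + ∑ (λ x → ι (not (x == v)) * (ι (P x) * deg P x)) ≡⟨ cong₂ _+_ (cong (_* deg P v) (ι-true Pv) ∙ +-identityʳ (deg P v)) (∑-cong summand ∙ ∑-+ (λ x → ι ((P - v) x) * deg (P - v) x) _) ⟩
    deg P v + (D (P - v) + ∑ (λ x → ι ((P - v) x) * ι (adj F x v))) ≡⟨ cong (λ z → deg P v + (D (P - v) + z)) (∑-cong back) ⟩
    deg P v + (D (P - v) + deg P v) ≡⟨ l (deg P v) (D (P - v)) ⟩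
    D (P - v) + 2 * deg P v ∎
    where
    open ≡-Reasoning
    l : ∀ a b → a + (b + a) ≡ b + 2 * a
    l = solve-∀
    deg-split : ∀ x → deg P x ≡ ι (adj F x v) + deg (P - v) x
    deg-split x = ∑-split (λ y → ι (P y ∧ adj F x y)) v ∙ cong₂ _+_ (cong ι (bool-ext (λ p → ∧-snd {P v} p) (∧-intro Pv)))
      (∑-cong (λ y → ≡-sym (ι-∧ (not (y == v)) _) ∙ cong ι (bool-ext
        (λ p → ∧-intro (∧-intro (∧-fst (∧-snd {not (y == v)} p)) (∧-fst p)) (∧-snd {P y} (∧-snd {not (y == v)} p)))
        (λ p → ∧-intro (∧-snd {P y} (∧-fst p)) (∧-intro (∧-fst (∧-fst p)) (∧-snd {(P - v) y} p))))))
    summand : ∀ x → ι (not (x == v)) * (ι (P x) * deg P x) ≡ ι ((P - v) x) * deg (P - v) x + ι ((P - v) x) * ι (adj F x v)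
    summand x = ≡-sym (*-assoc (ι (not (x == v))) (ι (P x)) _) ∙ cong₂ _*_ (*-comm (ι (not (x == v))) _ ∙ ≡-sym (ι-∧ (P x) _)) (deg-split x)
      ∙ *-distribˡ-+ (ι ((P - v) x)) _ _ ∙ +-comm _ (ι ((P - v) x) * deg (P - v) x)
    back : ∀ x → ι ((P - v) x) * ι (adj F x v) ≡ ι (P x ∧ adj F v x)
    back x = ≡-sym (ι-∧ ((P - v) x) _) ∙ cong ι (bool-ext
      (λ p → ∧-intro (∧-fst (∧-fst p)) (trans (sym F v x) (∧-snd {(P - v) x} p)))
      (λ p → ∧-intro (-∋ P (∧-fst p) (λ { refl → true≢false (∧-snd {P x} p) (irrefl F x) })) (trans (sym F x v) (∧-snd {P x} p))))

  D-≥ : ∀ P c → (∀ x → P x ≡ true → c ≤ deg P x) → c * # P ≤ D P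
  D-≥ P c p = ≡≤ (*-comm c (# P) ∙ ≡-sym (∑-*ʳ (λ x → ι (P x)) c)) (∑-mono (λ x → ι*-mono (p x)))

-- Topological minors with prescribed edges (repetitions and loops are allowed)

record TopologicalMinor {n h m : ℕ} (F : Graph n) (B : VSet n) (ends : Fin m → Fin h × Fin h) : Set where
  field
    branch : Fin h → Fin n
    branch-inj : Injective _≡_ _≡_ branch
    branch∈ : ∀ w → B (branch w) ≡ true
    path : Fin m → List (Fin n)
    path≢[] : ∀ e → path e ≢ []
    path∈ : ∀ e x → x ∈ path e → B x ≡ true
    path-unique : ∀ e → Unique (path e)
    path-avoids : ∀ e w → branch w ∉ path e
    path-disjoint : ∀ e e′ x → x ∈ path e → x ∈ path e′ → e ≡ e′
    path-adj : ∀ e p q → Step (branch (proj₁ (ends e))) (path e) (branch (proj₂ (ends e))) p q → Adj F p q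

-- Mader's theorem, with paths routed through contracted sets

module Mader {n : ℕ} (F : Graph n) (h : ℕ) (h>0 : 0 < h) where

  open DegreeSums F
  open TopologicalMinor

  Joins : VSet n → Fin n → Fin n → List (Fin n) → Set
  Joins U p q ℓ = (∀ x → x ∈ ℓ → U x ≡ true) × Unique ℓ × ℓ ≢ [] × (∀ a b → Step p ℓ q a b → Adj F a b)

  -- Connectivity in the form needed for routing. The outer vertices `p` and `q` are arbitrary: they
  -- may coincide, which gives loops, and one of them may be the new vertex in `extend-connected`.
  Connected : VSet n → Set
  Connected U = ∀ p q x y → U x ≡ true → U y ≡ true → Adj F p x → Adj F y q → ∃[ ℓ ] Joins U p q ℓ

  singleton-connected : ∀ v → Connected (_== v)
  singleton-connected v p q x y ux uy px yq rewrite ==-elim ux | ==-elim uy =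
    v ∷ [] , (λ { z (here refl) → ==-refl v }) , ([] ∷ []) , (λ ()) , (λ { _ _ here → px ; _ _ (there last) → yq })

  _+ᵥ_ : VSet n → Fin n → VSet n
  (U +ᵥ v) x = U x ∨ (x == v)

  extend-connected : ∀ U v u → Connected U → U v ≡ false → U u ≡ true → Adj F u v → Connected (U +ᵥ v)
  extend-connected U v u conn v∉ u∈ uv p q x y ux uy px yq = go (∨-elim ux) (∨-elim uy)
    where
    v∈′ : (U +ᵥ v) v ≡ true
    v∈′ = ∨-introʳ {U v} (==-refl v)
    vu : Adj F v u
    vu = trans (sym F v u) uv
    go : U x ≡ true ⊎ x == v ≡ true → U y ≡ true ⊎ y == v ≡ true → ∃[ ℓ ] Joins (U +ᵥ v) p q ℓ
    go (inj₁ x∈) (inj₁ y∈) with conn p q x y x∈ y∈ px yq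
    ... | ℓ , ⊆U , uniq , ne , steps = ℓ , (λ z p → ∨-introˡ (⊆U z p)) , uniq , ne , steps
    go (inj₂ xv) (inj₁ y∈) with conn v q u y u∈ y∈ vu yq
    ... | ℓ , ⊆U , uniq , ne , steps = v ∷ ℓ , (λ { z (here refl) → v∈′ ; z (there p) → ∨-introˡ (⊆U z p) }) ,
      (All.tabulate (λ z∈ e → true≢false (subst (λ w → U w ≡ true) (≡-sym e) (⊆U _ z∈)) v∉) ∷ uniq) , (λ ()) ,
      (λ { _ _ here → subst (λ w → Adj F p w) (==-elim xv) px ; a b (there s) → steps a b s })
    go (inj₁ x∈) (inj₂ yv) with conn p v x u x∈ u∈ px uv
    ... | ℓ , ⊆U , uniq , ne , steps = ℓ ∷ʳ v , mem ℓ ⊆U ,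
      AllPairs.++⁺ uniq ([] ∷ []) (All.tabulate (λ z∈ → (λ e → true≢false (subst (λ w → U w ≡ true) e (⊆U _ z∈)) v∉) ∷ [])) , nonempty ℓ , chain
      where
      mem : ∀ ℓ → (∀ z → z ∈ ℓ → U z ≡ true) → ∀ z → z ∈ ℓ ∷ʳ v → (U +ᵥ v) z ≡ true
      mem [] s z (here refl) = v∈′
      mem (w ∷ ℓ) s z (here refl) = ∨-introˡ (s z (here refl))
      mem (w ∷ ℓ) s z (there p) = mem ℓ (λ z p → s z (there p)) z p
      nonempty : ∀ ℓ → ℓ ∷ʳ v ≢ []
      nonempty [] ()
      nonempty (_ ∷ _) ()
      chain : ∀ a b → Step p (ℓ ∷ʳ v) q a b → Adj F a b
      chain a b s with Step-∷ʳ ℓ s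
      ... | inj₁ t = steps a b t
      ... | inj₂ (refl , refl) = subst (λ w → Adj F w q) (==-elim yv) yq
    go (inj₂ xv) (inj₂ yv) = v ∷ [] , (λ { z (here refl) → v∈′ }) , ([] ∷ []) , (λ ()) ,
      (λ { _ _ here → subst (λ w → Adj F p w) (==-elim xv) px ; _ _ (there last) → subst (λ w → Adj F w q) (==-elim yv) yq })

  -- Each path halves the density: the neighbourhood of a contracted set is dense for half of the
  -- threshold and carries the remaining paths. Without paths `h` distinct vertices are enough,
  -- whence the initial value.
  Threshold : ℕ → ℕ
  Threshold zero = h
  Threshold (suc m) = 2 * Threshold m

  Threshold>0 : ∀ m → 0 < Threshold m
  Threshold>0 zero = h>0
  Threshold>0 (suc m) = *-pos {2} (s≤s z≤n) (Threshold>0 m)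

  Threshold≡ : ∀ m → Threshold m ≡ 2 ^ m * h
  Threshold≡ zero = ≡-sym (+-identityʳ h)
  Threshold≡ (suc m) = cong (2 *_) (Threshold≡ m) ∙ ≡-sym (*-assoc 2 (2 ^ m) h)

  touches : VSet n → VSet n
  touches U x = not (allF (λ u → not (U u ∧ adj F u x)))

  touches-elim : ∀ {U x} → touches U x ≡ true → ∃[ u ] U u ≡ true × Adj F u x
  touches-elim p with allF-false (not-elim p)
  ... | u , q = u , ∧-elim (not-false q)

  touches-intro : ∀ {U x} u → U u ≡ true → Adj F u x → touches U x ≡ true
  touches-intro {U} {x} u p q = not-intro (≢true (λ r → true≢false (∧-intro p q) (not-elim (allF-elim r u))))

  module Contraction {m : ℕ} (ends : Fin (suc m) → Fin h × Fin h)
    (IH : ∀ B → 0 < # B → Threshold m * # B ≤ D B → TopologicalMinor F B (ends ∘ suc)) (B : VSet n) where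

    k′ κ : ℕ
    k′ = Threshold m
    κ = Threshold (suc m)

    -- All branch vertices found in `P` have neighbours in `U`, so the first prescribed path can be
    -- led through `U`, away from everything inside `P`.
    add-path : ∀ U P → Connected U → (∀ x → U x ≡ true → P x ≡ true → ⊥) → U ⊆ B → P ⊆ B → P ⊆ touches U →
      TopologicalMinor F P (ends ∘ suc) → TopologicalMinor F B ends
    add-path U P conn disj U⊆ P⊆ P-touches M = join (touches-elim (P-touches _ (branch∈ M u))) (touches-elim (P-touches _ (branch∈ M v)))
      where
      u = proj₁ (ends zero)
      v = proj₂ (ends zero)
      extend : ∃[ ℓ ] Joins U (branch M u) (branch M v) ℓ → TopologicalMinor F B ends
      extend (ℓ , ⊆U , uniq , ne , steps) = record
        { branch = branch M
        ; branch-inj = branch-inj M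
        ; branch∈ = λ w → P⊆ _ (branch∈ M w)
        ; path = λ { zero → ℓ ; (suc e) → path M e }
        ; path≢[] = λ { zero → ne ; (suc e) → path≢[] M e }
        ; path∈ = λ { zero x p → U⊆ x (⊆U x p) ; (suc e) x p → P⊆ x (path∈ M e x p) }
        ; path-unique = λ { zero → uniq ; (suc e) → path-unique M e }
        ; path-avoids = λ { zero w p → disj _ (⊆U _ p) (branch∈ M w) ; (suc e) → path-avoids M e }
        ; path-disjoint = λ { zero zero x p q → refl
                            ; zero (suc e) x p q → ⊥-elim (disj x (⊆U x p) (path∈ M e x q))
                            ; (suc e) zero x p q → ⊥-elim (disj x (⊆U x q) (path∈ M e x p))
                            ; (suc e) (suc e′) x p q → cong suc (path-disjoint M e e′ x p q) }
        ; path-adj = λ { zero → steps ; (suc e) → path-adj M e }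
        }
      join : (∃[ x ] U x ≡ true × Adj F x (branch M u)) → (∃[ y ] U y ≡ true × Adj F y (branch M v)) → TopologicalMinor F B ends
      join (x , x∈ , xu) (y , y∈ , yv) = extend (conn _ _ x y x∈ y∈ (trans (sym F _ x) xu) yv)

    -- U is the contracted set and R the rest of the graph; the last hypothesis bounds the
    -- degree sum of the contracted graph from below.
    contract : ∀ r U R → # R ≤ r → Connected U → U ⊆ B → R ⊆ B → (∀ x → U x ≡ true → R x ≡ true → ⊥) →
      κ * suc (# R) ≤ D R + 2 * # (R ∩ touches U) → TopologicalMinor F B ends
    restart : ∀ r R → # R ≤ suc r → R ⊆ B → ∀ v → R v ≡ true → κ * # R ≤ D R → TopologicalMinor F B ends
    restart r R R≤r R⊆ v Rv dense = contract r (_== v) (R - v) (≤-pred (≡≤ (≡-sym (#-remove R v Rv)) R≤r))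
      (singleton-connected v) (λ x p → subst (λ w → B w ≡ true) (≡-sym (==-elim p)) (R⊆ v Rv)) (λ x p → R⊆ x (-⊆ R v x p))
      (λ x p q → true≢false (subst (λ w → (R - v) w ≡ true) (==-elim p) q) (-∌ R v))
      (≡≤ (cong (κ *_) (≡-sym (#-remove R v Rv))) (≤-trans dense (≡≤ (D-remove R v Rv)
        (+-monoʳ-≤ (D (R - v)) (*-monoʳ-≤ 2 (#-mono {P = R ∩ adj F v} {Q = (R - v) ∩ touches (_== v)} sub))))))
      where
      sub : (R ∩ adj F v) ⊆ ((R - v) ∩ touches (_== v))
      sub x p = ∧-intro (-∋ R (∧-fst p) (λ { refl → true≢false (∧-snd {R x} p) (irrefl F x) }))
        (touches-intro v (==-refl v) (∧-snd {R x} p))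
    contract zero U R R≤r conn U⊆ R⊆ disj dense = ⊥-elim (<⇒≱ (Threshold>0 (suc m)) (begin
      κ ≡⟨ ≡-sym (*-identityʳ κ) ⟩
      κ * 1 ≤⟨ *-monoʳ-≤ κ (s≤s z≤n) ⟩
      κ * suc (# R) ≤⟨ dense ⟩
      D R + 2 * # (R ∩ touches U) ≤⟨ +-mono-≤ (≤-trans (D-≤ R) (*-mono-≤ R≤r R≤r)) (*-monoʳ-≤ 2 (≤-trans (#-mono {P = R ∩ touches U} {Q = R} (λ x p → ∧-fst p)) R≤r)) ⟩
      0 ∎))
      where open ≤-Reasoning
    contract (suc r) U R R≤r conn U⊆ R⊆ disj dense = go (0 <? # P) (any? (λ v → (P v Data.Bool.≟ true) ×-dec (deg P v <? k′)))
      where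
      P : VSet n
      P = R ∩ touches U
      P⊆R : P ⊆ R
      P⊆R x p = ∧-fst p
      move : ∀ v → P v ≡ true → deg P v < k′ → TopologicalMinor F B ends
      move v Pv small = attach (touches-elim (∧-snd {R v} Pv))
        where
        Rv = P⊆R v Pv
        -- Neighbours of the enlarged set are the old ones except `v` and the neighbours of `v`
        -- outside `P`: what disappears is the edge to `v` and `deg P v` parallel edges.
        count : # P + deg R v ≤ suc (deg P v) + # ((R - v) ∩ touches (U +ᵥ v))
        count = begin
          # P + deg R v ≤⟨ +-mono-≤ (≤-reflexive (#-remove P v Pv)) (#-cover {P = R ∩ adj F v} {Q = P ∩ adj F v} {R = λ x → (R ∩ adj F v) x ∧ not (P x)} split) ⟩
          suc (# (P - v)) + (deg P v + # (λ x → (R ∩ adj F v) x ∧ not (P x))) ≡⟨ l (# (P - v)) (deg P v) _ ⟩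
          suc (deg P v) + (# (P - v) + # (λ x → (R ∩ adj F v) x ∧ not (P x))) ≤⟨ +-monoʳ-≤ (suc (deg P v)) (#-disjoint {P = P - v} {Q = λ x → (R ∩ adj F v) x ∧ not (P x)} {R = (R - v) ∩ touches (U +ᵥ v)} old new
              (λ x p q → true≢false (-⊆ P v x p) (not-elim (∧-snd {(R ∩ adj F v) x} q)))) ⟩
          suc (deg P v) + # ((R - v) ∩ touches (U +ᵥ v)) ∎
          where
          open ≤-Reasoning
          l : ∀ a b c → suc a + (b + c) ≡ suc b + (a + c)
          l = solve-∀
          split : ∀ x → (R ∩ adj F v) x ≡ true → (P ∩ adj F v) x ≡ true ⊎ (R ∩ adj F v) x ∧ not (P x) ≡ true
          split x p with bool (P x)
          ... | inj₁ q = inj₁ (∧-intro q (∧-snd {R x} p))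
          ... | inj₂ q = inj₂ (∧-intro p (not-intro q))
          old : (P - v) ⊆ ((R - v) ∩ touches (U +ᵥ v))
          old x p with touches-elim {U} (∧-snd {R x} (-⊆ P v x p))
          ... | u , u∈ , ux = ∧-intro (∧-intro (P⊆R x (-⊆ P v x p)) (∧-snd {P x} p)) (touches-intro u (∨-introˡ u∈) ux)
          new : (λ x → (R ∩ adj F v) x ∧ not (P x)) ⊆ ((R - v) ∩ touches (U +ᵥ v))
          new x p = ∧-intro (-∋ R (∧-fst (∧-fst p)) (λ { refl → true≢false vx (irrefl F x) }))
            (touches-intro v (∨-introʳ {U v} (==-refl v)) vx)
            where vx = ∧-snd {R x} (∧-fst p)
        -- One vertex and at most k′ edges are lost, that is 2k′ = κ in the degree sum, so the
        -- average degree of the contracted graph stays at least κ.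
        dense′ : κ * suc (# (R - v)) ≤ D (R - v) + 2 * # ((R - v) ∩ touches (U +ᵥ v))
        dense′ = ≤-by (+-mono-≤ (≡≤ (cong (κ *_) (cong suc (≡-sym (#-remove R v Rv)))) (≤-trans dense (≤-reflexive (cong (_+ 2 * # P) (D-remove R v Rv)))))
            (+-mono-≤ (*-monoʳ-≤ 2 count) (*-monoʳ-≤ 2 small))) 0
            (l k′ (# (R - v)) (D (R - v)) (# ((R - v) ∩ touches (U +ᵥ v))) (# P) (deg R v) (deg P v))
          where l : ∀ k r d t p a b → 2 * k * suc r + (d + 2 * a + 2 * p + (2 * (suc b + t) + 2 * k)) + 0 ≡ d + 2 * t + (2 * k * suc (suc r) + (2 * (p + a) + 2 * suc b))
                l = solve-∀
        attach : (∃[ u ] U u ≡ true × Adj F u v) → TopologicalMinor F B ends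
        attach (u , u∈ , uv) = contract r (U +ᵥ v) (R - v) (≤-pred (≡≤ (≡-sym (#-remove R v Rv)) R≤r))
          (extend-connected U v u conn (≢true (λ q → disj v q Rv)) u∈ uv)
          (λ x p → [ U⊆ x , (λ e → subst (λ w → B w ≡ true) (≡-sym (==-elim e)) (R⊆ v Rv)) ]′ (∨-elim p))
          (λ x p → R⊆ x (-⊆ R v x p))
          (λ x p q → [ (λ a → disj x a (-⊆ R v x q)) , (λ e → true≢false (subst (λ w → (R - v) w ≡ true) (==-elim e) q) (-∌ R v)) ]′ (∨-elim p))
          dense′
      -- No edge joins the contracted set to `R`, so `R` alone is still dense and a new set is
      -- started inside it.
      isolated : # P ≡ 0 → TopologicalMinor F B ends
      isolated P≡0 = pick (#-pos⇒∃ {P = R} (n≢0⇒n>0 (λ e → <⇒≱ (*-pos (Threshold>0 (suc m)) (s≤s z≤n)) (≤-trans dense′ (≤-trans (D-≤ R) (≤-reflexive (cong (_* # R) e)))))))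
        where
        dense′ : κ * suc (# R) ≤ D R
        dense′ = ≤-trans dense (≤-reflexive (cong (λ z → D R + 2 * z) P≡0 ∙ +-identityʳ (D R)))
        pick : (∃[ v ] R v ≡ true) → TopologicalMinor F B ends
        pick (v , Rv) = restart r R R≤r R⊆ v Rv (≤-trans (*-monoʳ-≤ κ (n≤1+n (# R))) dense′)
      go : Dec (0 < # P) → Dec (∃[ v ] P v ≡ true × deg P v < k′) → TopologicalMinor F B ends
      go (no q) _ = isolated (n≤0⇒n≡0 (≮⇒≥ q))
      go (yes P>0) (yes (v , Pv , small)) = move v Pv small
      -- Every vertex of `P` has at least k′ neighbours in `P`, the density that the induction on
      -- the number of paths requires.
      go (yes P>0) (no q) = add-path U P conn (λ x p p′ → disj x p (P⊆R x p′)) U⊆ (λ x p → R⊆ x (P⊆R x p)) (λ x p → ∧-snd {R x} p)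
        (IH P P>0 (D-≥ P k′ (λ x Px → ≮⇒≥ (λ lt → q (x , Px , lt)))))

  mader : ∀ m (ends : Fin m → Fin h × Fin h) B → 0 < # B → Threshold m * # B ≤ D B → TopologicalMinor F B ends
  -- From h |B| ≤ D B ≤ |B|² it follows that `B` has at least `h` vertices.
  mader zero ends B B>0 dense = start (choose B (≤-cancel (# B) B>0 (≡≤ (*-comm (# B) h) (≤-trans dense (D-≤ B)))))
    where
    start : (Σ (Fin h → Fin n) λ φ → Injective _≡_ _≡_ φ × (∀ i → B (φ i) ≡ true)) → TopologicalMinor F B ends
    start (φ , inj , mem) = record
      { branch = φ ; branch-inj = inj ; branch∈ = mem ; path = λ () ; path≢[] = λ () ; path∈ = λ () ; path-unique = λ ()
      ; path-avoids = λ () ; path-disjoint = λ () ; path-adj = λ () }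
  mader (suc m) ends B B>0 dense = start (#-pos⇒∃ B>0)
    where
    open Contraction ends (mader m (ends ∘ suc)) B
    start : (∃[ v ] B v ≡ true) → TopologicalMinor F B ends
    start (v , Bv) = restart (# B) B (n≤1+n (# B)) (λ _ p → p) v Bv dense

-- Interleaving paths with middle vertices

weave : (V → V → V) → V → List V → V → List V
weave mid x [] y = mid x y ∷ []
weave mid x (z ∷ ℓ) y = mid x z ∷ z ∷ weave mid z ℓ y

module _ {V : Set} {mid : V → V → V} where

  weave-∈ : ∀ {x ℓ y z} → z ∈ weave mid x ℓ y → z ∈ ℓ ⊎ (∃[ p ] ∃[ q ] Step x ℓ y p q × z ≡ mid p q)
  weave-∈ {ℓ = []} (here refl) = inj₂ (_ , _ , last , refl)
  weave-∈ {ℓ = w ∷ ℓ} (here refl) = inj₂ (_ , _ , here , refl)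
  weave-∈ {ℓ = w ∷ ℓ} (there (here refl)) = inj₁ (here refl)
  weave-∈ {ℓ = w ∷ ℓ} (there (there i)) with weave-∈ {ℓ = ℓ} i
  ... | inj₁ j = inj₁ (there j)
  ... | inj₂ (p , q , s , e) = inj₂ (p , q , there s , e)

  weave-step : ∀ {x ℓ y a b} → Step x (weave mid x ℓ y) y a b →
    ∃[ p ] ∃[ q ] Step x ℓ y p q × ((a ≡ p × b ≡ mid p q) ⊎ (a ≡ mid p q × b ≡ q))
  weave-step {ℓ = []} here = _ , _ , last , inj₁ (refl , refl)
  weave-step {ℓ = []} (there last) = _ , _ , last , inj₂ (refl , refl)
  weave-step {ℓ = w ∷ ℓ} here = _ , _ , here , inj₁ (refl , refl)
  weave-step {ℓ = w ∷ ℓ} (there here) = _ , _ , here , inj₂ (refl , refl)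
  weave-step {ℓ = w ∷ ℓ} (there (there s)) with weave-step {ℓ = ℓ} s
  ... | p , q , t , e = p , q , there t , e

  step-weave : ∀ {x ℓ y p q} → Step x ℓ y p q → Step x (weave mid x ℓ y) y p (mid p q) × Step x (weave mid x ℓ y) y (mid p q) q
  step-weave last = here , there last
  step-weave here = here , there here
  step-weave (there s) with step-weave s
  ... | t , t′ = there (there t) , there (there t′)

step-source : ∀ {x : V} {ℓ y p q} → Step x ℓ y p q → p ≡ x ⊎ p ∈ ℓ
step-source last = inj₁ refl
step-source here = inj₁ refl
step-source (there s) with step-source s
... | inj₁ refl = inj₂ (here refl)
... | inj₂ i = inj₂ (there i)

step-target : ∀ {x : V} {ℓ y p q} → Step x ℓ y p q → q ∈ ℓ ⊎ q ≡ y
step-target last = inj₂ refl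
step-target here = inj₁ (here refl)
step-target (there s) with step-target s
... | inj₁ i = inj₁ (there i)
... | inj₂ e = inj₂ e

step-interior : ∀ {x : V} {ℓ y p q} → ℓ ≢ [] → Step x ℓ y p q → p ∈ ℓ ⊎ q ∈ ℓ
step-interior ne last = ⊥-elim (ne refl)
step-interior ne here = inj₂ (here refl)
step-interior ne (there s) with step-source s
... | inj₁ refl = inj₁ (here refl)
... | inj₂ i = inj₁ (there i)

EdgeWithin : ∀ {n} → Graph n → VSet n → Fin n → Fin n → Set
EdgeWithin F B b b′ = B b ≡ true × B b′ ≡ true × Adj F b b′

-- A topological minor of F becomes an induced subdivision in G when the edges of F are
-- realised by independent middle vertices with exactly two neighbours in B.

module Weave {n h : ℕ} (G F : Graph n) (B : VSet n) (mid : Fin n → Fin n → Fin n)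
  (mid-left : ∀ b b′ → EdgeWithin F B b b′ → Adj G b (mid b b′))
  (mid-right : ∀ b b′ → EdgeWithin F B b b′ → Adj G (mid b b′) b′)
  (mid∉ : ∀ b b′ → EdgeWithin F B b b′ → B (mid b b′) ≡ false)
  (mid-neighbour : ∀ b b′ → EdgeWithin F B b b′ → ∀ x → B x ≡ true → Adj G (mid b b′) x → x ≡ b ⊎ x ≡ b′)
  (mid-indep : ∀ b b′ c c′ → EdgeWithin F B b b′ → EdgeWithin F B c c′ → ¬ Adj G (mid b b′) (mid c c′))
  (B-indep : ∀ x y → B x ≡ true → B y ≡ true → ¬ Adj G x y)
  (M : TopologicalMinor F B (remQuot {h} h)) (H : Graph h) where

  open TopologicalMinor M

  -- The minor has a path for each of the h·h ordered pairs, loops included. So one minor serves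
  -- every graph on `Fin h`, and the path of an edge is found by `combine`.
  path′ : Fin h → Fin h → List (Fin n)
  path′ u v = path (combine u v)

  ℓ : Fin h → Fin h → List (Fin n)
  ℓ u v = weave mid (branch u) (path′ u v) (branch v)

  path′-adj : ∀ u v p q → Step (branch u) (path′ u v) (branch v) p q → Adj F p q
  path′-adj u v p q = subst (λ e → Step (branch (proj₁ e)) (path′ u v) (branch (proj₂ e)) p q → Adj F p q)
    (remQuot-combine u v) (path-adj (combine u v) p q)

  step-edge : ∀ u v p q → Step (branch u) (path′ u v) (branch v) p q → EdgeWithin F B p q
  step-edge u v p q s = source (step-source s) , target (step-target s) , path′-adj u v p q s
    where
    source : p ≡ branch u ⊎ p ∈ path′ u v → B p ≡ true
    source (inj₁ refl) = branch∈ u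
    source (inj₂ i) = path∈ _ p i
    target : q ∈ path′ u v ⊎ q ≡ branch v → B q ≡ true
    target (inj₁ i) = path∈ _ q i
    target (inj₂ refl) = branch∈ v

  -- A middle vertex remembers its edge: if the one after `x` occurred again, then `x`, being a
  -- neighbour of it in `B`, would be an end of a later step.
  weave-unique : ∀ x L y → x ∉ L → y ∉ L → x ≢ y → Unique L → (∀ p q → Step x L y p q → EdgeWithin F B p q) → Unique (weave mid x L y)
  weave-unique x [] y x∉ y∉ x≢y u edge = [] ∷ []
  weave-unique x (z ∷ L) y x∉ y∉ x≢y (z# ∷ u) edge =
    ((λ e → true≢false (subst (λ w → B w ≡ true) (≡-sym e) Bz) m∉) ∷ All.tabulate (λ i e → fresh (weave-∈ {ℓ = L} (subst (_∈ weave mid z L y) (≡-sym e) i)))) ∷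
    (All.tabulate (λ i e → z-fresh (weave-∈ {ℓ = L} (subst (_∈ weave mid z L y) (≡-sym e) i)))) ∷
    weave-unique z L y (λ i → All.lookup z# i refl) (λ i → y∉ (there i)) (λ { refl → y∉ (here refl) }) u (λ p q s → edge p q (there s))
    where
    xz = edge x z here
    Bz = proj₁ (proj₂ xz)
    m∉ = mid∉ x z xz
    inB : ∀ {w} → w ∈ L → B w ≡ true
    inB {w} i = go L z (λ p q s → edge p q (there s)) i
      where
      go : ∀ L z → (∀ p q → Step z L y p q → EdgeWithin F B p q) → w ∈ L → B w ≡ true
      go (a ∷ L) z f (here refl) = proj₁ (proj₂ (f z a here))
      go (a ∷ L) z f (there j) = go L a (λ p q s → f p q (there s)) j
    fresh : mid x z ∈ L ⊎ (∃[ p ] ∃[ q ] Step z L y p q × mid x z ≡ mid p q) → ⊥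
    fresh (inj₁ i) = true≢false (inB i) m∉
    fresh (inj₂ (p , q , s , e)) = hit (mid-neighbour p q (edge p q (there s)) x (proj₁ xz) (subst (λ w → Adj G w x) e (trans (sym G _ x) (mid-left x z xz))))
      where
      hit : x ≡ p ⊎ x ≡ q → ⊥
      hit (inj₁ refl) = [ (λ { refl → x∉ (here refl) }) , (λ i → x∉ (there i)) ]′ (step-source s)
      hit (inj₂ refl) = [ (λ i → x∉ (there i)) , x≢y ]′ (step-target s)
    z-fresh : z ∈ L ⊎ (∃[ p ] ∃[ q ] Step z L y p q × z ≡ mid p q) → ⊥
    z-fresh (inj₁ i) = All.lookup z# i refl
    z-fresh (inj₂ (p , q , s , e)) = true≢false (subst (λ w → B w ≡ true) e Bz) (mid∉ p q (edge p q (there s)))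

  avoid : ∀ u v → Edge H u v → ∀ w → branch w ∉ ℓ u v
  avoid u v e w i = go (weave-∈ {ℓ = path′ u v} i)
    where
    go : branch w ∈ path′ u v ⊎ (∃[ p ] ∃[ q ] Step (branch u) (path′ u v) (branch v) p q × branch w ≡ mid p q) → ⊥
    go (inj₁ j) = path-avoids _ w j
    go (inj₂ (p , q , s , e)) = true≢false (subst (λ w → B w ≡ true) e (branch∈ w)) (mid∉ p q (step-edge u v p q s))

  disjoint : ∀ u v u′ v′ → Edge H u v → Edge H u′ v′ → ∀ x → x ∈ ℓ u v → x ∈ ℓ u′ v′ → u ≡ u′ × v ≡ v′
  disjoint u v u′ v′ _ _ x i i′ = go (weave-∈ {ℓ = path′ u v} i) (weave-∈ {ℓ = path′ u′ v′} i′)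
    where
    same : ∀ y → y ∈ path′ u v → y ∈ path′ u′ v′ → u ≡ u′ × v ≡ v′
    same y j j′ = combine-injective u v u′ v′ (path-disjoint _ _ y j j′)
    go : x ∈ path′ u v ⊎ (∃[ p ] ∃[ q ] Step (branch u) (path′ u v) (branch v) p q × x ≡ mid p q) →
      x ∈ path′ u′ v′ ⊎ (∃[ p ] ∃[ q ] Step (branch u′) (path′ u′ v′) (branch v′) p q × x ≡ mid p q) → u ≡ u′ × v ≡ v′
    go (inj₁ j) (inj₁ j′) = same x j j′
    go (inj₁ j) (inj₂ (p , q , s , refl)) = true≢false (path∈ _ _ j) (mid∉ p q (step-edge u′ v′ p q s))
    go (inj₂ (p , q , s , refl)) (inj₁ j) = true≢false (path∈ _ _ j) (mid∉ p q (step-edge u v p q s))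
    -- Suppose that two paths share a middle vertex. Interiors are non-empty, so an end of the
    -- second edge is interior to its path. As a neighbour of the shared vertex it is also an end of
    -- the first edge, and since it is no branch vertex, it is interior to both paths.
    go (inj₂ (p , q , s , refl)) (inj₂ (p′ , q′ , s′ , e)) = pick (step-interior (path≢[] _) s′)
      where
      pq = step-edge u v p q s
      p′q′ = step-edge u′ v′ p′ q′ s′
      on-path : ∀ y → y ∈ path′ u′ v′ → Adj G (mid p q) y → u ≡ u′ × v ≡ v′
      on-path y j adj-y = hit (mid-neighbour p q pq y (path∈ _ y j) adj-y)
        where
        hit : y ≡ p ⊎ y ≡ q → u ≡ u′ × v ≡ v′
        hit (inj₁ refl) = [ (λ { refl → ⊥-elim (path-avoids _ u j) }) , (λ j′ → same y j′ j) ]′ (step-source s)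
        hit (inj₂ refl) = [ (λ j′ → same y j′ j) , (λ { refl → ⊥-elim (path-avoids _ v j) }) ]′ (step-target s)
      pick : p′ ∈ path′ u′ v′ ⊎ q′ ∈ path′ u′ v′ → u ≡ u′ × v ≡ v′
      pick (inj₁ j) = on-path p′ j (subst (λ w → Adj G w p′) (≡-sym e) (trans (sym G _ p′) (mid-left p′ q′ p′q′)))
      pick (inj₂ j) = on-path q′ j (subst (λ w → Adj G w q′) (≡-sym e) (mid-right p′ q′ p′q′))

  sound : ∀ u v → Edge H u v → ∀ a b → Step (branch u) (ℓ u v) (branch v) a b → Adj G a b
  sound u v _ a b s = go (weave-step {ℓ = path′ u v} s)
    where
    go : (∃[ p ] ∃[ q ] Step (branch u) (path′ u v) (branch v) p q × ((a ≡ p × b ≡ mid p q) ⊎ (a ≡ mid p q × b ≡ q))) → Adj G a b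
    go (p , q , t , inj₁ (refl , refl)) = mid-left p q (step-edge u v p q t)
    go (p , q , t , inj₂ (refl , refl)) = mid-right p q (step-edge u v p q t)

  Kind : Fin n → Set
  Kind x = B x ≡ true ⊎ (∃[ u ] ∃[ v ] Edge H u v × ∃[ p ] ∃[ q ] Step (branch u) (path′ u v) (branch v) p q × x ≡ mid p q)

  kind : ∀ x → Covered H branch ℓ x → Kind x
  kind x (inj₁ (w , refl)) = inj₁ (branch∈ w)
  kind x (inj₂ (u , v , e , i)) with weave-∈ {ℓ = path′ u v} i
  ... | inj₁ j = inj₁ (path∈ _ x j)
  ... | inj₂ (p , q , s , eq) = inj₂ (u , v , e , p , q , s , eq)

  Joined : Fin n → Fin n → Set
  Joined = Consecutive H branch ℓ

  complete : ∀ x y → Covered H branch ℓ x → Covered H branch ℓ y → Adj G x y → Joined x y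
  complete x y cx cy a = go (kind x cx) (kind y cy)
    where
    one : ∀ a b → Adj G a b → (∃[ u ] ∃[ v ] Edge H u v × ∃[ p ] ∃[ q ] Step (branch u) (path′ u v) (branch v) p q × a ≡ mid p q) → B b ≡ true → Joined a b
    one a b ab (u , v , e , p , q , s , refl) Bb with mid-neighbour p q (step-edge u v p q s) b Bb ab
    ... | inj₁ refl = u , v , e , inj₂ (proj₁ (step-weave s))
    ... | inj₂ refl = u , v , e , inj₁ (proj₂ (step-weave s))
    swap : ∀ {a b} → Joined a b → Joined b a
    swap (u , v , e , inj₁ s) = u , v , e , inj₂ s
    swap (u , v , e , inj₂ s) = u , v , e , inj₁ s
    go : Kind x → Kind y → Joined x y
    go (inj₁ Bx) (inj₁ By) = ⊥-elim (B-indep x y Bx By a)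
    go (inj₁ Bx) (inj₂ m) = swap (one y x (trans (sym G y x) a) m Bx)
    go (inj₂ m) (inj₁ By) = one x y a m By
    go (inj₂ (u , v , e , p , q , s , refl)) (inj₂ (u′ , v′ , e′ , p′ , q′ , s′ , refl)) =
      ⊥-elim (mid-indep p q p′ q′ (step-edge u v p q s) (step-edge u′ v′ p′ q′ s′) a)

  contains : ContainsInducedSubdivision H G
  contains = Assemble.contains G H branch branch-inj ℓ
    (λ u v e → weave-unique (branch u) (path′ u v) (branch v) (path-avoids _ u) (path-avoids _ v)
      (λ q → <-irrefl (cong toℕ (branch-inj q)) (proj₁ e)) (path-unique _) (step-edge u v))
    avoid disjoint sound complete

-- Random colourings: the expectation is ∑V divided by N ^ n.

Independent : Fin n → (Vec (Fin N) n → ℕ) → Set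
Independent v g = ∀ c c′ → (∀ u → u ≢ v → lookup c u ≡ lookup c′ u) → g c ≡ g c′

colour : (Fin N → Bool) → Fin n → Vec (Fin N) n → ℕ
colour φ v c = ι (φ (lookup c v))

_·_ : (Vec (Fin N) n → ℕ) → (Vec (Fin N) n → ℕ) → Vec (Fin N) n → ℕ
(f · g) c = f c * g c

infixl 7 _·_

independent-· : ∀ {v : Fin n} {f g : Vec (Fin N) n → ℕ} → Independent v f → Independent v g → Independent v (f · g)
independent-· p q c c′ e = cong₂ _*_ (p c c′ e) (q c c′ e)

independent-colour : ∀ (φ : Fin N → Bool) {u v : Fin n} → u ≢ v → Independent v (colour φ u)
independent-colour φ p c c′ e = cong (λ x → ι (φ x)) (e _ p)

independent-const : ∀ {v : Fin n} x → Independent {N = N} v (λ _ → x)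
independent-const x c c′ e = refl

-- The colour of `v` is uniform and `g` ignores it: the product rule with denominators cleared. `x₀`
-- fills the vacant place of `v`.
E-colour : ∀ {n N} (v : Fin n) (φ : Fin N → Bool) (g : Vec (Fin N) n → ℕ) → Fin N → Independent v g →
  N * ∑V (g · colour φ v) ≡ # φ * ∑V g
E-colour {suc n} {N} v φ g x₀ ind = begin
  N * ∑V (g · colour φ v) ≡⟨ cong (N *_) (∑V-insertAt v (g · colour φ v) ∙ ∑V-cong {k = n} (λ t → ∑-cong (λ x → cong₂ _*_ (fix t x) (cong (λ y → ι (φ y)) (insertAt-lookup t v x))) ∙ ∑-* (g (insertAt t v x₀)) (λ x → ι (φ x)))
    ∙ ∑V-*ʳ {k = n} (λ t → g (insertAt t v x₀)) (# φ)) ⟩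
  N * (∑V {k = n} (λ t → g (insertAt t v x₀)) * # φ) ≡⟨ l N (∑V {k = n} (λ t → g (insertAt t v x₀))) (# φ) ⟩
  # φ * (N * ∑V {k = n} (λ t → g (insertAt t v x₀))) ≡⟨ cong (# φ *_) (≡-sym (∑V-* {k = n} N (λ t → g (insertAt t v x₀))) ∙ ∑V-cong {k = n} (λ t → ≡-sym (∑-cong (fix t) ∙ ∑-const N _)) ∙ ≡-sym (∑V-insertAt v g)) ⟩
  # φ * ∑V g ∎
  where
  open ≡-Reasoning
  l : ∀ a b c → a * (b * c) ≡ c * (a * b)
  l = solve-∀
  fix : ∀ t x → g (insertAt t v x) ≡ g (insertAt t v x₀)
  fix t x = ind _ _ (insertAt-other t v)

opaque
  unfolding ∑V

  E-one : ∀ n → ∑V {n = N} {k = n} (λ _ → 1) ≡ N ^ n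
  E-one zero = refl
  E-one {N} (suc n) = ∑-cong {n = N} {f = λ x → ∑V {n = N} {k = n} (λ _ → 1)} {g = λ _ → N ^ n} (λ x → E-one n) ∙ ∑-const N (N ^ n)

module _ {n N : ℕ} (g : Vec (Fin N) n → ℕ) (M : ℕ) where

  E-∑ : (X : Fin k → Vec (Fin N) n → ℕ) (w : Fin k → ℕ) → (∀ v → M * ∑V (g · X v) ≤ w v) →
    M * ∑V (λ c → g c * ∑ (λ v → X v c)) ≤ ∑ w
  E-∑ X w p = ≡≤ (cong (M *_) (∑V-cong (λ c → ≡-sym (∑-* (g c) (λ v → X v c))) ∙ ∑V-swap (λ c v → g c * X v c)) ∙ ≡-sym (∑-* M (λ v → ∑V (g · X v)))) (∑-mono p)

  -- The bound is asked for only if `b` holds, because the vertices whose colours occur in `X` are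
  -- known to be distinct only for genuine conflicts.
  E-ι : ∀ b (X : Vec (Fin N) n → ℕ) m → (b ≡ true → M * ∑V (g · X) ≤ m) → M * ∑V (λ c → g c * (ι b * X c)) ≤ ι b * m
  E-ι b X m p = ≡≤ (cong (M *_) (∑V-cong (λ c → l (g c) (ι b) (X c)) ∙ ∑V-* (ι b) (g · X)) ∙ l M (ι b) _) (ι*-mono p)
    where l = *-swap

∑₃ : (Fin n → Fin n → Fin n → ℕ) → ℕ
∑₃ f = ∑ (λ a → ∑ (λ b → ∑ (f a b)))

∑₃-mono : {f g : Fin n → Fin n → Fin n → ℕ} → (∀ a b c → f a b c ≤ g a b c) → ∑₃ f ≤ ∑₃ g
∑₃-mono p = ∑-mono (λ a → ∑-mono (λ b → ∑-mono (p a b)))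

∑₃-cong : {f g : Fin n → Fin n → Fin n → ℕ} → (∀ a b c → f a b c ≡ g a b c) → ∑₃ f ≡ ∑₃ g
∑₃-cong p = ∑-cong (λ a → ∑-cong (λ b → ∑-cong (p a b)))

∑₃-+ : (f g : Fin n → Fin n → Fin n → ℕ) → ∑₃ (λ a b c → f a b c + g a b c) ≡ ∑₃ f + ∑₃ g
∑₃-+ f g = ∑-cong (λ a → ∑-cong (λ b → ∑-+ (f a b) (g a b)) ∙ ∑-+ (λ b → ∑ (f a b)) _) ∙ ∑-+ (λ a → ∑ (λ b → ∑ (f a b))) _

∑₃-* : ∀ x (f : Fin n → Fin n → Fin n → ℕ) → ∑₃ (λ a b c → x * f a b c) ≡ x * ∑₃ f
∑₃-* x f = ∑-cong (λ a → ∑-cong (λ b → ∑-* x (f a b)) ∙ ∑-* x (λ b → ∑ (f a b))) ∙ ∑-* x (λ a → ∑ (λ b → ∑ (f a b)))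

∑V-∑₃ : (f : Vec (Fin N) k → Fin n → Fin n → Fin n → ℕ) → ∑V (λ t → ∑₃ (f t)) ≡ ∑₃ (λ a b c → ∑V (λ t → f t a b c))
∑V-∑₃ f = ∑V-swap (λ t a → ∑ (λ b → ∑ (f t a b))) ∙ ∑-cong (λ a → ∑V-swap (λ t b → ∑ (f t a b)) ∙ ∑-cong (λ b → ∑V-swap (λ t → f t a b)))

-- The sampling argument

module Sample {n N : ℕ} (G : Graph n) (W A : VSet n) (o : Fin n → Fin n → Bool) (P : Fin n → Fin n → Fin n → Bool)
  (β α : Fin N → Bool) (x₀ : Fin N) (L K : ℕ) where

  -- Conflicting vertices are kept apart from the triple, so that their colours are independent of
  -- the event `base` that the triple is sampled.
  fresh : Fin n → Fin n → Fin n → Fin n → Bool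
  fresh a b b′ v = not (v == a) ∧ (not (v == b) ∧ not (v == b′))

  -- A triple none of whose conflicts is sampled has a as its middle vertex: (1) a has no
  -- other sampled neighbour and b, b′ have no sampled in-neighbour, (2) a is the only sampled
  -- common neighbour of b and b′, (3, 4) no in-neighbour of a is a middle vertex.
  conflict₁ conflict₂ : Fin n → Fin n → Fin n → VSet n
  conflict₁ a b b′ v = fresh a b b′ v ∧ ((W v ∧ adj G a v) ∨ (o v b ∨ o v b′))
  conflict₂ a b b′ v = fresh a b b′ v ∧ (A v ∧ (adj G v b ∧ adj G v b′))

  Nbr : Fin n → Fin n → Fin n → Fin n → Fin n → Bool
  Nbr a b b′ x v = fresh a b b′ v ∧ (W v ∧ adj G x v)

  conflict₃ : Fin n → Fin n → Fin n → Fin n → Fin n → Bool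
  conflict₃ a b b′ x v = (fresh a b b′ x ∧ (A x ∧ (o x a ∧ (adj G x b ∨ adj G x b′)))) ∧ Nbr a b b′ x v

  conflict₄ : Fin n → Fin n → Fin n → Fin n → Fin n → Fin n → Bool
  conflict₄ a b b′ x v w = (fresh a b b′ x ∧ (A x ∧ o x a)) ∧ (Nbr a b b′ x v ∧ (Nbr a b b′ x w ∧ not (v == w)))

  Colouring : Set
  Colouring = Vec (Fin N) n

  count₁ count₂ count₃ count₄ conflicts : Fin n → Fin n → Fin n → Colouring → ℕ
  count₁ a b b′ c = ∑ (λ v → ι (conflict₁ a b b′ v) * colour β v c)
  count₂ a b b′ c = ∑ (λ v → ι (conflict₂ a b b′ v) * colour α v c)
  count₃ a b b′ c = ∑ (λ x → ∑ (λ v → ι (conflict₃ a b b′ x v) * (colour α x · colour β v) c))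
  count₄ a b b′ c = ∑ (λ x → ∑ (λ v → ∑ (λ w → ι (conflict₄ a b b′ x v w) * (colour α x · colour β v · colour β w) c)))
  conflicts a b b′ c = count₁ a b b′ c + count₂ a b b′ c + count₃ a b b′ c + count₄ a b b′ c

  base : Fin n → Fin n → Fin n → Colouring → ℕ
  base a b b′ = colour α a · colour β b · colour β b′

  good : Colouring → Fin n → Fin n → Fin n → Bool
  good c a b b′ = P a b b′ ∧ (((α (lookup c a) ∧ β (lookup c b)) ∧ β (lookup c b′)) ∧ (conflicts a b b′ c <ᵇ 1))

  -- The deletion method: a sampled triple is good, or it has a conflict and the second summand pays
  -- for it.
  base-≤ : ∀ c a b b′ → ι (P a b b′) * base a b b′ c ≤ ι (good c a b b′) + ι (P a b b′) * (base a b b′ c * conflicts a b b′ c)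
  base-≤ c a b b′ = go (conflicts a b b′ c) refl
    where
    b∧ = (α (lookup c a) ∧ β (lookup c b)) ∧ β (lookup c b′)
    base-ι : base a b b′ c ≡ ι b∧
    base-ι = ≡-sym (ι-∧ (α (lookup c a) ∧ β (lookup c b)) _ ∙ cong (_* colour β b′ c) (ι-∧ (α (lookup c a)) _))
    go : ∀ x → conflicts a b b′ c ≡ x → ι (P a b b′) * base a b b′ c ≤ ι (good c a b b′) + ι (P a b b′) * (base a b b′ c * conflicts a b b′ c)
    go zero e = ≡≤ (cong (ι (P a b b′) *_) base-ι ∙ ≡-sym (ι-∧ (P a b b′) b∧)) (≤-trans (ι-mono (λ p →
      ∧-intro (∧-fst p) (∧-intro (∧-snd {P a b b′} p) (<ᵇ-intro (≤-reflexive (cong suc e)))))) (m≤m+n _ _))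
    go (suc x) e = ≤-trans (*-monoʳ-≤ (ι (P a b b′)) (≡≤ (≡-sym (*-identityʳ _)) (*-monoʳ-≤ (base a b b′ c) (≤-trans (s≤s z≤n) (≤-reflexive (≡-sym e)))))) (m≤n+m _ _)

  module Expectation (β-size : # β ≡ 1) (α-size : # α ≡ L) where

    E-base : ∀ a b b′ → a ≢ b → a ≢ b′ → b ≢ b′ → N * (N * (N * ∑V (base a b b′))) ≡ L * N ^ n
    E-base a b b′ ab ab′ bb′ = begin
      N * (N * (N * ∑V (base a b b′))) ≡⟨ cong (λ z → N * (N * z)) (E-colour b′ β (colour α a · colour β b) x₀ (independent-· (independent-colour α ab′) (independent-colour β bb′))) ⟩
      N * (N * (# β * ∑V (colour α a · colour β b))) ≡⟨ cong (λ z → N * (N * z)) (cong (_* ∑V (colour α a · colour β b)) β-size ∙ +-identityʳ _) ⟩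
      N * (N * ∑V (colour α a · colour β b)) ≡⟨ cong (N *_) (E-colour b β (colour α a) x₀ (independent-colour α ab)) ⟩
      N * (# β * ∑V (colour α a)) ≡⟨ cong (N *_) (cong (_* ∑V (colour α a)) β-size ∙ +-identityʳ _) ⟩
      N * ∑V (colour α a) ≡⟨ cong (N *_) (∑V-cong {k = n} {F = colour α a} {H = (λ _ → 1) · colour α a} (λ c → ≡-sym (+-identityʳ _))) ⟩
      N * ∑V ((λ _ → 1) · colour α a) ≡⟨ E-colour a α (λ _ → 1) x₀ (independent-const 1) ⟩
      # α * ∑V {n = N} {k = n} (λ _ → 1) ≡⟨ cong₂ _*_ α-size (E-one n) ⟩
      L * N ^ n ∎
      where open ≡-Reasoning

    E-β : ∀ (g : Colouring → ℕ) v → Independent v g → N * ∑V (g · colour β v) ≡ ∑V g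
    E-β g v ind = E-colour v β g x₀ ind ∙ cong (_* ∑V g) β-size ∙ +-identityʳ _

    E-α : ∀ (g : Colouring → ℕ) v → Independent v g → N * ∑V (g · colour α v) ≡ L * ∑V g
    E-α g v ind = E-colour v α g x₀ ind ∙ cong (_* ∑V g) α-size

    reassoc : ∀ (f g h : Colouring → ℕ) → ∑V (f · (g · h)) ≡ ∑V (f · g · h)
    reassoc f g h = ∑V-cong {k = n} (λ c → ≡-sym (*-assoc (f c) (g c) (h c)))

    module _ (a b b′ : Fin n) where

      g = base a b b′

      fresh-elim : ∀ {v} → fresh a b b′ v ≡ true → v ≢ a × v ≢ b × v ≢ b′
      fresh-elim {v} p = ==-false (not-elim (∧-fst p)) , ==-false (not-elim (∧-fst q)) , ==-false (not-elim (∧-snd {not (v == b)} q))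
        where q = ∧-snd {not (v == a)} p

      g-independent : ∀ v → fresh a b b′ v ≡ true → Independent v g
      g-independent v p = independent-· (independent-· (independent-colour α (λ e → proj₁ q (≡-sym e))) (independent-colour β (λ e → proj₁ (proj₂ q) (≡-sym e)))) (independent-colour β (λ e → proj₂ (proj₂ q) (≡-sym e)))
        where q = fresh-elim {v} p

      E-count₁ : N * ∑V (g · count₁ a b b′) ≤ # (conflict₁ a b b′) * ∑V g
      E-count₁ = ≤-trans (E-∑ g N (λ v c → ι (conflict₁ a b b′ v) * colour β v c) (λ v → ι (conflict₁ a b b′ v) * ∑V g)
        (λ v → E-ι g N (conflict₁ a b b′ v) (colour β v) (∑V g) (λ p → ≤-reflexive (E-β g v (g-independent v (∧-fst p))))))
        (≤-reflexive (∑-*ʳ (λ v → ι (conflict₁ a b b′ v)) (∑V g)))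

      E-count₂ : N * ∑V (g · count₂ a b b′) ≤ # (conflict₂ a b b′) * (L * ∑V g)
      E-count₂ = ≤-trans (E-∑ g N (λ v c → ι (conflict₂ a b b′ v) * colour α v c) (λ v → ι (conflict₂ a b b′ v) * (L * ∑V g))
        (λ v → E-ι g N (conflict₂ a b b′ v) (colour α v) (L * ∑V g) (λ p → ≤-reflexive (E-α g v (g-independent v (∧-fst p))))))
        (≤-reflexive (∑-*ʳ (λ v → ι (conflict₂ a b b′ v)) (L * ∑V g)))

      E-αβ : ∀ x v → fresh a b b′ x ≡ true → fresh a b b′ v ≡ true → x ≢ v → N * N * ∑V (g · (colour α x · colour β v)) ≡ L * ∑V g
      E-αβ x v fx fv xv = cong (N * N *_) (reassoc g (colour α x) (colour β v)) ∙ *-assoc N N _ ∙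
        cong (N *_) (E-β (g · colour α x) v (independent-· (g-independent v fv) (independent-colour α xv))) ∙ E-α g x (g-independent x fx)

      E-αββ : ∀ x v w → fresh a b b′ x ≡ true → fresh a b b′ v ≡ true → fresh a b b′ w ≡ true → x ≢ v → x ≢ w → v ≢ w →
        N * N * N * ∑V (g · (colour α x · colour β v · colour β w)) ≡ L * ∑V g
      E-αββ x v w fx fv fw xv xw vw = cong (N * N * N *_) (reassoc g (colour α x · colour β v) (colour β w)) ∙ *-assoc (N * N) N _ ∙
        cong (N * N *_) (E-β (g · (colour α x · colour β v)) w (independent-· (g-independent w fw) (independent-· (independent-colour α xw) (independent-colour β vw)))) ∙ E-αβ x v fx fv xv

      E-count₃ : N * N * ∑V (g · count₃ a b b′) ≤ ∑ (λ x → # (conflict₃ a b b′ x)) * (L * ∑V g)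
      E-count₃ = ≤-trans (E-∑ g (N * N) (λ x c → ∑ (λ v → ι (conflict₃ a b b′ x v) * (colour α x · colour β v) c)) (λ x → # (conflict₃ a b b′ x) * (L * ∑V g))
        (λ x → ≤-trans (E-∑ g (N * N) (λ v c → ι (conflict₃ a b b′ x v) * (colour α x · colour β v) c) (λ v → ι (conflict₃ a b b′ x v) * (L * ∑V g))
          (λ v → E-ι g (N * N) (conflict₃ a b b′ x v) (colour α x · colour β v) (L * ∑V g) (λ p → ≤-reflexive (single x v p))))
          (≤-reflexive (∑-*ʳ (λ v → ι (conflict₃ a b b′ x v)) (L * ∑V g)))))
        (≤-reflexive (∑-*ʳ (λ x → # (conflict₃ a b b′ x)) (L * ∑V g)))
        where
        single : ∀ x v → conflict₃ a b b′ x v ≡ true → N * N * ∑V (g · (colour α x · colour β v)) ≡ L * ∑V g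
        single x v p = E-αβ x v (∧-fst px) (∧-fst pv) (λ { refl → true≢false (∧-snd {W x} (∧-snd {fresh a b b′ x} pv)) (irrefl G x) })
          where px = ∧-fst p
                pv = ∧-snd {fresh a b b′ x ∧ (A x ∧ (o x a ∧ (adj G x b ∨ adj G x b′)))} p

      E-count₄ : N * N * N * ∑V (g · count₄ a b b′) ≤ ∑ (λ x → ∑ (λ v → # (conflict₄ a b b′ x v))) * (L * ∑V g)
      E-count₄ = ≤-trans (E-∑ g M (λ x c → ∑ (λ v → ∑ (λ w → ι (conflict₄ a b b′ x v w) * (Z x v w) c))) (λ x → ∑ (λ v → # (conflict₄ a b b′ x v)) * (L * ∑V g))
        (λ x → ≤-trans (E-∑ g M (λ v c → ∑ (λ w → ι (conflict₄ a b b′ x v w) * (Z x v w) c)) (λ v → # (conflict₄ a b b′ x v) * (L * ∑V g))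
          (λ v → ≤-trans (E-∑ g M (λ w c → ι (conflict₄ a b b′ x v w) * (Z x v w) c) (λ w → ι (conflict₄ a b b′ x v w) * (L * ∑V g))
            (λ w → E-ι g M (conflict₄ a b b′ x v w) (Z x v w) (L * ∑V g) (λ p → ≤-reflexive (single x v w p))))
            (≤-reflexive (∑-*ʳ (λ w → ι (conflict₄ a b b′ x v w)) (L * ∑V g)))))
          (≤-reflexive (∑-*ʳ (λ v → # (conflict₄ a b b′ x v)) (L * ∑V g)))))
        (≤-reflexive (∑-*ʳ (λ x → ∑ (λ v → # (conflict₄ a b b′ x v))) (L * ∑V g)))
        where
        M = N * N * N
        Z : Fin n → Fin n → Fin n → Colouring → ℕ
        Z x v w = colour α x · colour β v · colour β w
        single : ∀ x v w → conflict₄ a b b′ x v w ≡ true → M * ∑V (g · Z x v w) ≡ L * ∑V g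
        single x v w p = E-αββ x v w (∧-fst px) (∧-fst pv) (∧-fst pw) (distinct pv) (distinct pw)
            (==-false (not-elim (∧-snd {Nbr a b b′ x w} q)))
          where
          px = ∧-fst p
          pvw = ∧-snd {fresh a b b′ x ∧ (A x ∧ o x a)} p
          pv = ∧-fst pvw
          q = ∧-snd {Nbr a b b′ x v} pvw
          pw = ∧-fst q
          distinct : ∀ {v} → Nbr a b b′ x v ≡ true → x ≢ v
          distinct {v} r refl = true≢false (∧-snd {W x} (∧-snd {fresh a b b′ x} r)) (irrefl G x)

      scale : ∀ M x y z → 0 < M → M * x ≤ y * z → 8 * y ≤ M → 8 * x ≤ z
      scale M x y z M>0 p q = ≤-cancel M M>0 (≡≤ (l₁ M x) (≤-trans (*-monoʳ-≤ 8 p)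
        (≡≤ (≡-sym (*-assoc 8 y z)) (*-monoˡ-≤ z q))))
        where l₁ : ∀ m x → m * (8 * x) ≡ 8 * (m * x)
              l₁ = solve-∀

      -- Given that the triple is sampled, each of the four kinds of conflict has expectation at
      -- most 1/8, so all of them together at most 1/2.
      E-conflicts : 0 < N → 8 * # (conflict₁ a b b′) ≤ N → 8 * (# (conflict₂ a b b′) * L) ≤ N →
        8 * (∑ (λ x → # (conflict₃ a b b′ x)) * L) ≤ N * N → 8 * (∑ (λ x → ∑ (λ v → # (conflict₄ a b b′ x v))) * L) ≤ N * N * N →
        2 * ∑V (g · conflicts a b b′) ≤ ∑V g
      E-conflicts N>0 h₁ h₂ h₃ h₄ = ≤-cancel 4 (s≤s z≤n) (≡≤ (cong (λ z → 4 * (2 * z)) split)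
        (≡≤ (l (∑V (g · count₁ a b b′)) (∑V (g · count₂ a b b′)) (∑V (g · count₃ a b b′)) (∑V (g · count₄ a b b′)))
        (≤-trans (+-mono-≤ (+-mono-≤ (+-mono-≤
            (scale N (∑V (g · count₁ a b b′)) (# (conflict₁ a b b′)) (∑V g) N>0 E-count₁ h₁)
            (scale N (∑V (g · count₂ a b b′)) (# (conflict₂ a b b′) * L) (∑V g) N>0 (assoc (# (conflict₂ a b b′)) E-count₂) h₂))
            (scale (N * N) (∑V (g · count₃ a b b′)) (κ₃ * L) (∑V g) (*-pos N>0 N>0) (assoc κ₃ E-count₃) h₃))
            (scale (N * N * N) (∑V (g · count₄ a b b′)) (κ₄ * L) (∑V g) (*-pos (*-pos N>0 N>0) N>0) (assoc κ₄ E-count₄) h₄))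
          (≤-reflexive (l′ (∑V g))))))
        where
        κ₃ κ₄ : ℕ
        κ₃ = ∑ (λ x → # (conflict₃ a b b′ x))
        κ₄ = ∑ (λ x → ∑ (λ v → # (conflict₄ a b b′ x v)))
        assoc : ∀ {x} y → x ≤ y * (L * ∑V g) → x ≤ y * L * ∑V g
        assoc y p = ≤-trans p (≤-reflexive (≡-sym (*-assoc y L (∑V g))))
        distrib : ∀ w x y z u → w * (x + y + z + u) ≡ w * x + w * y + w * z + w * u
        distrib = solve-∀
        split : ∑V (g · conflicts a b b′) ≡ ∑V (g · count₁ a b b′) + ∑V (g · count₂ a b b′) + ∑V (g · count₃ a b b′) + ∑V (g · count₄ a b b′)
        split = ∑V-cong {k = n} (λ c → distrib (g c) (count₁ a b b′ c) (count₂ a b b′ c) (count₃ a b b′ c) (count₄ a b b′ c)) ∙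
          ∑V-+ {k = n} (λ c → (g · count₁ a b b′) c + (g · count₂ a b b′) c + (g · count₃ a b b′) c) (g · count₄ a b b′) ∙
          cong (_+ ∑V (g · count₄ a b b′)) (∑V-+ {k = n} (λ c → (g · count₁ a b b′) c + (g · count₂ a b b′) c) (g · count₃ a b b′) ∙
          cong (_+ ∑V (g · count₃ a b b′)) (∑V-+ {k = n} (g · count₁ a b b′) (g · count₂ a b b′)))
        l : ∀ x y z w → 4 * (2 * (x + y + z + w)) ≡ 8 * x + 8 * y + 8 * z + 8 * w
        l = solve-∀
        l′ : ∀ z → z + z + z + z ≡ 4 * z
        l′ = solve-∀

    sampled : Colouring → VSet n
    sampled c v = W v ∧ β (lookup c v)

    E-sampled : N * ∑V (λ c → K * # (sampled c)) ≡ K * (# W * N ^ n)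
    E-sampled = begin
      N * ∑V (λ c → K * # (sampled c)) ≡⟨ cong (N *_) (∑V-* {k = n} K (λ c → # (sampled c)) ∙ cong (K *_) (∑V-cong {k = n} (λ c → ∑-cong (λ v → ι-∧ (W v) _)) ∙ ∑V-swap {k = n} (λ c v → ι (W v) * colour β v c))) ⟩
      N * (K * ∑ (λ v → ∑V (λ c → ι (W v) * colour β v c))) ≡⟨ l N K _ ⟩
      K * (N * ∑ (λ v → ∑V (λ c → ι (W v) * colour β v c))) ≡⟨ cong (K *_) (≡-sym (∑-* N (λ v → ∑V (λ c → ι (W v) * colour β v c))) ∙ ∑-cong (λ v → cong (N *_) (∑V-* {k = n} (ι (W v)) (colour β v)) ∙ l N (ι (W v)) _ ∙ cong (ι (W v) *_) (one v)) ∙ ∑-*ʳ (λ v → ι (W v)) (N ^ n)) ⟩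
      K * (# W * N ^ n) ∎
      where
      open ≡-Reasoning
      l = *-swap
      one : ∀ v → N * ∑V (colour β v) ≡ N ^ n
      one v = cong (N *_) (∑V-cong {k = n} {F = colour β v} {H = (λ _ → 1) · colour β v} (λ c → ≡-sym (+-identityʳ _))) ∙ E-β (λ _ → 1) v (independent-const 1) ∙ E-one n

    -- At least half of the sampled triples are good in expectation, that is T L / 2N³ for T triples
    -- in `P`, against K |W| / N for the sampled ends. The last hypothesis makes the former larger,
    -- so some colouring has the strict inequality.
    good-colouring : 0 < N → (∀ a b b′ → P a b b′ ≡ true → a ≢ b × a ≢ b′ × b ≢ b′) →
      (∀ a b b′ → P a b b′ ≡ true → 2 * ∑V (base a b b′ · conflicts a b b′) ≤ ∑V (base a b b′)) →
      2 * (N * (N * (K * # W))) < ∑₃ (λ a b b′ → ι (P a b b′)) * L →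
      ∃[ c ] K * # (sampled c) < ∑₃ (λ a b b′ → ι (good c a b b′))
    good-colouring N>0 distinct small enough = ∑V-<⇒∃ (≰⇒> contra)
      where
      T = ∑₃ (λ a b b′ → ι (P a b b′))
      S = ∑₃ (λ a b b′ → ι (P a b b′) * ∑V (base a b b′))
      R = ∑₃ (λ a b b′ → ι (P a b b′) * ∑V (base a b b′ · conflicts a b b′))
      EH = ∑V (λ c → ∑₃ (λ a b b′ → ι (good c a b b′)))
      EB = ∑V (λ c → K * # (sampled c))
      S≤ : S ≤ EH + R
      S≤ = begin
        S ≡⟨ ∑₃-cong (λ a b b′ → ≡-sym (∑V-* {k = n} (ι (P a b b′)) (base a b b′))) ∙ ≡-sym (∑V-∑₃ (λ c a b b′ → ι (P a b b′) * base a b b′ c)) ⟩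
        ∑V (λ c → ∑₃ (λ a b b′ → ι (P a b b′) * base a b b′ c)) ≤⟨ ∑V-mono {k = n} (λ c → ∑₃-mono (base-≤ c)) ⟩
        ∑V (λ c → ∑₃ (λ a b b′ → ι (good c a b b′) + ι (P a b b′) * (base a b b′ c * conflicts a b b′ c))) ≡⟨ ∑V-cong {k = n} (λ c → ∑₃-+ (λ a b b′ → ι (good c a b b′)) _) ∙ ∑V-+ {k = n} (λ c → ∑₃ (λ a b b′ → ι (good c a b b′))) _ ⟩
        EH + ∑V (λ c → ∑₃ (λ a b b′ → ι (P a b b′) * (base a b b′ c * conflicts a b b′ c))) ≡⟨ cong (EH +_) (∑V-∑₃ (λ c a b b′ → ι (P a b b′) * (base a b b′ c * conflicts a b b′ c)) ∙ ∑₃-cong (λ a b b′ → ∑V-* {k = n} (ι (P a b b′)) (base a b b′ · conflicts a b b′))) ⟩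
        EH + R ∎
        where open ≤-Reasoning
      R≤ : 2 * R ≤ S
      R≤ = ≡≤ (≡-sym (∑₃-* 2 (λ a b b′ → ι (P a b b′) * ∑V (base a b b′ · conflicts a b b′))))
        (∑₃-mono (λ a b b′ → ≡≤ (l (ι (P a b b′)) _) (ι*-mono (small a b b′))))
        where l : ∀ i x → 2 * (i * x) ≡ i * (2 * x)
              l = solve-∀
      NS : N * (N * (N * S)) ≡ T * (L * N ^ n)
      NS = cong (λ z → N * (N * z)) (≡-sym (∑₃-* N X₀)) ∙ cong (N *_) (≡-sym (∑₃-* N (λ a b b′ → N * X₀ a b b′))) ∙ ≡-sym (∑₃-* N (λ a b b′ → N * (N * X₀ a b b′)))
        ∙ ∑₃-cong (λ a b b′ → l N (ι (P a b b′)) _ ∙ ι*-cong (λ p → E-base a b b′ (proj₁ (distinct a b b′ p)) (proj₁ (proj₂ (distinct a b b′ p))) (proj₂ (proj₂ (distinct a b b′ p)))) ∙ *-comm (ι (P a b b′)) _)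
        ∙ ∑₃-* (L * N ^ n) (λ a b b′ → ι (P a b b′)) ∙ *-comm (L * N ^ n) T
        where
        X₀ : Fin n → Fin n → Fin n → ℕ
        X₀ a b b′ = ι (P a b b′) * ∑V (base a b b′)
        l : ∀ m i x → m * (m * (m * (i * x))) ≡ i * (m * (m * (m * x)))
        l = solve-∀
      contra : ¬ (EH ≤ EB)
      contra EH≤EB = <⇒≱ (*-monoˡ-< (N ^ n) {{>-nonZero (^-pos N>0 n)}} enough) (begin
        T * L * N ^ n ≡⟨ *-assoc T L (N ^ n) ∙ ≡-sym NS ⟩
        N * (N * (N * S)) ≤⟨ *-monoʳ-≤ N (*-monoʳ-≤ N (*-monoʳ-≤ N S≤2EB)) ⟩
        N * (N * (N * (2 * EB))) ≡⟨ l₁ N EB ∙ cong (λ z → 2 * (N * (N * z))) E-sampled ∙ l₂ N K (# W) (N ^ n) ⟩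
        2 * (N * (N * (K * # W))) * N ^ n ∎)
        where
        open ≤-Reasoning
        l₁ : ∀ m x → m * (m * (m * (2 * x))) ≡ 2 * (m * (m * (m * x)))
        l₁ = solve-∀
        l₂ : ∀ m k w x → 2 * (m * (m * (k * (w * x)))) ≡ 2 * (m * (m * (k * w))) * x
        l₂ = solve-∀
        S≤2EB : S ≤ 2 * EB
        S≤2EB = ≤-by (+-mono-≤ S≤ (+-mono-≤ S≤ (+-mono-≤ R≤ (*-monoʳ-≤ 2 EH≤EB)))) 0 (l S EH R EB)
          where l : ∀ s e r b → s + (e + r + (e + r + (s + 2 * b))) + 0 ≡ 2 * b + (s + (s + (2 * r + 2 * e)))
                l = solve-∀

  -- The structure found by a good colouring

  module Chosen (c : Colouring)
    (o-adj : ∀ u v → o u v ≡ true → Adj G u v)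
    (o-covers : ∀ u v → W u ≡ true → W v ≡ true → Adj G u v → o u v ≡ true ⊎ o v u ≡ true)
    (A⊆W : A ⊆ W)
    (αβ : ∀ x → α x ≡ true → β x ≡ true → ⊥)
    (P-A : ∀ {a b b′} → P a b b′ ≡ true → A a ≡ true)
    (P-W : ∀ {a b b′} → P a b b′ ≡ true → W b ≡ true)
    (P-adj : ∀ {a b b′} → P a b b′ ≡ true → Adj G a b)
    (P-≢ : ∀ {a b b′} → P a b b′ ≡ true → b ≢ b′)
    (P-nonadj : ∀ {a b b′} → P a b b′ ≡ true → adj G b b′ ≡ false)
    (P-sym : ∀ {a b b′} → P a b b′ ≡ true → P a b′ b ≡ true) where

    c∈α c∈β : Fin n → Set
    c∈α v = α (lookup c v) ≡ true
    c∈β v = β (lookup c v) ≡ true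

    α≢β : ∀ {u v} → c∈α u → c∈β v → u ≢ v
    α≢β p q refl = αβ _ p q

    ∑≡0 : ∀ {k} {f : Fin k → ℕ} → ∑ f ≡ 0 → ∀ v → f v ≡ 0
    ∑≡0 {f = f} e v = n≤0⇒n≡0 (≤-trans (term≤∑ f v) (≤-reflexive e))

    colour-true : ∀ (φ : Fin N → Bool) v → φ (lookup c v) ≡ true → colour φ v c ≡ 1
    colour-true φ v = ι-true

    clash : ∀ {κ x} → ι κ * x ≡ 0 → κ ≡ true → x ≡ 1 → ⊥
    clash {κ} {x} e k refl with trans (≡-sym e) (cong (_* 1) (ι-true k))
    ... | ()

    record Triple (a b b′ : Fin n) : Set where
      field
        triple : P a b b′ ≡ true
        a∈ : c∈α a
        b∈ : c∈β b
        b′∈ : c∈β b′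
        zero₁ : count₁ a b b′ c ≡ 0
        zero₂ : count₂ a b b′ c ≡ 0
        zero₃ : count₃ a b b′ c ≡ 0
        zero₄ : count₄ a b b′ c ≡ 0

      fresh-intro : ∀ {v} → v ≢ a → v ≢ b → v ≢ b′ → fresh a b b′ v ≡ true
      fresh-intro p q r = ∧-intro (not-intro (≢-== p)) (∧-intro (not-intro (≢-== q)) (not-intro (≢-== r)))

      sampled-neighbour : ∀ v → W v ≡ true → Adj G a v → c∈β v → v ≡ b ⊎ v ≡ b′
      sampled-neighbour v Wv av βv with v ≟ b | v ≟ b′
      ... | yes e | _ = inj₁ e
      ... | no _ | yes e = inj₂ e
      ... | no v≢b | no v≢b′ = ⊥-elim (clash (∑≡0 zero₁ v)
        (∧-intro (fresh-intro (λ e → α≢β a∈ βv (≡-sym e)) v≢b v≢b′) (∨-introˡ (∧-intro Wv av))) (colour-true β v βv))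

      no-back : ∀ v → c∈β v → o v b ∨ o v b′ ≡ true → ⊥
      no-back v βv ov = clash (∑≡0 zero₁ v)
        (∧-intro (fresh-intro (λ e → α≢β a∈ βv (≡-sym e)) (λ { refl → at-b (∨-elim ov) }) (λ { refl → at-b′ (∨-elim ov) }))
          (∨-introʳ {W v ∧ adj G a v} ov)) (colour-true β v βv)
        where
        at-b : o b b ≡ true ⊎ o b b′ ≡ true → ⊥
        at-b (inj₁ p) = true≢false (o-adj b b p) (irrefl G b)
        at-b (inj₂ p) = true≢false (o-adj b b′ p) (P-nonadj triple)
        at-b′ : o b′ b ≡ true ⊎ o b′ b′ ≡ true → ⊥
        at-b′ (inj₁ p) = true≢false (trans (sym G b b′) (o-adj b′ b p)) (P-nonadj triple)
        at-b′ (inj₂ p) = true≢false (o-adj b′ b′ p) (irrefl G b′)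

      common-neighbour : ∀ x → A x ≡ true → Adj G x b → Adj G x b′ → c∈α x → x ≡ a
      common-neighbour x Ax xb xb′ αx with x ≟ a
      ... | yes e = e
      ... | no x≢a = ⊥-elim (clash (∑≡0 zero₂ x) (∧-intro (fresh-intro x≢a (α≢β αx b∈) (α≢β αx b′∈)) (∧-intro Ax (∧-intro xb xb′))) (colour-true α x αx))

      -- Depending on how many of `v` and `w` are among the ends b and b′, such an `x` would be a
      -- conflict of kind 4 (none), 3 (one) or 2 (both).
      no-back-star : ∀ x → A x ≡ true → o x a ≡ true → c∈α x → ∀ v w → v ≢ w → W v ≡ true → W w ≡ true →
        Adj G x v → Adj G x w → c∈β v → c∈β w → ⊥
      no-back-star x Ax ox αx v w v≢w Wv Ww xv xw βv βw = go (endpoint v) (endpoint w)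
        where
        x≢a : x ≢ a
        x≢a refl = true≢false (o-adj x x ox) (irrefl G x)
        fx : fresh a b b′ x ≡ true
        fx = fresh-intro x≢a (α≢β αx b∈) (α≢β αx b′∈)
        endpoint : ∀ u → (u ≡ b ⊎ u ≡ b′) ⊎ (u ≢ b × u ≢ b′)
        endpoint u with u ≟ b | u ≟ b′
        ... | yes e | _ = inj₁ (inj₁ e)
        ... | no _ | yes e = inj₁ (inj₂ e)
        ... | no p | no q = inj₂ (p , q)
        nbr : ∀ u → W u ≡ true → Adj G x u → c∈β u → u ≢ b × u ≢ b′ → Nbr a b b′ x u ≡ true
        nbr u Wu xu βu (p , q) = ∧-intro (fresh-intro (λ e → α≢β a∈ βu (≡-sym e)) p q) (∧-intro Wu xu)
        one : ∀ u u′ → u ≡ b ⊎ u ≡ b′ → Adj G x u → Nbr a b b′ x u′ ≡ true → c∈β u′ → ⊥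
        one u u′ e xu nb βu′ = clash (∑≡0 (∑≡0 zero₃ x) u′) (∧-intro (∧-intro fx (∧-intro Ax (∧-intro ox (side e)))) nb)
          (cong₂ _*_ (colour-true α x αx) (colour-true β u′ βu′))
          where
          side : u ≡ b ⊎ u ≡ b′ → adj G x b ∨ adj G x b′ ≡ true
          side (inj₁ refl) = ∨-introˡ xu
          side (inj₂ refl) = ∨-introʳ {adj G x b} xu
        go : (v ≡ b ⊎ v ≡ b′) ⊎ (v ≢ b × v ≢ b′) → (w ≡ b ⊎ w ≡ b′) ⊎ (w ≢ b × w ≢ b′) → ⊥
        go (inj₁ (inj₁ p)) (inj₁ (inj₁ q)) = v≢w (trans p (≡-sym q))
        go (inj₁ (inj₂ p)) (inj₁ (inj₂ q)) = v≢w (trans p (≡-sym q))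
        go (inj₁ (inj₁ refl)) (inj₁ (inj₂ refl)) = x≢a (common-neighbour x Ax xv xw αx)
        go (inj₁ (inj₂ refl)) (inj₁ (inj₁ refl)) = x≢a (common-neighbour x Ax xw xv αx)
        go (inj₁ e) (inj₂ q) = one v w e xv (nbr w Ww xw βw q) βw
        go (inj₂ p) (inj₁ e) = one w v e xw (nbr v Wv xv βv p) βv
        go (inj₂ p) (inj₂ q) = clash (∑≡0 (∑≡0 (∑≡0 zero₄ x) v) w)
          (∧-intro (∧-intro fx (∧-intro Ax ox)) (∧-intro (nbr v Wv xv βv p) (∧-intro (nbr w Ww xw βw q) (not-intro (≢-== v≢w)))))
          (cong₂ _*_ (cong₂ _*_ (colour-true α x αx) (colour-true β v βv)) (colour-true β w βw))

    open Triple

    good⇒Triple : ∀ {a b b′} → good c a b b′ ≡ true → Triple a b b′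
    good⇒Triple {a} {b} {b′} p = record
      { triple = ∧-fst p
      ; a∈ = ∧-fst (∧-fst cs) ; b∈ = ∧-snd {α (lookup c a)} (∧-fst cs) ; b′∈ = ∧-snd {α (lookup c a) ∧ β (lookup c b)} cs
      ; zero₁ = m+n≡0⇒m≡0 _ e₂ ; zero₂ = m+n≡0⇒n≡0 (count₁ a b b′ c) e₂
      ; zero₃ = m+n≡0⇒n≡0 (count₁ a b b′ c + count₂ a b b′ c) e₁
      ; zero₄ = m+n≡0⇒n≡0 (count₁ a b b′ c + count₂ a b b′ c + count₃ a b b′ c) e }
      where
      rest = ∧-snd {P a b b′} p
      cs = ∧-fst rest
      e : conflicts a b b′ c ≡ 0
      e = n<1⇒n≡0 (<ᵇ-elim (∧-snd {(α (lookup c a) ∧ β (lookup c b)) ∧ β (lookup c b′)} rest))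
      e₁ : count₁ a b b′ c + count₂ a b b′ c + count₃ a b b′ c ≡ 0
      e₁ = m+n≡0⇒m≡0 _ e
      e₂ : count₁ a b b′ c + count₂ a b b′ c ≡ 0
      e₂ = m+n≡0⇒m≡0 _ e₁

    -- Allowing both orders of the ends makes `F` symmetric without comparing the conflicts of a
    -- triple with those of its reflection.
    Middle : Fin n → Fin n → Fin n → Bool
    Middle a b b′ = good c a b b′ ∨ good c a b′ b

    linked : Fin n → Fin n → Bool
    linked b b′ = not (allF (λ a → not (Middle a b b′)))

    linked-elim : ∀ {b b′} → linked b b′ ≡ true → ∃[ a ] (Triple a b b′ ⊎ Triple a b′ b)
    linked-elim {b} {b′} p with allF-false (not-elim p)
    ... | a , q with ∨-elim {good c a b b′} (not-false q)
    ...   | inj₁ r = a , inj₁ (good⇒Triple r)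
    ...   | inj₂ r = a , inj₂ (good⇒Triple r)

    linked-swap : ∀ {b b′} → linked b b′ ≡ true → linked b′ b ≡ true
    linked-swap {b} {b′} p with allF-false (not-elim p)
    ... | a , q = not-intro (≢true (λ r → true≢false ([ ∨-introʳ {good c a b′ b} , ∨-introˡ ]′ (∨-elim {good c a b b′} (not-false q))) (not-elim (allF-elim r a))))

    linked-intro : ∀ {a b b′} → good c a b b′ ≡ true → linked b b′ ≡ true
    linked-intro {a} p = not-intro (≢true (λ r → true≢false (∨-introˡ p) (not-elim (allF-elim r a))))

    F : Graph n
    F = record
      { adj = linked
      ; sym = λ b b′ → bool-ext linked-swap linked-swap
      ; irrefl = λ b → ≢true (λ p → [ (λ t → P-≢ (triple t) refl) , (λ t → P-≢ (triple t) refl) ]′ (proj₂ (linked-elim p))) }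

    -- Sampled vertices without sampled in-neighbours. Every edge inside `W` is oriented, so `B` is
    -- independent, and excluding conflict (1) keeps the ends of good triples in `B`.
    B : VSet n
    B v = (W v ∧ β (lookup c v)) ∧ allF (λ u → not (o u v ∧ β (lookup c u)))

    B-W : ∀ {v} → B v ≡ true → W v ≡ true
    B-W p = ∧-fst (∧-fst p)

    B-β : ∀ {v} → B v ≡ true → c∈β v
    B-β {v} p = ∧-snd {W v} (∧-fst p)

    B-indep : ∀ x y → B x ≡ true → B y ≡ true → ¬ Adj G x y
    B-indep x y Bx By a = [ (λ p → avoid x y Bx By p) , (λ p → avoid y x By Bx p) ]′ (o-covers x y (B-W Bx) (B-W By) a)
      where
      avoid : ∀ x y → B x ≡ true → B y ≡ true → o x y ≡ true → ⊥
      avoid x y Bx By p = true≢false (∧-intro p (B-β Bx)) (not-elim (allF-elim (∧-snd {W y ∧ β (lookup c y)} By) x))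

    Triple⇒B : ∀ {a b b′} → Triple a b b′ → B b ≡ true × B b′ ≡ true
    Triple⇒B {a} {b} {b′} t = make b (P-W (triple t)) (b∈ t) (λ u q r → no-back t u r (∨-introˡ q)) ,
        make b′ (P-W (P-sym (triple t))) (b′∈ t) (λ u q r → no-back t u r (∨-introʳ {o u b} q))
      where
      make : ∀ v → W v ≡ true → c∈β v → (∀ u → o u v ≡ true → c∈β u → ⊥) → B v ≡ true
      make v w q f = ∧-intro (∧-intro w q) (allF-intro (λ u → not-intro (≢true (λ r → f u (∧-fst r) (∧-snd {o u v} r)))))

    record Mid (a b b′ : Fin n) : Set where
      field
        left : Adj G b a
        right : Adj G a b′
        not∈B : B a ≡ false
        neighbour : ∀ x → B x ≡ true → Adj G a x → x ≡ b ⊎ x ≡ b′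
        starred : A a ≡ true × c∈α a
        ends : ∃[ v ] ∃[ w ] v ≢ w × W v ≡ true × W w ≡ true × Adj G a v × Adj G a w × c∈β v × c∈β w
        no-back-stars : ∀ x → A x ≡ true → o x a ≡ true → c∈α x → ∀ v w → v ≢ w → W v ≡ true → W w ≡ true →
          Adj G x v → Adj G x w → c∈β v → c∈β w → ⊥

    open Mid

    Triple⇒Mid : ∀ {a b b′} → Triple a b b′ ⊎ Triple a b′ b → Mid a b b′
    Triple⇒Mid {a} {b} {b′} (inj₁ t) = record
      { left = trans (sym G b a) (P-adj (triple t))
      ; right = P-adj (P-sym (triple t))
      ; not∈B = ≢true (λ p → αβ _ (a∈ t) (B-β p))
      ; neighbour = λ x Bx ax → sampled-neighbour t x (B-W Bx) ax (B-β Bx)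
      ; starred = P-A (triple t) , a∈ t
      ; ends = b , b′ , P-≢ (triple t) , P-W (triple t) , P-W (P-sym (triple t)) , P-adj (triple t) , P-adj (P-sym (triple t)) , b∈ t , b′∈ t
      ; no-back-stars = no-back-star t }
    Triple⇒Mid {a} {b} {b′} (inj₂ t) = record
      { left = trans (sym G b a) (P-adj (P-sym (triple t)))
      ; right = P-adj (triple t)
      ; not∈B = ≢true (λ p → αβ _ (a∈ t) (B-β p))
      ; neighbour = λ x Bx ax → [ inj₂ , inj₁ ]′ (sampled-neighbour t x (B-W Bx) ax (B-β Bx))
      ; starred = P-A (triple t) , a∈ t
      ; ends = b′ , b , P-≢ (triple t) , P-W (triple t) , P-W (P-sym (triple t)) , P-adj (triple t) , P-adj (P-sym (triple t)) , b∈ t , b′∈ t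
      ; no-back-stars = no-back-star t }

    middle : ∀ {b b′} → Dec (linked b b′ ≡ true) → Fin n
    middle {b} (yes p) = proj₁ (linked-elim p)
    -- A default off the edges of `F`; `mid-Mid` speaks of linked pairs only.
    middle {b} (no _) = b

    mid : Fin n → Fin n → Fin n
    mid b b′ = middle (linked b b′ Data.Bool.≟ true)

    mid-Mid : ∀ b b′ → linked b b′ ≡ true → Mid (mid b b′) b b′
    mid-Mid b b′ p = go (linked b b′ Data.Bool.≟ true)
      where
      go : (x : Dec (linked b b′ ≡ true)) → Mid (middle x) b b′
      go (yes q) = Triple⇒Mid (proj₂ (linked-elim q))
      go (no q) = ⊥-elim (q p)

    -- An edge between two middle vertices is oriented, and its tail would be an in-neighbour of a
    -- middle vertex with two sampled neighbours of its own.
    Mid-indep : ∀ {a b b′ a₂ d d′} → Mid a b b′ → Mid a₂ d d′ → ¬ Adj G a a₂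
    Mid-indep {a} {a₂ = a₂} m m₂ adj-aa₂ = go (o-covers a a₂ (A⊆W a (proj₁ (starred m))) (A⊆W a₂ (proj₁ (starred m₂))) adj-aa₂) (ends m) (ends m₂)
      where
      go : o a a₂ ≡ true ⊎ o a₂ a ≡ true → (∃[ v ] ∃[ w ] v ≢ w × W v ≡ true × W w ≡ true × Adj G a v × Adj G a w × c∈β v × c∈β w) →
        (∃[ v ] ∃[ w ] v ≢ w × W v ≡ true × W w ≡ true × Adj G a₂ v × Adj G a₂ w × c∈β v × c∈β w) → ⊥
      go (inj₁ p) (v , w , v≢w , Wv , Ww , av , aw , βv , βw) _ =
        no-back-stars m₂ a (proj₁ (starred m)) p (proj₂ (starred m)) v w v≢w Wv Ww av aw βv βw
      go (inj₂ p) _ (v , w , v≢w , Wv , Ww , av , aw , βv , βw) =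
        no-back-stars m a₂ (proj₁ (starred m₂)) p (proj₂ (starred m₂)) v w v≢w Wv Ww av aw βv βw

    unique-middle : ∀ {a a₂ b b′} → Triple a b b′ → Triple a₂ b b′ → a₂ ≡ a
    unique-middle {a₂ = a₂} t t₂ = common-neighbour t a₂ (P-A (triple t₂)) (P-adj (triple t₂)) (P-adj (P-sym (triple t₂))) (a∈ t₂)

    ∑-unique : ∀ {Q : VSet n} {b} → (∀ x y → Q x ≡ true → Q y ≡ true → x ≡ y) → (∀ x → Q x ≡ true → b ≡ true) → # Q ≤ ι b
    ∑-unique {Q} {b} uniq imp with any? (λ x → Q x Data.Bool.≟ true)
    ... | no q = ≡≤ (∑-zero (λ x → ι-false (≢true (λ p → q (x , p))))) z≤n
    ... | yes (x , p) = ≤-trans (#-mono {P = Q} {Q = _== x} (λ y q → subst (λ w → y == w ≡ true) (uniq y x q p) (==-refl y)))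
      (≤-reflexive (#-singleton x ∙ ≡-sym (ι-true (imp x p))))

    open DegreeSums F using (D)

    -- By conflict (2) an ordered pair of ends belongs to at most one good triple, so good triples
    -- inject into the ordered edges of `F` inside `B`.
    good-≤-D : ∑₃ (λ a b b′ → ι (good c a b b′)) ≤ D B
    good-≤-D = begin
      ∑₃ (λ a b b′ → ι (good c a b b′)) ≡⟨ ∑-swap (λ a b → ∑ (λ b′ → ι (good c a b b′))) ∙ ∑-cong (λ b → ∑-swap (λ a b′ → ι (good c a b b′))) ⟩
      ∑ (λ b → ∑ (λ b′ → # (λ a → good c a b b′))) ≤⟨ ∑-mono (λ b → ∑-mono (λ b′ → ∑-unique {Q = λ a → good c a b b′} {b = B b ∧ (B b′ ∧ linked b b′)}
          (λ x y p q → unique-middle (good⇒Triple q) (good⇒Triple p))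
          (λ x p → ∧-intro (proj₁ (Triple⇒B (good⇒Triple p))) (∧-intro (proj₂ (Triple⇒B (good⇒Triple p))) (linked-intro p))))) ⟩
      ∑ (λ b → ∑ (λ b′ → ι (B b ∧ (B b′ ∧ linked b b′)))) ≡⟨ ∑-cong (λ b → ∑-cong (λ b′ → ι-∧ (B b) _) ∙ ∑-* (ι (B b)) (λ b′ → ι (B b′ ∧ linked b b′))) ⟩
      D B ∎
      where open ≤-Reasoning

    B≤sampled : # B ≤ # (λ v → W v ∧ β (lookup c v))
    B≤sampled = #-mono {P = B} (λ v p → ∧-fst p)

    -- The sample contains `B`, so `D B` is at least K |B|, enough for all h·h paths of Mader's
    -- theorem.
    contains : ∀ {h} (H : Graph h) → 0 < h → 2 ^ (h * h) * h ≤ K →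
      K * # (λ v → W v ∧ β (lookup c v)) < ∑₃ (λ a b b′ → ι (good c a b b′)) → ContainsInducedSubdivision H G
    contains {h} H h>0 thr many = finish (Mader.mader F h h>0 (h * h) (remQuot {h} h) B B>0
        (≤-trans (*-mono-≤ (≡≤ (Mader.Threshold≡ F h h>0 (h * h)) thr) B≤sampled) (≤-trans (<⇒≤ many) good-≤-D)))
      where
      B>0 : 0 < # B
      B>0 = n≢0⇒n>0 (λ e → <⇒≱ (≤-<-trans z≤n (≤-trans many good-≤-D)) (≤-trans (DegreeSums.D-≤ F B) (≤-reflexive (cong (_* # B) e))))
      finish : TopologicalMinor F B (remQuot {h} h) → ContainsInducedSubdivision H G
      finish M = Weave.contains G F B mid
        (λ b b′ e → left (mid-Mid b b′ (proj₂ (proj₂ e))))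
        (λ b b′ e → right (mid-Mid b b′ (proj₂ (proj₂ e))))
        (λ b b′ e → not∈B (mid-Mid b b′ (proj₂ (proj₂ e))))
        (λ b b′ e → neighbour (mid-Mid b b′ (proj₂ (proj₂ e))))
        (λ b b′ d d′ e e′ → Mid-indep (mid-Mid b b′ (proj₂ (proj₂ e))) (mid-Mid d d′ (proj₂ (proj₂ e′))))
        B-indep M H

-- Dependent random choice

all∈ : VSet n → Vec (Fin n) k → Bool
all∈ X t = allF (λ u → X (lookup t u))

all∈-⊆ : {X X′ : VSet n} → X ⊆ X′ → (t : Vec (Fin n) k) → all∈ X t ≡ true → all∈ X′ t ≡ true
all∈-⊆ s t p = allF-intro (λ u → s _ (allF-elim p u))

opaque
  unfolding ∑V

  #-tuples : ∀ k (X : VSet n) → ∑V {k = k} (λ t → ι (all∈ X t)) ≡ # X ^ k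
  #-tuples zero X = refl
  #-tuples (suc k) X = ∑-cong (λ x → ∑V-cong {k = k} (λ t → ι-∧ (X x) (all∈ X t)) ∙ ∑V-* {k = k} (ι (X x)) (λ t → ι (all∈ X t)) ∙ cong (ι (X x) *_) (#-tuples k X))
    ∙ ∑-*ʳ (λ x → ι (X x)) (# X ^ k)

∑-ι*const : (P : VSet n) (c : ℕ) → ∑ (λ x → ι (P x) * c) ≡ # P * c
∑-ι*const P c = ∑-*ʳ (λ x → ι (P x)) c

∑-<⇒∃∈ : {P : VSet n} {f g : Fin n → ℕ} → 0 < # P → ∑ (λ x → ι (P x) * f x) ≤ ∑ (λ x → ι (P x) * g x) → ∃[ x ] P x ≡ true × f x ≤ g x
∑-<⇒∃∈ {n} {P} {f} {g} P>0 p = x , Px , ≤-pred (subst₂ _<_ (one (f x)) (one (suc (g x))) (proj₂ found))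
  where
  strict : ∑ (λ x → ι (P x) * f x) < ∑ (λ x → ι (P x) * suc (g x))
  strict = ≤-<-trans p (≤-trans (+-monoˡ-≤ (∑ (λ x → ι (P x) * g x)) P>0)
    (≤-reflexive (≡-sym (∑-cong (λ x → *-suc (ι (P x)) (g x)) ∙ ∑-+ (λ x → ι (P x)) (λ x → ι (P x) * g x)))))
  found : ∃[ x ] ι (P x) * f x < ι (P x) * suc (g x)
  found = ∑-<⇒∃ strict
  x = proj₁ found
  Px : P x ≡ true
  Px = ι-pos (pos-*⁻ˡ (≤-<-trans z≤n (proj₂ found)))
  one : ∀ y → ι (P x) * y ≡ y
  one y = cong (_* y) (ι-true Px) ∙ +-identityʳ y

module DependentRandomChoice {n : ℕ} (G : Graph n) (h : ℕ) (s T : ℕ) (s>0 : 0 < s) (Y : VSet n) (Y>0 : 0 < # Y) where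

  open Domination G

  common : Vec (Fin n) h → VSet n
  common t = joined (λ _ → true) t Y

  -- The factor T + 1 lets h rounds eliminate all of the at most T^h poor tuples; the factor 2s lets
  -- the same choice retain a 1/2s fraction of `X`.
  Q : ℕ
  Q = 2 * s * suc T

  poor : Vec (Fin n) h → Bool
  poor t = Q * # (common t) <ᵇ # Y

  #poor : VSet n → ℕ
  #poor X = ∑V {k = h} (λ t → ι (all∈ X t ∧ poor t))

  -- One random choice: a vertex y of Y whose neighbourhood keeps a 1/2s fraction of X while
  -- the number of poor tuples drops by the factor T + 1.
  step : ∀ X → (∀ x → X x ≡ true → # Y ≤ s * # (Y ∩ adj G x)) → 0 < # X → 0 < #poor X →
    ∃[ y ] # X ≤ 2 * s * # (X ∩ adj G y) × suc T * #poor (X ∩ adj G y) ≤ #poor X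
  step X deg X>0 P>0 = y , α-big , π-small
    where
    x = # X
    P = #poor X
    α π : Fin n → ℕ
    α y = # (X ∩ adj G y)
    π y = #poor (X ∩ adj G y)
    A = ∑ (λ y → ι (Y y) * α y)
    B = ∑ (λ y → ι (Y y) * π y)
    A-big : x * # Y ≤ s * A
    A-big = begin
      x * # Y ≡⟨ ≡-sym (∑-ι*const X (# Y)) ⟩
      ∑ (λ v → ι (X v) * # Y) ≤⟨ ∑-mono (λ v → ι*-mono (deg v)) ⟩
      ∑ (λ v → ι (X v) * (s * # (Y ∩ adj G v))) ≡⟨ ∑-cong (λ v → l (ι (X v)) s (# (Y ∩ adj G v)) ∙ cong (s *_) (≡-sym (∑-* (ι (X v)) (λ y → ι ((Y ∩ adj G v) y))))) ∙ ∑-* s (λ v → ∑ (λ y → ι (X v) * ι ((Y ∩ adj G v) y))) ⟩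
      s * ∑ (λ v → ∑ (λ y → ι (X v) * ι ((Y ∩ adj G v) y))) ≡⟨ cong (s *_) (∑-swap (λ v y → ι (X v) * ι ((Y ∩ adj G v) y)) ∙ ∑-cong (λ y → ∑-cong (λ v → flip y v) ∙ ∑-* (ι (Y y)) (λ v → ι ((X ∩ adj G y) v)))) ⟩
      s * A ∎
      where
      open ≤-Reasoning
      l = *-swap
      flip : ∀ y v → ι (X v) * ι ((Y ∩ adj G v) y) ≡ ι (Y y) * ι ((X ∩ adj G y) v)
      flip y v = cong (ι (X v) *_) (ι-∧ (Y y) (adj G v y)) ∙ l (ι (X v)) (ι (Y y)) _ ∙
        cong (λ b → ι (Y y) * (ι (X v) * ι b)) (sym G v y) ∙ cong (ι (Y y) *_) (≡-sym (ι-∧ (X v) (adj G y v)))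
    B-small : Q * B ≤ P * # Y
    B-small = begin
      Q * B ≡⟨ cong (Q *_) (∑-cong (λ y → ≡-sym (∑V-* {k = h} (ι (Y y)) (λ t → ι (all∈ (X ∩ adj G y) t ∧ poor t)))) ∙ ≡-sym (∑V-swap {k = h} (λ t y → ι (Y y) * ι (all∈ (X ∩ adj G y) t ∧ poor t)))) ∙ ≡-sym (∑V-* {k = h} Q (λ t → ∑ (λ y → ι (Y y) * ι (all∈ (X ∩ adj G y) t ∧ poor t)))) ⟩
      ∑V {k = h} (λ t → Q * ∑ (λ y → ι (Y y) * ι (all∈ (X ∩ adj G y) t ∧ poor t))) ≤⟨ ∑V-mono {k = h} (λ t → *-monoʳ-≤ Q (∑-mono (tuple t))) ⟩
      ∑V {k = h} (λ t → Q * ∑ (λ y → ι (all∈ X t ∧ poor t) * ι (common t y))) ≡⟨ ∑V-cong {k = h} (λ t → cong (Q *_) (∑-* (ι (all∈ X t ∧ poor t)) (λ y → ι (common t y))) ∙ l Q (ι (all∈ X t ∧ poor t)) _) ⟩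
      ∑V {k = h} (λ t → ι (all∈ X t ∧ poor t) * (Q * # (common t))) ≤⟨ ∑V-mono {k = h} (λ t → ι*-mono (λ p → <⇒≤ (<ᵇ-elim (∧-snd {all∈ X t} p)))) ⟩
      ∑V {k = h} (λ t → ι (all∈ X t ∧ poor t) * # Y) ≡⟨ ∑V-*ʳ {k = h} (λ t → ι (all∈ X t ∧ poor t)) (# Y) ⟩
      P * # Y ∎
      where
      open ≤-Reasoning
      l = *-swap
      tuple : ∀ t y → ι (Y y) * ι (all∈ (X ∩ adj G y) t ∧ poor t) ≤ ι (all∈ X t ∧ poor t) * ι (common t y)
      tuple t y = ≡≤ (≡-sym (ι-∧ (Y y) _)) (≤-trans (ι-mono imp) (≤-reflexive (ι-∧ (all∈ X t ∧ poor t) (common t y))))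
        where
        imp : Y y ∧ (all∈ (X ∩ adj G y) t ∧ poor t) ≡ true → (all∈ X t ∧ poor t) ∧ common t y ≡ true
        imp p = ∧-intro (∧-intro (all∈-⊆ {X = X ∩ adj G y} {X′ = X} (λ v q → ∧-fst {X v} q) t in-t) (∧-snd {all∈ (X ∩ adj G y) t} (∧-snd {Y y} p)))
          (∧-intro (∧-fst p) (allF-intro (λ u → ⇒-intro (λ _ → trans (sym G _ y) (∧-snd {X (lookup t u)} (allF-elim in-t u))))))
          where in-t = ∧-fst (∧-snd {Y y} p)
    -- Both demands in one inequality: averaged over `Y`, the left side is at most 2xP and the right
    -- side at least 2xP. For a single `y` satisfying it, the term xP gives `α-big`, and α y ≤ x
    -- gives `π-small`.
    combined : ∑ (λ y → ι (Y y) * (x * P + x * Q * π y)) ≤ ∑ (λ y → ι (Y y) * (2 * s * P * α y))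
    combined = begin
      ∑ (λ y → ι (Y y) * (x * P + x * Q * π y)) ≡⟨ ∑-cong (λ y → l₁ (ι (Y y)) (x * P) (x * Q) (π y)) ∙ ∑-+ (λ y → x * P * ι (Y y)) _ ∙ cong₂ _+_ (∑-* (x * P) (λ y → ι (Y y))) (∑-* (x * Q) (λ y → ι (Y y) * π y)) ⟩
      x * P * # Y + x * Q * B ≤⟨ ≤-by (+-mono-≤ (*-monoʳ-≤ x B-small) (*-monoʳ-≤ (2 * P) A-big)) 0 (l₂ x P (# Y) Q B s A) ⟩
      2 * s * P * A ≡⟨ ≡-sym (∑-* (2 * s * P) (λ y → ι (Y y) * α y)) ∙ ∑-cong (λ y → l₃ (2 * s * P) (ι (Y y)) (α y)) ⟩
      ∑ (λ y → ι (Y y) * (2 * s * P * α y)) ∎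
      where
      open ≤-Reasoning
      l₁ : ∀ o a b p → o * (a + b * p) ≡ a * o + b * (o * p)
      l₁ = solve-∀
      l₂ : ∀ x p y q b s a → x * p * y + x * q * b + (x * (p * y) + 2 * p * (s * a)) + 0 ≡ 2 * s * p * a + (x * (q * b) + 2 * p * (x * y))
      l₂ = solve-∀
      l₃ = *-swap
    found = ∑-<⇒∃∈ {P = Y} {f = λ y → x * P + x * Q * π y} {g = λ y → 2 * s * P * α y} Y>0 combined
    y = proj₁ found
    ineq : x * P + x * Q * π y ≤ 2 * s * P * α y
    ineq = proj₂ (proj₂ found)
    α-big : x ≤ 2 * s * α y
    α-big = ≤-cancel P P>0 (≡≤ (*-comm P x) (≤-trans (m≤m+n _ _) (≤-trans ineq (≤-reflexive (l s P (α y))))))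
      where l : ∀ s p a → 2 * s * p * a ≡ p * (2 * s * a)
            l = solve-∀
    π-small : suc T * π y ≤ P
    π-small = ≤-cancel (x * (2 * s)) (*-pos X>0 (*-pos {2} (s≤s z≤n) s>0)) (begin
      x * (2 * s) * (suc T * π y) ≡⟨ l x (2 * s) (suc T) (π y) ⟩
      x * Q * π y ≤⟨ m≤n+m _ (x * P) ⟩
      x * P + x * Q * π y ≤⟨ ineq ⟩
      2 * s * P * α y ≤⟨ *-monoʳ-≤ (2 * s * P) (#-mono {P = X ∩ adj G y} (λ v p → ∧-fst p)) ⟩
      2 * s * P * x ≡⟨ l′ (2 * s) P x ⟩
      x * (2 * s) * P ∎)
      where
      open ≤-Reasoning
      l : ∀ a b c d → a * b * (c * d) ≡ a * (b * c) * d
      l = solve-∀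
      l′ : ∀ a b c → a * b * c ≡ c * a * b
      l′ = solve-∀

  2s>0 : 0 < 2 * s
  2s>0 = *-pos {2} (s≤s z≤n) s>0

  NoPoor : ℕ → VSet n → Set
  NoPoor k X = Σ (VSet n) λ X′ → X′ ⊆ X × #poor X′ ≡ 0 × # X ≤ (2 * s) ^ k * # X′

  -- Each round divides the number of poor tuples by at least T + 1, and an integer below 1 is zero.
  -- If no poor tuple is left earlier, the process stops.
  no-poor : ∀ k X → (∀ x → X x ≡ true → # Y ≤ s * # (Y ∩ adj G x)) → 0 < # X → #poor X < suc T ^ k → NoPoor k X
  no-poor zero X deg X>0 few = X , (λ _ p → p) , n<1⇒n≡0 few , ≤-reflexive (≡-sym (+-identityʳ (# X)))
  no-poor (suc k) X deg X>0 few = go (0 <? #poor X)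
    where
    next : ∃[ y ] # X ≤ 2 * s * # (X ∩ adj G y) × suc T * #poor (X ∩ adj G y) ≤ #poor X → NoPoor (suc k) X
    next (y , α-big , π-small) = extend (no-poor k (X ∩ adj G y) (λ x p → deg x (∧-fst p)) nonempty
        (*-cancelˡ-< (suc T) (#poor (X ∩ adj G y)) (suc T ^ k) (≤-<-trans π-small few)))
      where
      nonempty : 0 < # (X ∩ adj G y)
      nonempty = n≢0⇒n>0 (λ e → <⇒≱ X>0 (≤-trans α-big (≤-reflexive (cong (2 * s *_) e ∙ *-zeroʳ (2 * s)))))
      extend : NoPoor k (X ∩ adj G y) → NoPoor (suc k) X
      extend (X′ , X′⊆ , none , big) = X′ , (λ x p → ∧-fst (X′⊆ x p)) , none ,
        ≤-trans α-big (≤-trans (*-monoʳ-≤ (2 * s) big) (≤-reflexive (≡-sym (*-assoc (2 * s) ((2 * s) ^ k) (# X′)))))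
    go : Dec (0 < #poor X) → NoPoor (suc k) X
    go (no P≯0) = X , (λ _ p → p) , n≤0⇒n≡0 (≮⇒≥ P≯0) , ≡≤ (≡-sym (+-identityʳ (# X))) (*-monoˡ-≤ (# X) (^-pos 2s>0 (suc k)))
    go (yes P>0) = next (step X deg X>0 P>0)

  -- The bound `# X ≤ T` leaves at most T^h < (T + 1)^h tuples, so h rounds suffice.
  rich-subset : 0 < h → ∀ X → (∀ x → X x ≡ true → # Y ≤ s * # (Y ∩ adj G x)) → 0 < # X → # X ≤ T →
    Σ (VSet n) λ X′ → X′ ⊆ X × # X ≤ (2 * s) ^ h * # X′ × (∀ t → all∈ X′ t ≡ true → # Y ≤ Q * # (common t))
  rich-subset h>0 X deg X>0 X≤T = X′ , proj₁ (proj₂ r) , proj₂ (proj₂ (proj₂ r)) , rich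
    where
    few : #poor X < suc T ^ h
    few = ≤-<-trans (∑V-mono {k = h} (λ t → ι-mono {all∈ X t ∧ poor t} {all∈ X t} (λ p → ∧-fst p)))
      (≤-<-trans (≤-reflexive (#-tuples h X)) (≤-<-trans (^-monoˡ-≤ h X≤T) (^-monoˡ-< h {{>-nonZero h>0}} ≤-refl)))
    r = no-poor h X deg X>0 few
    X′ = proj₁ r
    rich : ∀ t → all∈ X′ t ≡ true → # Y ≤ Q * # (common t)
    rich t p = <ᵇ-false (≢true (λ q → 1+n≰n {0} (begin
      1 ≡⟨ ≡-sym (ι-true (∧-intro p q)) ⟩
      ι (all∈ X′ t ∧ poor t) ≤⟨ term≤∑V {k = h} (λ t → ι (all∈ X′ t ∧ poor t)) t ⟩
      #poor X′ ≡⟨ proj₁ (proj₂ (proj₂ r)) ⟩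
      0 ∎)))
      where open ≤-Reasoning

-- A set dense to many vertices yields an induced copy of the bipartite graph

InducedIn : ∀ {h n} → Graph h → Graph n → Set
InducedIn {h} {n} H G = Σ (Fin h → Fin n) λ φ → Injective _≡_ _≡_ φ × (∀ u v → adj G (φ u) (φ v) ≡ adj H u v)

module DenseSpot {n : ℕ} (G : Graph n) {r : ℕ} (H : Graph (suc r)) (bip : Bipartite H)
  {s β γ T : ℕ} (s>0 : 0 < s) (free : ¬ ContainsKss s G)
  (4s≤β : 4 * s ≤ β) (hs<β : suc r * s < β)
  (γ-sq : 2 * (16 * s * s) ≤ γ * γ) (hhs<γ : suc r * (suc r * s) < γ) (T-big : (2 * s) ^ suc r * ((2 * (8 * s)) ^ r * γ) ≤ T) where

  h : ℕ
  h = suc r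

  open Domination G

  dom : Dom (2 * s) (4 * s) s
  dom = Kss-free⇒Dom s free

  2s>0 : 0 < 2 * s
  2s>0 = *-pos {2} (s≤s z≤n) s>0

  Γ : Fin n → Fin n → Bool
  Γ x y = not (adj⁼ x y)

  -- All but s vertices of a set of size p ≥ 4s have at least p/2s non-neighbours in it, so p² ≤ 2sE
  -- + sp with sp ≤ p²/4. Smaller sets are covered by the additive term (4s)².
  nonadjacent-pairs : ∀ Z P → # P * # P ≤ 8 * s * Tuples.pairs Γ Z P + 16 * s * s
  nonadjacent-pairs Z P = go (4 * s ≤? p)
    where
    open Tuples Γ Z
    p = # P
    E = pairs P
    pairs-eq : E ≡ ∑ (λ y → ι (P y) * # (P ∖ y))
    pairs-eq = ∑-cong (λ y → ∑-cong (λ x → cong ι (∧-assoc′ (P y) (P x) (Γ y x)) ∙ ι-∧ (P y) _) ∙ ∑-* (ι (P y)) (λ x → ι ((P ∖ y) x)))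
      where
      opaque
        unfolding _∧_
        ∧-assoc′ : ∀ a b c → (a ∧ b) ∧ c ≡ a ∧ (b ∧ c)
        ∧-assoc′ true b c = refl
        ∧-assoc′ false b c = refl
    go : Dec (4 * s ≤ p) → p * p ≤ 8 * s * E + 16 * s * s
    go (no q) = ≤-trans (*-mono-≤ (<⇒≤ (≰⇒> q)) (<⇒≤ (≰⇒> q))) (≡≤ (l s) (m≤n+m _ _))
      where l : ∀ s → 4 * s * (4 * s) ≡ 16 * s * s
            l = solve-∀
    go (yes q) = ≤-by (+-mono-≤ main (+-mono-≤ main (+-mono-≤ main (+-mono-≤ main (*-monoʳ-≤ p q))))) (2 * p * p + 16 * s * s) (l p s E)
      where
      D = Dominating (2 * s) P
      pointwise : ∀ y → ι (P y) * p ≤ 2 * s * (ι (P y) * # (P ∖ y)) + ι (D y) * p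
      pointwise y = split (bool (D y))
        where
        split : _ → _
        split (inj₁ d) = ≤-trans (ι*≤ (P y) p) (≡≤ (≡-sym (cong (_* p) (ι-true d) ∙ +-identityʳ p)) (m≤n+m _ _))
        split (inj₂ d) = ≤-trans (*-monoʳ-≤ (ι (P y)) (<ᵇ-false d)) (≡≤ (l′ (ι (P y)) (2 * s) _) (m≤m+n _ _))
          where l′ = *-swap
      main : p * p ≤ 2 * s * E + s * p
      main = begin
        p * p ≡⟨ ≡-sym (∑-ι*const P p) ⟩
        ∑ (λ y → ι (P y) * p) ≤⟨ ∑-mono pointwise ⟩
        ∑ (λ y → 2 * s * (ι (P y) * # (P ∖ y)) + ι (D y) * p) ≡⟨ ∑-+ (λ y → 2 * s * (ι (P y) * # (P ∖ y))) _ ∙ cong₂ _+_ (∑-* (2 * s) (λ y → ι (P y) * # (P ∖ y)) ∙ cong (2 * s *_) (≡-sym pairs-eq)) (∑-ι*const D p) ⟩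
        2 * s * E + # D * p ≤⟨ +-monoʳ-≤ (2 * s * E) (*-monoˡ-≤ p (dom P q)) ⟩
        2 * s * E + s * p ∎
        where open ≤-Reasoning
      l : ∀ p s e → p * p + (2 * s * e + s * p + (2 * s * e + s * p + (2 * s * e + s * p + (2 * s * e + s * p + p * p)))) + (2 * p * p + 16 * s * s) ≡
                    8 * s * e + 16 * s * s + (p * p + (p * p + (p * p + (p * p + p * (4 * s)))))
      l = solve-∀

  module _ (Z : VSet n) where
    open Tuples Γ Z using (Ω; Ω-mem; Ω-related)

    -- Each vertex `v` of `H` has two candidates, entry `v` of the tuple and `z v`; its colour
    -- selects one. Inside a colour class only independence is needed, and across the classes the
    -- patterns of `z` give the adjacencies of `H`.
    embedding⇒induced : ∀ t → Ω {k = h} t ≡ true → (z : Fin h → Fin n) →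
      (∀ u v → u ≢ v → adj⁼ (z u) (z v) ≡ false) →
      (∀ v u → adj H u v ≡ true → adj G (lookup t u) (z v) ≡ true) →
      (∀ v u → adj H u v ≡ false → adj⁼ (lookup t u) (z v) ≡ false) → InducedIn H G
    embedding⇒induced t Ωt z z-indep tz-adj tz-non = φ , φ-inj , φ-adj
      where
      t-indep : ∀ u v → u ≢ v → adj⁼ (lookup t u) (lookup t v) ≡ false
      t-indep u v p = not-elim (Ω-related (λ x y q → not-intro (adj⁼-sym (not-elim q))) t Ωt u v p)
      col = proj₁ bip
      place : Fin h → Bool → Fin n
      place v true = lookup t v
      place v false = z v
      φ : Fin h → Fin n
      φ v = place v (col v)
      Faithful : Fin h → Fin h → Fin n → Fin n → Set
      Faithful u v a b = a ≢ b × adj G a b ≡ adj H u v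
      faithful : ∀ u v → u ≢ v → ∀ a b → a ≡ col u → b ≡ col v → Faithful u v (place u a) (place v b)
      from-non : ∀ {u v a b} → adj⁼ a b ≡ false → adj H u v ≡ false → Faithful u v a b
      from-non p q = proj₂ (adj⁼-false p) , trans (proj₁ (adj⁼-false p)) (≡-sym q)
      same-col : ∀ {u v c} → c ≡ col u → c ≡ col v → adj H u v ≡ false
      same-col p q = ≢true (λ a → proj₂ bip _ _ a (trans (≡-sym p) q))
      cross : ∀ u v → Faithful u v (lookup t u) (z v)
      cross u v with bool (adj H u v)
      ... | inj₁ e = (λ q → true≢false (subst (λ w → adj G (lookup t u) w ≡ true) (≡-sym q) (tz-adj v u e)) (irrefl G _)) , trans (tz-adj v u e) (≡-sym e)
      ... | inj₂ e = from-non (tz-non v u e) e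
      faithful u v p true true cu cv = from-non (t-indep u v p) (same-col cu cv)
      faithful u v p false false cu cv = from-non (z-indep u v p) (same-col cu cv)
      faithful u v p true false cu cv = cross u v
      faithful u v p false true cu cv = (λ q → proj₁ (cross v u) (≡-sym q)) , trans (sym G _ _) (trans (proj₂ (cross v u)) (sym H v u))
      φ-inj : Injective _≡_ _≡_ φ
      φ-inj {u} {v} e with u ≟ v
      ... | yes q = q
      ... | no q = ⊥-elim (proj₁ (faithful u v q (col u) (col v) refl refl) e)
      φ-adj : ∀ u v → adj G (φ u) (φ v) ≡ adj H u v
      φ-adj u v with u ≟ v
      ... | yes refl = trans (irrefl G (φ u)) (≡-sym (irrefl H u))
      ... | no q = proj₂ (faithful u v q (col u) (col v) refl refl)

    rich⇒induced : ∀ Y → (∀ t → Ω {k = h} t ≡ true → ∀ j → (2 * s) ^ h * ((2 * s) ^ h * β) ≤ # (joined (λ u → adj H u j) t Y)) →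
      (2 * (8 * s)) ^ r * γ ≤ # Z → InducedIn H G
    rich⇒induced Y rich Z-big = finish pattern-embedding
      where
      open PatternEmbedding {r} {suc r} {2 * s} {4 * s} {s} {8 * s} {16 * s * s} {β} {γ} dom 2s>0 (*-pos {8} (s≤s z≤n) s>0) Γ Z (λ P _ → nonadjacent-pairs Z P) (λ j u → adj H u j) Y rich 4s≤β hs<β γ-sq hhs<γ Z-big using (pattern-embedding)
      finish : Embedding Γ Z (λ j u → adj H u j) Y → InducedIn H G
      finish (t , Ωt , z , _ , indep , yes-adj , non-adj) = embedding⇒induced t Ωt z indep yes-adj non-adj

  dense⇒induced : ∀ X Y → T ≤ # X → 2 * s * suc T * ((2 * s) ^ h * ((2 * s) ^ h * β)) ≤ # Y →
    (∀ x → X x ≡ true → # Y ≤ s * # (Y ∩ adj G x)) → InducedIn H G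
  -- `X₀` is cut down to exactly T vertices: dependent random choice tolerates no more, and after
  -- its loss of (2s)^h this many still leave enough for the tuples.
  dense⇒induced X₀ Y T≤X Y-big deg = trim (subset-of-size (# X₀ ∸ T) X₀ (≡-sym (m∸n+n≡m T≤X)))
    where
    β>0 : 0 < β
    β>0 = ≤-trans (*-pos {4} (s≤s z≤n) s>0) 4s≤β
    B : ℕ
    B = (2 * s) ^ h * ((2 * s) ^ h * β)
    Y>0 : 0 < # Y
    Y>0 = ≤-trans (*-pos (*-pos 2s>0 (s≤s z≤n)) (*-pos (^-pos 2s>0 h) (*-pos (^-pos 2s>0 h) β>0))) Y-big
    open DependentRandomChoice G h s T s>0 Y Y>0 using (rich-subset; common; Q)
    T>0 : 0 < T
    T>0 = ≤-trans (*-pos (^-pos 2s>0 h) (*-pos (^-pos (*-pos {2} (s≤s z≤n) (*-pos {8} (s≤s z≤n) s>0)) r) (≤-<-trans z≤n hhs<γ))) T-big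
    restrict : ∀ X → # X ≡ T → (Σ (VSet n) λ Z → Z ⊆ X × # X ≤ (2 * s) ^ h * # Z × (∀ t → all∈ Z t ≡ true → # Y ≤ Q * # (common t))) → InducedIn H G
    restrict X #X (Z , _ , X≤Z , common-big) = rich⇒induced Z Y rich
      (≤-cancel ((2 * s) ^ h) (^-pos 2s>0 h) (≤-trans T-big (≡≤ (≡-sym #X) X≤Z)))
      where
      rich : ∀ t → Tuples.Ω Γ Z {k = h} t ≡ true → ∀ j → B ≤ # (joined (λ u → adj H u j) t Y)
      rich t Ωt j = ≤-trans (≤-cancel Q (*-pos 2s>0 (s≤s z≤n)) (≤-trans Y-big (common-big t (allF-intro (Tuples.Ω-mem Γ Z t Ωt)))))
        (#-mono {P = common t} {Q = joined (λ u → adj H u j) t Y} (λ y p → ∧-intro (∧-fst p) (allF-intro (λ u → ⇒-intro (λ _ → ⇒-elim (allF-elim (∧-snd {Y y} p) u) refl)))))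
    trim : (Σ (VSet n) λ X → X ⊆ X₀ × # X ≡ T) → InducedIn H G
    trim (X , X⊆ , #X) = restrict X #X (rich-subset (s≤s z≤n) X (λ x p → deg x (X⊆ x p)) (≤-trans T>0 (≤-reflexive (≡-sym #X))) (≤-reflexive #X))

-- Orientations of bounded indegree

module Degeneracy {n : ℕ} (G : Graph n) where

  open DegreeSums G

  Orientation : VSet n → ℕ → (Fin n → Fin n → Bool) → Set
  Orientation U b o = (∀ u v → o u v ≡ true → Adj G u v) ×
    (∀ u v → U u ≡ true → U v ≡ true → Adj G u v → o u v ≡ true ⊎ o v u ≡ true) × (∀ v → # (λ u → o u v) ≤ b)

  Sparse : ℕ → VSet n → Set
  Sparse d U = ∀ U′ → U′ ⊆ U → 0 < # U′ → D U′ < 2 * d * # U′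

  -- Degrees inside `U` average less than 2d, so some vertex has degree less than 2d. Its edges are
  -- directed towards it, and the rest is oriented by induction.
  orient : ∀ d r U → # U ≤ r → Sparse d U → ∃[ o ] Orientation U (2 * d) o
  orient d r U U≤r sparse = go r U≤r (0 <? # U)
    where
    go : ∀ r → # U ≤ r → Dec (0 < # U) → ∃[ o ] Orientation U (2 * d) o
    go r _ (no q) = (λ _ _ → false) , (λ _ _ ()) , (λ u v Uu _ _ → ⊥-elim (q (∃⇒#-pos u Uu))) ,
      (λ v → ≡≤ (∑-zero {f = λ u → ι false} (λ u → ι-false refl)) z≤n)
    go zero U≤0 (yes p) = ⊥-elim (<⇒≱ p U≤0)
    go (suc r) U≤r (yes U>0) = pick (any? (λ v → (U v Data.Bool.≟ true) ×-dec (deg U v <? 2 * d)))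
      where
      extend : ∀ v → U v ≡ true → deg U v < 2 * d → (∃[ o ] Orientation (U - v) (2 * d) o) → ∃[ o ] Orientation U (2 * d) o
      extend v Uv small (o , o-adj , o-covers , indeg) = o′ , adj′ , covers′ , indeg′
        where
        o′ : Fin n → Fin n → Bool
        o′ u w = (w == v ∧ (U u ∧ adj G v u)) ∨ (not (w == v) ∧ o u w)
        adj′ : ∀ u w → o′ u w ≡ true → Adj G u w
        adj′ u w p = [ (λ q → subst (λ x → Adj G u x) (≡-sym (==-elim (∧-fst q))) (trans (sym G u v) (∧-snd {U u} (∧-snd {w == v} q)))) ,
          (λ q → o-adj u w (∧-snd {not (w == v)} q)) ]′ (∨-elim p)
        covers′ : ∀ u w → U u ≡ true → U w ≡ true → Adj G u w → o′ u w ≡ true ⊎ o′ w u ≡ true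
        covers′ u w Uu Uw uw = split (u ≟ v) (w ≟ v)
          where
          split : Dec (u ≡ v) → Dec (w ≡ v) → o′ u w ≡ true ⊎ o′ w u ≡ true
          split _ (yes refl) = inj₁ (∨-introˡ (∧-intro (==-refl v) (∧-intro Uu (trans (sym G v u) uw))))
          split (yes refl) (no _) = inj₂ (∨-introˡ (∧-intro (==-refl v) (∧-intro Uw uw)))
          split (no u≢v) (no w≢v) = [ (λ p → inj₁ (∨-introʳ {w == v ∧ (U u ∧ adj G v u)} (∧-intro (not-intro (≢-== w≢v)) p))) ,
            (λ p → inj₂ (∨-introʳ {u == v ∧ (U w ∧ adj G v w)} (∧-intro (not-intro (≢-== u≢v)) p))) ]′ (o-covers u w (-∋ U Uu u≢v) (-∋ U Uw w≢v) uw)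
        indeg′ : ∀ w → # (λ u → o′ u w) ≤ 2 * d
        indeg′ w with w ≟ v
        ... | yes refl = ≤-trans (#-mono {P = λ u → o′ u w} {Q = U ∩ adj G v} (λ u p → [ (λ q → ∧-snd {w == v} q) , (λ q → true≢false (==-refl w) (not-elim (∧-fst q))) ]′ (∨-elim p))) (<⇒≤ small)
        ... | no w≢v = ≤-trans (#-mono {P = λ u → o′ u w} {Q = λ u → o u w} (λ u p → [ (λ q → ⊥-elim (w≢v (==-elim (∧-fst q)))) , (λ q → ∧-snd {not (w == v)} q) ]′ (∨-elim p))) (indeg w)
      pick : Dec (∃[ v ] U v ≡ true × deg U v < 2 * d) → ∃[ o ] Orientation U (2 * d) o
      pick (yes (v , Uv , small)) = extend v Uv small (orient d r (U - v) (≤-pred (≡≤ (≡-sym (#-remove U v Uv)) U≤r)) (λ U′ s → sparse U′ (λ x p → -⊆ U v x (s x p))))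
      pick (no q) = ⊥-elim (<⇒≱ (sparse U (λ _ p → p) U>0) (D-≥ U (2 * d) (λ x p → ≮⇒≥ (λ lt → q (x , p , lt)))))

  module Minimal (d : ℕ) (d>0 : 0 < d) (W : VSet n) (W>0 : 0 < # W) (dense : 2 * d * # W ≤ D W)
    (minimal : ∀ U → U ⊆ W → # U < # W → 0 < # U → D U < 2 * d * # U) where

    remove-< : ∀ v → W v ≡ true → # (W - v) < # W
    remove-< v Wv = ≤-reflexive (≡-sym (#-remove W v Wv))

    -- Deleting a vertex of degree below d would cost less than 2d in the degree sum, against
    -- minimality.
    min-degree : ∀ v → W v ≡ true → d ≤ deg W v
    min-degree v Wv = go (0 <? # (W - v))
      where
      eq : 2 * d * suc (# (W - v)) ≤ D (W - v) + 2 * deg W v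
      eq = ≡≤ (cong (2 * d *_) (≡-sym (#-remove W v Wv))) (≤-trans dense (≤-reflexive (D-remove W v Wv)))
      bound : D (W - v) ≤ 2 * d * # (W - v) → d ≤ deg W v
      bound p = ≤-cancel 2 (s≤s z≤n) (≤-by (+-mono-≤ eq p) 0 (l d (# (W - v)) (D (W - v)) (deg W v)))
        where l : ∀ d w e g → 2 * d + (e + 2 * g + 2 * d * w) + 0 ≡ 2 * g + (2 * d * suc w + e)
              l = solve-∀
      go : Dec (0 < # (W - v)) → d ≤ deg W v
      go (yes p) = bound (<⇒≤ (minimal (W - v) (-⊆ W v) (remove-< v Wv) p))
      go (no p) = bound (≤-trans (D-≤ (W - v)) (≡≤ (cong (_* # (W - v)) (n≤0⇒n≡0 (≮⇒≥ p))) z≤n))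

    -- Minimality makes only the smaller subsets of `W` sparse. So one vertex is set aside and its
    -- edges are directed away from it, which adds at most 1 ≤ d to each indegree: 3d instead of 2d.
    orientation : ∃[ o ] Orientation W (3 * d) o
    orientation = at (#-pos⇒∃ W>0)
      where
      at : (∃[ v ] W v ≡ true) → ∃[ o ] Orientation W (3 * d) o
      at (v , Wv) = extend (orient d (# (W - v)) (W - v) ≤-refl (λ U s → minimal U (λ x p → -⊆ W v x (s x p)) (≤-<-trans (#-mono s) (remove-< v Wv))))
        where
        extend : (∃[ o ] Orientation (W - v) (2 * d) o) → ∃[ o ] Orientation W (3 * d) o
        extend (o , o-adj , o-covers , indeg) = o′ , adj′ , covers′ , indeg′
          where
          o′ : Fin n → Fin n → Bool
          o′ u w = (u == v ∧ (W w ∧ adj G v w)) ∨ o u w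
          adj′ : ∀ u w → o′ u w ≡ true → Adj G u w
          adj′ u w p = [ (λ q → subst (λ x → Adj G x w) (≡-sym (==-elim (∧-fst q))) (∧-snd {W w} (∧-snd {u == v} q))) , o-adj u w ]′ (∨-elim p)
          covers′ : ∀ u w → W u ≡ true → W w ≡ true → Adj G u w → o′ u w ≡ true ⊎ o′ w u ≡ true
          covers′ u w Wu Ww uw = split (u ≟ v) (w ≟ v)
            where
            split : Dec (u ≡ v) → Dec (w ≡ v) → o′ u w ≡ true ⊎ o′ w u ≡ true
            split (yes refl) _ = inj₁ (∨-introˡ (∧-intro (==-refl v) (∧-intro Ww uw)))
            split (no _) (yes refl) = inj₂ (∨-introˡ (∧-intro (==-refl v) (∧-intro Wu (trans (sym G v u) uw))))
            split (no u≢v) (no w≢v) = [ (λ p → inj₁ (∨-introʳ {u == v ∧ (W w ∧ adj G v w)} p)) , (λ p → inj₂ (∨-introʳ {w == v ∧ (W u ∧ adj G v u)} p)) ]′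
              (o-covers u w (-∋ W Wu u≢v) (-∋ W Ww w≢v) uw)
          indeg′ : ∀ w → # (λ u → o′ u w) ≤ 3 * d
          indeg′ w = ≤-trans (#-cover {P = λ u → o′ u w} {Q = _== v} {R = λ u → o u w} (λ u p → [ (λ q → inj₁ (∧-fst q)) , inj₂ ]′ (∨-elim p)))
            (≤-trans (+-mono-≤ (≡≤ (#-singleton v) d>0) (indeg w)) (≤-reflexive (l d)))
            where l : ∀ d → d + 2 * d ≡ 3 * d
                  l = solve-∀

    D-upper : ∀ o b → Orientation W b o → D W ≤ 2 * b * # W
    D-upper o b (_ , o-covers , indeg) = begin
      D W ≡⟨ ∑-cong (λ x → ≡-sym (∑-* (ι (W x)) (λ y → ι ((W ∩ adj G x) y)))) ⟩
      ∑ (λ x → ∑ (λ y → ι (W x) * ι ((W ∩ adj G x) y))) ≤⟨ ∑-mono (λ x → ∑-mono (pointwise x)) ⟩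
      ∑ (λ x → ∑ (λ y → ι (W y) * ι (o x y) + ι (W x) * ι (o y x))) ≡⟨ ∑-cong (λ x → ∑-+ (λ y → ι (W y) * ι (o x y)) _) ∙ ∑-+ (λ x → ∑ (λ y → ι (W y) * ι (o x y))) _ ⟩
      ∑ (λ x → ∑ (λ y → ι (W y) * ι (o x y))) + ∑ (λ x → ∑ (λ y → ι (W x) * ι (o y x))) ≡⟨ cong (_+ S) (∑-swap (λ x y → ι (W y) * ι (o x y))) ⟩
      S + S ≤⟨ +-mono-≤ S≤ S≤ ⟩
      # W * b + # W * b ≡⟨ l (# W) b ⟩
      2 * b * # W ∎
      where
      open ≤-Reasoning
      S = ∑ (λ x → ∑ (λ y → ι (W x) * ι (o y x)))
      S≤ : S ≤ # W * b
      S≤ = ≤-trans (∑-mono (λ x → ≡≤ (∑-* (ι (W x)) (λ y → ι (o y x))) (*-monoʳ-≤ (ι (W x)) (indeg x)))) (≤-reflexive (∑-ι*const W b))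
      l : ∀ w b → w * b + w * b ≡ 2 * b * w
      l = solve-∀
      pointwise : ∀ x y → ι (W x) * ι ((W ∩ adj G x) y) ≤ ι (W y) * ι (o x y) + ι (W x) * ι (o y x)
      pointwise x y = go (bool (W x ∧ (W ∩ adj G x) y))
        where
        go : _ → ι (W x) * ι ((W ∩ adj G x) y) ≤ ι (W y) * ι (o x y) + ι (W x) * ι (o y x)
        go (inj₂ e) = ≡≤ (≡-sym (ι-∧ (W x) _) ∙ ι-false e) z≤n
        go (inj₁ e) = ≤-trans (≡≤ (≡-sym (ι-∧ (W x) _)) (ι≤1 _)) (side (o-covers x y Wx Wy (∧-snd {W y} Wxy)))
          where
          Wx = ∧-fst e
          Wxy = ∧-snd {W x} e
          Wy = ∧-fst Wxy
          side : o x y ≡ true ⊎ o y x ≡ true → 1 ≤ ι (W y) * ι (o x y) + ι (W x) * ι (o y x)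
          side (inj₁ p) = ≡≤ (≡-sym (cong₂ _*_ (ι-true Wy) (ι-true p))) (m≤m+n _ _)
          side (inj₂ p) = ≡≤ (≡-sym (cong₂ _*_ (ι-true Wx) (ι-true p))) (m≤n+m _ _)

    low : VSet n
    low v = W v ∧ (deg W v <ᵇ suc (12 * d))

    low-degree : ∀ v → low v ≡ true → deg W v ≤ 12 * d
    low-degree v p = ≤-pred (<ᵇ-elim (∧-snd {W v} p))

    -- Indegrees of at most 3d give average degree at most 6d, and at most half of the vertices
    -- exceed twice this.
    half-low : ∀ o → Orientation W (3 * d) o → # W ≤ 2 * # low
    half-low o ori = ≤-by (+-mono-≤ cover (+-mono-≤ cover few)) 0 (l (# W) (# low) (# high))
      where
      l : ∀ w a z → w + (a + z + (a + z + w)) + 0 ≡ 2 * a + (w + (w + 2 * z))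
      l = solve-∀
      high : VSet n
      high v = W v ∧ not (deg W v <ᵇ suc (12 * d))
      cover : # W ≤ # low + # high
      cover = #-cover {P = W} {Q = low} {R = high} (λ x p → [ (λ q → inj₁ (∧-intro p q)) , (λ q → inj₂ (∧-intro p (not-intro q))) ]′ (bool (deg W x <ᵇ suc (12 * d))))
      few : 2 * # high ≤ # W
      few = ≤-cancel (6 * d) (*-pos {6} (s≤s z≤n) d>0) (begin
        6 * d * (2 * # high) ≡⟨ l₁ d (# high) ⟩
        # high * (12 * d) ≡⟨ ≡-sym (∑-ι*const high (12 * d)) ⟩
        ∑ (λ v → ι (high v) * (12 * d)) ≤⟨ ∑-mono (λ v → ≤-trans (ι*-mono {high v} (λ p → ≤-trans (n≤1+n _) (<ᵇ-false (not-elim (∧-snd {W v} p))))) (*-monoˡ-≤ (deg W v) (ι-mono {high v} {W v} (λ p → ∧-fst p)))) ⟩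
        D W ≤⟨ D-upper o (3 * d) ori ⟩
        2 * (3 * d) * # W ≡⟨ l₂ d (# W) ⟩
        6 * d * # W ∎)
        where
        open ≤-Reasoning
        l₁ : ∀ d z → 6 * d * (2 * z) ≡ z * (12 * d)
        l₁ = solve-∀
        l₂ : ∀ d w → 2 * (3 * d) * w ≡ 6 * d * w
        l₂ = solve-∀

-- Neighbourhoods in the locally sparse case

module LocalCase {n r : ℕ} (G : Graph n) (H : Graph (suc r)) {s d γ T₁ T₂ t β : ℕ}
  (A W : VSet n) (A⊆W : A ⊆ W) (W-degree : ∀ v → W v ≡ true → d ≤ DegreeSums.deg G W v)
  (A-degree : ∀ v → A v ≡ true → DegreeSums.deg G W v ≤ 12 * d) (W≤2A : # W ≤ 2 * # A)
  (few-dense : ∀ Y → T₂ ≤ # Y → # (λ x → not (s * # (Y ∩ adj G x) <ᵇ # Y)) ≤ T₁)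
  (3≤s : 3 ≤ s) (2≤T₂ : 2 ≤ T₂) (T₂≤β : T₂ ≤ β) (mT₁<β : suc r * suc r * T₁ < β) (β≤t : 2 ^ suc r * (2 ^ (suc r * suc r) * β) ≤ t)
  (2t≤d : 2 * t ≤ d) (γ-small : 2 ^ r * γ ≤ d) (mhT₁<γ : suc r * suc r * (suc r * T₁) < γ)
  (γ-sq : 8 * (12 * d * (1 + 2 * T₁)) ≤ γ * γ) (s-big : 8 * (144 * d * d) ≤ s * (γ * γ)) where

  h h² : ℕ
  h = suc r
  h² = h * h

  open Domination G

  -- If `x` misses less than half of `Y` and has e neighbours there, then |Y| ≤ 2e + 1, with 1 for
  -- `x` itself. So |Y| ≤ 3e ≤ se, and `few-dense` applies.
  dom : Dom 2 T₂ T₁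
  dom Y T₂≤Y = ≤-trans (#-mono {P = Dominating 2 Y} {Q = λ x → not (s * # (Y ∩ adj G x) <ᵇ # Y)} sub) (few-dense Y T₂≤Y)
    where
    sub : Dominating 2 Y ⊆ (λ x → not (s * # (Y ∩ adj G x) <ᵇ # Y))
    sub x p = not-intro (≢true (λ q → <⇒≱ (<ᵇ-elim q) many))
      where
      e = # (Y ∩ adj G x)
      f = # (Y ∖ x)
      cover : # Y ≤ f + (e + 1)
      cover = ≤-trans (#-cover {P = Y} {Q = Y ∖ x} {R = λ y → Y y ∧ adj⁼ x y} (λ y p → [ (λ q → inj₂ (∧-intro p q)) , (λ q → inj₁ (∧-intro p (not-intro q))) ]′ (bool (adj⁼ x y))))
        (+-monoʳ-≤ f (≤-trans (#-cover {P = λ y → Y y ∧ adj⁼ x y} {Q = Y ∩ adj G x} {R = _== x} (λ y p → [ (λ q → inj₁ (∧-intro (∧-fst p) q)) , (λ q → inj₂ (subst (λ w → y == w ≡ true) (≡-sym (==-elim q)) (==-refl y))) ]′ (∨-elim (∧-snd {Y y} p))))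
          (+-monoʳ-≤ e (≤-reflexive (#-singleton x)))))
      Y≤ : # Y ≤ 2 * e + 1
      Y≤ = ≤-by (+-mono-≤ cover (+-mono-≤ cover (<ᵇ-elim p))) 0 (l (# Y) e f)
        where l : ∀ y e f → y + (f + (e + 1) + (f + (e + 1) + y)) + 0 ≡ 2 * e + 1 + (y + (y + suc (2 * f)))
              l = solve-∀
      1≤e : 1 ≤ e
      1≤e = n≢0⇒n>0 (λ z → <⇒≱ (≤-trans 2≤T₂ T₂≤Y) (≤-trans Y≤ (≤-reflexive (cong (λ w → 2 * w + 1) z))))
      many : # Y ≤ s * e
      many = ≤-trans Y≤ (≤-trans (+-monoʳ-≤ (2 * e) 1≤e) (≡≤ (l e) (*-monoˡ-≤ e 3≤s)))
        where l : ∀ e → 2 * e + e ≡ 3 * e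
              l = solve-∀

  codeg : Fin n → Fin n → ℕ
  codeg b b′ = # (λ x → A x ∧ (adj G x b ∧ adj G x b′))

  codeg-sym : ∀ b b′ → codeg b b′ ≡ codeg b′ b
  codeg-sym b b′ = #-cong (λ x → cong (A x ∧_) (bool-ext swap swap))
    where swap : ∀ {a c} → a ∧ c ≡ true → c ∧ a ≡ true
          swap {a} p = ∧-intro (∧-snd {a} p) (∧-fst p)

  Nb : Fin n → VSet n
  Nb a = W ∩ adj G a

  light : Fin n → VSet n
  light a b = s * # (Nb a ∩ adj G b) <ᵇ # (Nb a)

  typical : Fin n → VSet n
  typical a b = Nb a b ∧ light a b

  -- A possible edge bb′ of the auxiliary graph with middle vertex `a`. Few common neighbours give
  -- `a` a chance to be the only one sampled; typical ends have few neighbours among the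
  -- in-neighbours of `a`.
  P : Fin n → Fin n → Fin n → Bool
  P a b b′ = A a ∧ ((typical a b ∧ typical a b′) ∧ (not (adj⁼ b b′) ∧ (codeg b b′ <ᵇ t)))

  σ : Fin n → ℕ
  σ a = ∑ (λ b → ∑ (λ b′ → ι (P a b b′)))

  -- The opposite kind of pair: with at least `t` common neighbours there is room to choose a
  -- subdividing vertex.
  Γ : Fin n → Fin n → Bool
  Γ b b′ = not (adj⁼ b b′) ∧ not (codeg b b′ <ᵇ t)

  Γ-sym : ∀ x y → Γ x y ≡ true → Γ y x ≡ true
  Γ-sym x y p = ∧-intro (not-intro (adj⁼-sym (not-elim (∧-fst p))))
    (subst (λ z → not (z <ᵇ t) ≡ true) (codeg-sym x y) (∧-snd {not (adj⁼ x y)} p))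

  T₂≤d : T₂ ≤ d
  T₂≤d = ≤-trans T₂≤β (≤-trans (≤-trans (≡≤ (≡-sym (+-identityʳ β)) (*-monoˡ-≤ β (^-pos (s≤s z≤n) h²))) (≡≤ (≡-sym (+-identityʳ _)) (*-monoˡ-≤ (2 ^ h² * β) (^-pos (s≤s z≤n) h))))
    (≤-trans β≤t (≤-trans (m≤m+n t _) 2t≤d)))

  module AtVertex (a : Fin n) (Aa : A a ≡ true) where

    y e ν : ℕ
    y = # (Nb a)
    e = ∑ (λ b → ι (typical a b) * # (Nb a ∩ adj G b))
    ν = σ a + (y + (T₁ * y + (y * T₁ + e)))

    d≤y : d ≤ y
    d≤y = W-degree a (A⊆W a Aa)

    y≤12d : y ≤ 12 * d
    y≤12d = A-degree a Aa

    heavy : VSet n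
    heavy b = Nb a b ∧ not (light a b)

    #heavy : # heavy ≤ T₁
    #heavy = ≤-trans (#-mono {P = heavy} {Q = λ b → not (light a b)} (λ b p → ∧-snd {Nb a b} p)) (few-dense (Nb a) (≤-trans T₂≤d d≤y))

    se≤ : s * e ≤ y * y
    se≤ = ≡≤ (≡-sym (∑-* s (λ b → ι (typical a b) * # (Nb a ∩ adj G b))))
      (≤-trans (∑-mono (λ b → ≡≤ (l s (ι (typical a b)) _) (≤-trans (ι*-mono {typical a b} (λ p → <⇒≤ (<ᵇ-elim (∧-snd {Nb a b} p)))) (*-monoˡ-≤ y (ι-mono {typical a b} {Nb a b} (λ p → ∧-fst p)))))) (≤-reflexive (∑-ι*const (Nb a) y)))
      where l = *-swap

    open Tuples Γ (Nb a)

    -- A pair in `R` not related by `Γ` is counted by σ, or is equal, or has a heavy first or second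
    -- entry, or is an adjacent pair of typical vertices: these are f₁ to f₅ in this order.
    Ψ : ∀ R → R ⊆ Nb a → # R * # R ≤ 1 * pairs R + ν
    Ψ R R⊆ = begin
      # R * # R ≡⟨ ≡-sym (∑-ι*const R (# R)) ∙ ∑-cong (λ b → ≡-sym (∑-* (ι (R b)) (λ b′ → ι (R b′)))) ⟩
      ∑ (λ b → ∑ (λ b′ → ι (R b) * ι (R b′))) ≤⟨ ∑-mono (λ b → ∑-mono (pointwise b)) ⟩
      ∑ (λ b → ∑ (λ b′ → f₀ b b′ + (f₁ b b′ + (f₂ b b′ + (f₃ b b′ + (f₄ b b′ + f₅ b b′)))))) ≡⟨ ∑∑-+ f₀ _ ∙ cong (∑∑ f₀ +_) (∑∑-+ f₁ _ ∙ cong (∑∑ f₁ +_) (∑∑-+ f₂ _ ∙ cong (∑∑ f₂ +_) (∑∑-+ f₃ _ ∙ cong (∑∑ f₃ +_) (∑∑-+ f₄ f₅)))) ⟩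
      ∑∑ f₀ + (∑∑ f₁ + (∑∑ f₂ + (∑∑ f₃ + (∑∑ f₄ + ∑∑ f₅)))) ≤⟨ +-mono-≤ (≤-reflexive (≡-sym (+-identityʳ (pairs R)))) (+-monoʳ-≤ (σ a) (+-mono-≤ s₂ (+-mono-≤ s₃ (+-mono-≤ s₄ s₅)))) ⟩
      1 * pairs R + ν ∎
      where
      open ≤-Reasoning
      ∑∑ : (Fin n → Fin n → ℕ) → ℕ
      ∑∑ f = ∑ (λ b → ∑ (f b))
      ∑∑-+ : ∀ f g → ∑∑ (λ b b′ → f b b′ + g b b′) ≡ ∑∑ f + ∑∑ g
      ∑∑-+ f g = ∑-cong (λ b → ∑-+ (f b) (g b)) ∙ ∑-+ (λ b → ∑ (f b)) (λ b → ∑ (g b))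
      f₀ f₁ f₂ f₃ f₄ f₅ : Fin n → Fin n → ℕ
      f₀ b b′ = ι ((R b ∧ R b′) ∧ Γ b b′)
      f₁ b b′ = ι (P a b b′)
      f₂ b b′ = ι (Nb a b) * ι (b′ == b)
      f₃ b b′ = ι (heavy b) * ι (Nb a b′)
      f₄ b b′ = ι (Nb a b) * ι (heavy b′)
      f₅ b b′ = ι (typical a b) * ι ((Nb a ∩ adj G b) b′)
      product : ∀ f Q c → (∀ b → ∑ (λ b′ → f b b′) ≤ c) → ∑∑ (λ b b′ → ι (Q b) * f b b′) ≤ # Q * c
      product f Q c p = ≤-trans (∑-mono (λ b → ≡≤ (∑-* (ι (Q b)) (f b)) (*-monoʳ-≤ (ι (Q b)) (p b)))) (≤-reflexive (∑-ι*const Q c))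
      s₂ : ∑∑ f₂ ≤ y
      s₂ = ≤-trans (product (λ b b′ → ι (b′ == b)) (Nb a) 1 (λ b → ≤-reflexive (#-singleton b))) (≤-reflexive (*-identityʳ y))
      s₃ : ∑∑ f₃ ≤ T₁ * y
      s₃ = ≤-trans (product (λ _ b′ → ι (Nb a b′)) heavy y (λ b → ≤-refl)) (*-monoˡ-≤ y #heavy)
      s₄ : ∑∑ f₄ ≤ y * T₁
      s₄ = product (λ _ b′ → ι (heavy b′)) (Nb a) T₁ (λ b → #heavy)
      s₅ : ∑∑ f₅ ≤ e
      s₅ = ≤-reflexive (∑-cong (λ b → ∑-* (ι (typical a b)) (λ b′ → ι ((Nb a ∩ adj G b) b′))))
      later : ∀ x {z} → 1 ≤ z → 1 ≤ x + z
      later x p = ≤-trans p (m≤n+m _ x)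
      two : ∀ {p q} → p ≡ true → q ≡ true → 1 ≤ ι p * ι q
      two p q = ≤-reflexive (≡-sym (cong₂ _*_ (ι-true p) (ι-true q)))
      pointwise : ∀ b b′ → ι (R b) * ι (R b′) ≤ f₀ b b′ + (f₁ b b′ + (f₂ b b′ + (f₃ b b′ + (f₄ b b′ + f₅ b b′))))
      pointwise b b′ = go (bool (R b ∧ R b′))
        where
        go : _ → ι (R b) * ι (R b′) ≤ f₀ b b′ + (f₁ b b′ + (f₂ b b′ + (f₃ b b′ + (f₄ b b′ + f₅ b b′))))
        go (inj₂ z) = ≡≤ (≡-sym (ι-∧ (R b) _) ∙ ι-false z) z≤n
        go (inj₁ z) = ≤-trans (≡≤ (≡-sym (ι-∧ (R b) _)) (ι≤1 _)) (cases (bool (light a b)) (bool (light a b′)) (bool (adj⁼ b b′)) (bool (codeg b b′ <ᵇ t)))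
          where
          Nb-b = R⊆ b (∧-fst z)
          Nb-b′ = R⊆ b′ (∧-snd {R b} z)
          cases : _ → _ → _ → _ → 1 ≤ f₀ b b′ + (f₁ b b′ + (f₂ b b′ + (f₃ b b′ + (f₄ b b′ + f₅ b b′))))
          cases (inj₂ l) _ _ _ = later (f₀ b b′) (later (f₁ b b′) (later (f₂ b b′) (≤-trans (two (∧-intro Nb-b (not-intro l)) Nb-b′) (m≤m+n _ _))))
          cases (inj₁ l) (inj₂ l′) _ _ = later (f₀ b b′) (later (f₁ b b′) (later (f₂ b b′) (later (f₃ b b′) (≤-trans (two Nb-b (∧-intro Nb-b′ (not-intro l′))) (m≤m+n _ _)))))
          cases (inj₁ l) (inj₁ l′) (inj₁ q) _ = closed (∨-elim q)
            where
            closed : adj G b b′ ≡ true ⊎ b == b′ ≡ true → _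
            closed (inj₁ r) = later (f₀ b b′) (later (f₁ b b′) (later (f₂ b b′) (later (f₃ b b′) (later (f₄ b b′) (two (∧-intro Nb-b l) (∧-intro Nb-b′ r))))))
            closed (inj₂ r) = later (f₀ b b′) (later (f₁ b b′) (≤-trans (two Nb-b (subst (λ w → b′ == w ≡ true) (≡-sym (==-elim r)) (==-refl b′))) (m≤m+n _ _)))
          cases (inj₁ l) (inj₁ l′) (inj₂ q) (inj₁ c) = later (f₀ b b′) (≡≤ (≡-sym (ι-true (∧-intro Aa (∧-intro (∧-intro (∧-intro Nb-b l) (∧-intro Nb-b′ l′)) (∧-intro (not-intro q) c))))) (m≤m+n _ _))
          cases (inj₁ l) (inj₁ l′) (inj₂ q) (inj₂ c) = ≡≤ (≡-sym (ι-true (∧-intro z (∧-intro (not-intro q) (not-intro c))))) (m≤m+n _ _)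

    -- Three groups of exceptional pairs, namely σ, the terms linear in y, and e, contribute at most
    -- γ²/8 each.
    ν-small : 8 * σ a ≤ γ * γ → 2 * ν ≤ γ * γ
    ν-small σ-small = ≤-cancel 4 (s≤s z≤n) (≤-by (+-mono-≤ σ-small (+-mono-≤ middle-small e-small)) (γ * γ) (l (σ a) y T₁ e (γ * γ)))
      where
      l : ∀ σ y T e g → 4 * (2 * (σ + (y + (T * y + (y * T + e))))) + (g + (g + g)) + g ≡ 4 * g + (8 * σ + (8 * (y * (1 + 2 * T)) + 8 * e))
      l = solve-∀
      middle-small : 8 * (y * (1 + 2 * T₁)) ≤ γ * γ
      middle-small = ≤-trans (*-monoʳ-≤ 8 (*-monoˡ-≤ (1 + 2 * T₁) y≤12d)) γ-sq
      e-small : 8 * e ≤ γ * γ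
      e-small = ≤-cancel s (≤-trans (s≤s z≤n) 3≤s) (≡≤ (l₁ s e) (≤-trans (*-monoʳ-≤ 8 (≤-trans se≤ (≤-trans (*-mono-≤ y≤12d y≤12d) (≤-reflexive (l₂ d))))) s-big))
        where l₁ : ∀ s e → s * (8 * e) ≡ 8 * (s * e)
              l₁ = solve-∀
              l₂ : ∀ d → 12 * d * (12 * d) ≡ 144 * d * d
              l₂ = solve-∀

    -- The pattern of an edge consists of its two ends. A pair which is no edge of `H` gets the
    -- empty pattern, so that patterns are indexed by all pairs; for these `A` itself is the large
    -- joined set.
    S : Fin h² → Fin h → Bool
    S j k = adj H (proj₁ (remQuot {h} h j)) (proj₂ (remQuot {h} h j)) ∧ (k == proj₁ (remQuot {h} h j) ∨ k == proj₂ (remQuot {h} h j))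

    t≤A : t ≤ # A
    t≤A = ≤-cancel 2 (s≤s z≤n) (≤-trans 2t≤d (≤-trans d≤y (≤-trans (#-mono {P = Nb a} {Q = W} (λ x p → ∧-fst p)) W≤2A)))

    rich : ∀ τ → Ω {k = h} τ ≡ true → ∀ j → 2 ^ h * (2 ^ h² * β) ≤ # (joined (S j) τ A)
    rich τ Ωτ j = ≤-trans β≤t (go (bool (adj H u v)))
      where
      u = proj₁ (remQuot {h} h j)
      v = proj₂ (remQuot {h} h j)
      go : adj H u v ≡ true ⊎ adj H u v ≡ false → t ≤ # (joined (S j) τ A)
      go (inj₂ uv) = ≤-trans t≤A (#-mono {P = A} {Q = joined (S j) τ A} (λ x p → ∧-intro p (allF-intro (λ k → ⇒-intro (λ q → true≢false (∧-fst {adj H u v} q) uv)))))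
      go (inj₁ uv) = ≤-trans (<ᵇ-false (not-elim (∧-snd {not (adj⁼ (lookup τ u) (lookup τ v))} rel))) (#-mono {P = λ x → A x ∧ (adj G x (lookup τ u) ∧ adj G x (lookup τ v))} {Q = joined (S j) τ A}
          (λ x p → ∧-intro (∧-fst p) (allF-intro (λ k → ⇒-intro (λ q → ends x p k (∨-elim (∧-snd {adj H u v} q)))))))
        where
        rel : Γ (lookup τ u) (lookup τ v) ≡ true
        rel = Ω-related Γ-sym τ Ωτ u v (λ e → true≢false uv (subst (λ w → adj H u w ≡ false) e (irrefl H u)))
        ends : ∀ x → A x ∧ (adj G x (lookup τ u) ∧ adj G x (lookup τ v)) ≡ true → ∀ k → k == u ≡ true ⊎ k == v ≡ true → adj G (lookup τ k) x ≡ true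
        ends x p k (inj₁ q) = subst (λ w → adj G (lookup τ w) x ≡ true) (≡-sym (==-elim q)) (trans (sym G _ x) (∧-fst (∧-snd {A x} p)))
        ends x p k (inj₂ q) = subst (λ w → adj G (lookup τ w) x ≡ true) (≡-sym (==-elim q)) (trans (sym G _ x) (∧-snd {adj G x (lookup τ u)} (∧-snd {A x} p)))

    assemble : ∀ τ → Ω {k = h} τ ≡ true → (z : Fin h² → Fin n) → (∀ i j → i ≢ j → adj⁼ (z i) (z j) ≡ false) →
      (∀ j u → S j u ≡ true → adj G (lookup τ u) (z j) ≡ true) →
      (∀ j u → S j u ≡ false → adj⁼ (lookup τ u) (z j) ≡ false) → ContainsInducedSubdivision H G
    assemble τ Ωτ z z-indep tz-adj tz-non = Assemble.contains G H (lookup τ) τ-inj ℓ (λ _ _ _ → [] ∷ []) avoid disjoint sound complete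
      where
      ℓ : Fin h → Fin h → List (Fin n)
      ℓ u v = z (combine u v) ∷ []
      τ-indep : ∀ u v → u ≢ v → adj⁼ (lookup τ u) (lookup τ v) ≡ false
      τ-indep u v p = not-elim (∧-fst (Ω-related Γ-sym τ Ωτ u v p))
      τ-inj : Injective _≡_ _≡_ (lookup τ)
      τ-inj {u} {v} q with u ≟ v
      ... | yes p = p
      ... | no p = ⊥-elim (proj₂ (adj⁼-false (τ-indep u v p)) q)
      z-inj : ∀ i j → z i ≡ z j → i ≡ j
      z-inj i j q with i ≟ j
      ... | yes p = p
      ... | no p = ⊥-elim (proj₂ (adj⁼-false (z-indep i j p)) q)
      S-combine : ∀ u v k → S (combine u v) k ≡ adj H u v ∧ (k == u ∨ k == v)
      S-combine u v k = cong (λ p → adj H (proj₁ p) (proj₂ p) ∧ (k == proj₁ p ∨ k == proj₂ p)) (remQuot-combine u v)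
      avoid : ∀ u v → Edge H u v → ∀ w → lookup τ w ∉ ℓ u v
      avoid u v _ w (here q) = [ (λ p → true≢false (subst (λ x → adj G x (z (combine u v)) ≡ true) q (tz-adj (combine u v) w p)) (irrefl G _)) ,
        (λ p → proj₂ (adj⁼-false (tz-non (combine u v) w p)) q) ]′ (bool (S (combine u v) w))
      disjoint : ∀ u v u′ v′ → Edge H u v → Edge H u′ v′ → ∀ x → x ∈ ℓ u v → x ∈ ℓ u′ v′ → u ≡ u′ × v ≡ v′
      disjoint u v u′ v′ _ _ x (here p) (here q) = combine-injective u v u′ v′ (z-inj _ _ (trans (≡-sym p) q))
      left : ∀ u v → Edge H u v → adj G (lookup τ u) (z (combine u v)) ≡ true
      left u v e = tz-adj (combine u v) u (trans (S-combine u v u) (∧-intro (proj₂ e) (∨-introˡ (==-refl u))))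
      right : ∀ u v → Edge H u v → adj G (lookup τ v) (z (combine u v)) ≡ true
      right u v e = tz-adj (combine u v) v (trans (S-combine u v v) (∧-intro (proj₂ e) (∨-introʳ {v == u} (==-refl v))))
      sound : ∀ u v → Edge H u v → ∀ p q → Step (lookup τ u) (ℓ u v) (lookup τ v) p q → Adj G p q
      sound u v e _ _ here = left u v e
      sound u v e _ _ (there last) = trans (sym G _ _) (right u v e)
      Joined : Fin n → Fin n → Set
      Joined = Consecutive H (lookup τ) ℓ
      mixed : ∀ w u v → Edge H u v → Adj G (lookup τ w) (z (combine u v)) → Joined (lookup τ w) (z (combine u v))
      mixed w u v e a = go (bool (S (combine u v) w))
        where
        go : _ → Joined (lookup τ w) (z (combine u v))
        go (inj₂ q) = true≢false a (proj₁ (adj⁼-false (tz-non (combine u v) w q)))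
        go (inj₁ q) = [ (λ p → u , v , e , inj₁ (subst (λ x → Step (lookup τ u) (ℓ u v) (lookup τ v) (lookup τ x) (z (combine u v))) (≡-sym (==-elim p)) here)) ,
          (λ p → u , v , e , inj₂ (subst (λ x → Step (lookup τ u) (ℓ u v) (lookup τ v) (z (combine u v)) (lookup τ x)) (≡-sym (==-elim p)) (there last))) ]′
          (∨-elim (∧-snd {adj H u v} (trans (≡-sym (S-combine u v w)) q)))
      swap : ∀ {x y} → Joined x y → Joined y x
      swap (u , v , e , inj₁ p) = u , v , e , inj₂ p
      swap (u , v , e , inj₂ p) = u , v , e , inj₁ p
      complete : ∀ x y → Covered H (lookup τ) ℓ x → Covered H (lookup τ) ℓ y → Adj G x y → Joined x y
      complete x y (inj₁ (w , refl)) (inj₁ (w′ , refl)) a with w ≟ w′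
      ... | yes refl = true≢false a (irrefl G _)
      ... | no p = true≢false a (proj₁ (adj⁼-false (τ-indep w w′ p)))
      complete x y (inj₁ (w , refl)) (inj₂ (u , v , e , here refl)) a = mixed w u v e a
      complete x y (inj₂ (u , v , e , here refl)) (inj₁ (w , refl)) a = swap (mixed w u v e (trans (sym G _ _) a))
      complete x y (inj₂ (u , v , e , here refl)) (inj₂ (u′ , v′ , e′ , here refl)) a with combine u v ≟ combine u′ v′
      ... | yes p = true≢false a (subst (λ j → adj G (z (combine u v)) (z j) ≡ false) p (irrefl G _))
      ... | no p = true≢false a (proj₁ (adj⁼-false (z-indep _ _ p)))

    few-pairs⇒contains : 8 * σ a ≤ γ * γ → ContainsInducedSubdivision H G
    few-pairs⇒contains σ-small = finish pattern-embedding
      where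
      open PatternEmbedding {r} {h²} {2} {T₂} {T₁} {1} {ν} {β} {γ} dom (s≤s z≤n) (s≤s z≤n) Γ (Nb a) Ψ S A rich T₂≤β mT₁<β
        (ν-small σ-small) mhT₁<γ (≤-trans γ-small d≤y) using (pattern-embedding)
      finish : Embedding Γ (Nb a) S A → ContainsInducedSubdivision H G
      finish (τ , Ωτ , z , _ , indep , yes-adj , non-adj) = assemble τ Ωτ z indep yes-adj non-adj

  -- Without an induced subdivision every `a` in `A` has 8 σ a > γ², and `A` is at least half of
  -- `W`: 16 = 2 · 8.
  many-triples : ¬ ContainsInducedSubdivision H G → # W * (γ * γ) ≤ 16 * ∑₃ (λ a b b′ → ι (P a b b′))
  many-triples free = begin
    # W * (γ * γ) ≤⟨ *-monoˡ-≤ (γ * γ) W≤2A ⟩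
    2 * # A * (γ * γ) ≡⟨ *-assoc 2 (# A) (γ * γ) ∙ cong (2 *_) (≡-sym (∑-ι*const A (γ * γ))) ⟩
    2 * ∑ (λ a → ι (A a) * (γ * γ)) ≤⟨ *-monoʳ-≤ 2 (∑-mono (λ a → ≤-trans (ι*-mono {A a} (λ Aa → <⇒≤ (≰⇒> (λ p → free (AtVertex.few-pairs⇒contains a Aa p))))) (ι*≤ (A a) _))) ⟩
    2 * ∑ (λ a → 8 * σ a) ≡⟨ cong (2 *_) (∑-* 8 σ) ∙ ≡-sym (*-assoc 2 8 (∑ σ)) ⟩
    16 * ∑ σ ∎
    where open ≤-Reasoning

-- The locally sparse case assembled

induced⇒contains : ∀ {h n} (H : Graph h) (G : Graph n) → InducedIn H G → ContainsInducedSubdivision H G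
induced⇒contains {h} {n} H G (φ , φ-inj , φ-adj) = Assemble.contains G H φ φ-inj (λ _ _ → []) (λ _ _ _ → []) (λ _ _ _ _ ())
    (λ _ _ _ _ _ _ _ ()) sound complete
  where
  sound : ∀ u v → Edge H u v → ∀ p q → Step (φ u) [] (φ v) p q → Adj G p q
  sound u v e _ _ last = trans (φ-adj u v) (proj₂ e)
  complete : ∀ x y → Covered H φ (λ _ _ → []) x → Covered H φ (λ _ _ → []) y → Adj G x y → Consecutive H φ (λ _ _ → []) x y
  complete x y (inj₁ (w , refl)) (inj₁ (w′ , refl)) a with trans (≡-sym (φ-adj w w′)) a | <-cmp (toℕ w) (toℕ w′)
  ... | e | tri< p _ _ = w , w′ , (p , e) , inj₁ last
  ... | e | tri≈ _ p _ = true≢false (subst (λ v → adj H w v ≡ true) (≡-sym (toℕ-injective p)) e) (irrefl H w)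
  ... | e | tri> _ _ p = w′ , w , (p , trans (sym H w′ w) e) , inj₂ last

#-all : ∀ n → # {n} (λ _ → true) ≡ n
#-all n = ∑-cong (λ x → ι-true refl) ∙ ∑-const n 1 ∙ *-identityʳ n

colour-class : ∀ {N} (x₀ : Fin N) L → L < N → Σ (VSet N) λ α → (∀ x → α x ≡ true → x == x₀ ≡ true → ⊥) × # α ≡ L
colour-class {N} x₀ L L<N = go (subset-of-size (# others ∸ L) others (≡-sym (m∸n+n≡m L≤)))
  where
  others : VSet N
  others = (λ _ → true) - x₀
  L≤ : L ≤ # others
  L≤ = ≤-pred (≤-trans L<N (≤-reflexive (≡-sym (#-all N) ∙ #-remove (λ _ → true) x₀ refl)))
  go : (Σ (VSet N) λ Q → Q ⊆ others × # Q ≡ L) → _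
  go (Q , Q⊆ , #Q) = Q , (λ x p q → true≢false q (not-elim (∧-snd {true} (Q⊆ x p)))) , #Q

module SparseCase {n r : ℕ} (G : Graph n) (H : Graph (suc r)) (free : ¬ ContainsInducedSubdivision H G)
  {s d γ T₁ T₂ t β κ L K : ℕ}
  (few-dense : ∀ Y → T₂ ≤ # Y → # (λ x → not (s * # (Y ∩ adj G x) <ᵇ # Y)) ≤ T₁)
  (3≤s : 3 ≤ s) (2≤T₂ : 2 ≤ T₂) (T₂≤β : T₂ ≤ β) (mT₁<β : suc r * suc r * T₁ < β) (β≤t : 2 ^ suc r * (2 ^ (suc r * suc r) * β) ≤ t)
  (2t≤d : 2 * t ≤ d) (γ-small : 2 ^ r * γ ≤ d) (mhT₁<γ : suc r * suc r * (suc r * T₁) < γ)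
  (γ-sq : 8 * (12 * d * (1 + 2 * T₁)) ≤ γ * γ) (s-big : 8 * (144 * d * d) ≤ s * (γ * γ))
  (144≤κ : 144 ≤ κ) (tL : 8 * (t * L) ≤ κ * d) (sκ² : 8 * (288 * L) ≤ s * (κ * κ)) (κ³ : 8 * (432 * L) ≤ κ * κ * κ) (L<M : L < κ * d)
  (enough : 32 * (κ * d * (κ * d * K)) < γ * γ * L) (K-big : 2 ^ (suc r * suc r) * suc r ≤ K) where

  open Degeneracy G
  open DegreeSums G

  module AtMinimal (d>0 : 0 < d) (W : VSet n) (W>0 : 0 < # W) (dense : 2 * d * # W ≤ D W)
    (minimal : ∀ U → U ⊆ W → # U < # W → 0 < # U → D U < 2 * d * # U) where

    open Minimal d d>0 W W>0 dense minimal

    module Oriented (o : Fin n → Fin n → Bool) (ori : Orientation W (3 * d) o)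
      (x₀ : Fin (κ * d)) (α : VSet (κ * d)) (αβ : ∀ x → α x ≡ true → x == x₀ ≡ true → ⊥) (#α : # α ≡ L) where

      M : ℕ
      M = κ * d

      low⊆W : low ⊆ W
      low⊆W x p = ∧-fst p

      open LocalCase {n} {r} G H {s} {d} {γ} {T₁} {T₂} {t} {β} low W low⊆W min-degree low-degree (half-low o ori) few-dense
        3≤s 2≤T₂ T₂≤β mT₁<β β≤t 2t≤d γ-small mhT₁<γ γ-sq s-big using (P; codeg; codeg-sym; Nb; light; typical; many-triples)
      open Domination G using (adj⁼; adj⁼-false; adj⁼-sym)

      indeg : ∀ v → # (λ u → o u v) ≤ 3 * d
      indeg = proj₂ (proj₂ ori)

      o-adj : ∀ u v → o u v ≡ true → Adj G u v
      o-adj = proj₁ ori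

      module Parts {a b b′ : Fin n} (p : P a b b′ ≡ true) where
        Aa : low a ≡ true
        Aa = ∧-fst p
        rest : (typical a b ∧ typical a b′) ∧ (not (adj⁼ b b′) ∧ (codeg b b′ <ᵇ t)) ≡ true
        rest = ∧-snd {low a} p
        typ : typical a b ≡ true
        typ = ∧-fst (∧-fst rest)
        typ′ : typical a b′ ≡ true
        typ′ = ∧-snd {typical a b} (∧-fst rest)
        sep : adj⁼ b b′ ≡ false
        sep = not-elim (∧-fst (∧-snd {typical a b ∧ typical a b′} rest))
        cod : codeg b b′ < t
        cod = <ᵇ-elim (∧-snd {not (adj⁼ b b′)} (∧-snd {typical a b ∧ typical a b′} rest))
        nb : Nb a b ≡ true
        nb = ∧-fst typ

      P-W : ∀ {a b b′} → P a b b′ ≡ true → W b ≡ true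
      P-W p = ∧-fst (Parts.nb p)

      P-adj : ∀ {a b b′} → P a b b′ ≡ true → Adj G a b
      P-adj {a} {b} p = ∧-snd {W b} (Parts.nb p)

      P-sym : ∀ {a b b′} → P a b b′ ≡ true → P a b′ b ≡ true
      P-sym {a} {b} {b′} p = ∧-intro Aa (∧-intro (∧-intro typ′ typ) (∧-intro (not-intro (adj⁼-sym sep)) (<ᵇ-intro (≡≤ (cong suc (codeg-sym b′ b)) cod))))
        where open Parts p

      open Sample {n} {M} G W low o P (_== x₀) α x₀ L K
      open Expectation (#-singleton x₀) #α

      M>0 : 0 < M
      M>0 = ≤-trans (s≤s z≤n) (L<M)

      module Bounds {a b b′ : Fin n} (p : P a b b′ ≡ true) where
        open Parts p

        -- 12d neighbours of `a` and 3d in-neighbours of each end: 8 · 18 = 144.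
        bound₁ : 8 * # (conflict₁ a b b′) ≤ M
        bound₁ = ≤-trans (*-monoʳ-≤ 8 size) (≡≤ (l d) (*-monoˡ-≤ d 144≤κ))
          where
          l : ∀ d → 8 * (12 * d + (3 * d + 3 * d)) ≡ 144 * d
          l = solve-∀
          size : # (conflict₁ a b b′) ≤ 12 * d + (3 * d + 3 * d)
          size = ≤-trans (#-cover {P = conflict₁ a b b′} {Q = Nb a} {R = λ v → o v b ∨ o v b′} (λ v q → ∨-elim (∧-snd {fresh a b b′ v} q)))
            (+-mono-≤ (low-degree a Aa) (≤-trans (#-cover {P = λ v → o v b ∨ o v b′} {Q = λ v → o v b} {R = λ v → o v b′} (λ v q → ∨-elim q)) (+-mono-≤ (indeg b) (indeg b′))))

        bound₂ : 8 * (# (conflict₂ a b b′) * L) ≤ M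
        bound₂ = ≤-trans (*-monoʳ-≤ 8 (*-monoˡ-≤ L (≤-trans (#-mono {P = conflict₂ a b b′} {Q = λ x → low x ∧ (adj G x b ∧ adj G x b′)} (λ v q → ∧-snd {fresh a b b′ v} q)) (<⇒≤ cod)))) tL

        -- In-neighbours of `a` adjacent to an end lie in the neighbourhood of `a`, of which a
        -- typical end sees at most 12d/s vertices; each of them has at most 12d leaves.
        bound₃ : 8 * (∑ (λ x → # (conflict₃ a b b′ x)) * L) ≤ M * M
        bound₃ = ≤-cancel s (≤-trans (s≤s z≤n) 3≤s) (begin
          s * (8 * (∑ (λ x → # (conflict₃ a b b′ x)) * L)) ≤⟨ *-monoʳ-≤ s (*-monoʳ-≤ 8 (*-monoˡ-≤ L size)) ⟩
          s * (8 * (# X * (12 * d) * L)) ≡⟨ l₁ s (# X) (12 * d) L ⟩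
          8 * (s * # X * (12 * d) * L) ≤⟨ *-monoʳ-≤ 8 (*-monoˡ-≤ L (*-monoˡ-≤ (12 * d) X-small)) ⟩
          8 * ((12 * d + 12 * d) * (12 * d) * L) ≡⟨ l₂ d L ⟩
          8 * (288 * L) * (d * d) ≤⟨ *-monoˡ-≤ (d * d) sκ² ⟩
          s * (κ * κ) * (d * d) ≡⟨ l₃ s κ d ⟩
          s * (M * M) ∎)
          where
          open ≤-Reasoning
          l₁ : ∀ s x e l → s * (8 * (x * e * l)) ≡ 8 * (s * x * e * l)
          l₁ = solve-∀
          l₂ : ∀ d l → 8 * ((12 * d + 12 * d) * (12 * d) * l) ≡ 8 * (288 * l) * (d * d)
          l₂ = solve-∀
          l₃ : ∀ s k d → s * (k * k) * (d * d) ≡ s * (k * d * (k * d))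
          l₃ = solve-∀
          X : VSet n
          X x = low x ∧ (o x a ∧ (adj G x b ∨ adj G x b′))
          X-small : s * # X ≤ 12 * d + 12 * d
          X-small = ≤-trans (*-monoʳ-≤ s (#-cover {P = X} {Q = Nb a ∩ adj G b} {R = Nb a ∩ adj G b′} cov))
            (≡≤ (*-distribˡ-+ s _ _) (+-mono-≤ (near (∧-snd {Nb a b} typ)) (near (∧-snd {Nb a b′} typ′))))
            where
            near : ∀ {v} → light a v ≡ true → s * # (Nb a ∩ adj G v) ≤ 12 * d
            near q = ≤-trans (<⇒≤ (<ᵇ-elim q)) (low-degree a Aa)
            cov : ∀ x → X x ≡ true → (Nb a ∩ adj G b) x ≡ true ⊎ (Nb a ∩ adj G b′) x ≡ true
            cov x q = [ (λ e → inj₁ (∧-intro x∈ (trans (sym G b x) e))) , (λ e → inj₂ (∧-intro x∈ (trans (sym G b′ x) e))) ]′ (∨-elim (∧-snd {o x a} q′))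
              where
              q′ = ∧-snd {low x} q
              x∈ : Nb a x ≡ true
              x∈ = ∧-intro (low⊆W x (∧-fst q)) (trans (sym G a x) (o-adj x a (∧-fst q′)))
          size : ∑ (λ x → # (conflict₃ a b b′ x)) ≤ # X * (12 * d)
          size = ≤-trans (∑-mono one) (≤-reflexive (∑-ι*const X (12 * d)))
            where
            one : ∀ x → # (conflict₃ a b b′ x) ≤ ι (X x) * (12 * d)
            one x = go (bool (X x))
              where
              go : _ → # (conflict₃ a b b′ x) ≤ ι (X x) * (12 * d)
              go (inj₁ q) = ≤-trans (#-mono {P = conflict₃ a b b′ x} {Q = W ∩ adj G x} (λ v z → ∧-snd {fresh a b b′ v} (∧-snd {fresh a b b′ x ∧ X x} z)))
                (≤-trans (low-degree x (∧-fst q)) (≤-reflexive (≡-sym (cong (_* (12 * d)) (ι-true q) ∙ +-identityʳ (12 * d)))))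
              go (inj₂ q) = ≡≤ (∑-zero (λ v → ι-false (≢true (λ z → true≢false (∧-snd {fresh a b b′ x} (∧-fst z)) q)))) z≤n

        -- 3d in-neighbours with at most (12d)² pairs of leaves each: 432 d³.
        bound₄ : 8 * (∑ (λ x → ∑ (λ v → # (conflict₄ a b b′ x v))) * L) ≤ M * M * M
        bound₄ = begin
          8 * (∑ (λ x → ∑ (λ v → # (conflict₄ a b b′ x v))) * L) ≤⟨ *-monoʳ-≤ 8 (*-monoˡ-≤ L size) ⟩
          8 * (3 * d * (12 * d * (12 * d)) * L) ≡⟨ l₁ d L ⟩
          8 * (432 * L) * (d * d * d) ≤⟨ *-monoˡ-≤ (d * d * d) κ³ ⟩
          κ * κ * κ * (d * d * d) ≡⟨ l₂ κ d ⟩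
          M * M * M ∎
          where
          open ≤-Reasoning
          l₁ : ∀ d l → 8 * (3 * d * (12 * d * (12 * d)) * l) ≡ 8 * (432 * l) * (d * d * d)
          l₁ = solve-∀
          l₂ : ∀ k d → k * k * k * (d * d * d) ≡ k * d * (k * d) * (k * d)
          l₂ = solve-∀
          size : ∑ (λ x → ∑ (λ v → # (conflict₄ a b b′ x v))) ≤ 3 * d * (12 * d * (12 * d))
          size = ≤-trans (∑-mono star) (≡≤ (∑-ι*const (λ x → low x ∧ o x a) (12 * d * (12 * d)))
            (*-monoˡ-≤ (12 * d * (12 * d)) (≤-trans (#-mono {P = λ x → low x ∧ o x a} {Q = λ x → o x a} (λ x q → ∧-snd {low x} q)) (indeg a))))
            where
            star : ∀ x → ∑ (λ v → # (conflict₄ a b b′ x v)) ≤ ι (low x ∧ o x a) * (12 * d * (12 * d))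
            star x = go (bool (low x ∧ o x a))
              where
              go : _ → ∑ (λ v → # (conflict₄ a b b′ x v)) ≤ ι (low x ∧ o x a) * (12 * d * (12 * d))
              go (inj₂ q) = ≡≤ (∑-zero (λ v → ∑-zero (λ w → ι-false (≢true (λ z → true≢false (∧-snd {fresh a b b′ x} (∧-fst z)) q))))) z≤n
              go (inj₁ q) = ≤-trans (∑-mono leaf) (≡≤ (∑-ι*const (W ∩ adj G x) (12 * d))
                (≤-trans (*-monoˡ-≤ (12 * d) degx) (≤-reflexive (≡-sym (cong (_* (12 * d * (12 * d))) (ι-true q) ∙ +-identityʳ _)))))
                where
                degx : # (W ∩ adj G x) ≤ 12 * d
                degx = low-degree x (∧-fst q)
                leaf : ∀ v → # (conflict₄ a b b′ x v) ≤ ι ((W ∩ adj G x) v) * (12 * d)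
                leaf v = go′ (bool ((W ∩ adj G x) v))
                  where
                  go′ : _ → # (conflict₄ a b b′ x v) ≤ ι ((W ∩ adj G x) v) * (12 * d)
                  go′ (inj₁ e) = ≤-trans (#-mono {P = conflict₄ a b b′ x v} {Q = W ∩ adj G x} (λ w z →
                      ∧-snd {fresh a b b′ w} (∧-fst (∧-snd {Nbr a b b′ x v} (∧-snd {fresh a b b′ x ∧ (low x ∧ o x a)} z)))))
                    (≤-trans degx (≤-reflexive (≡-sym (cong (_* (12 * d)) (ι-true e) ∙ +-identityʳ (12 * d)))))
                  go′ (inj₂ e) = ≡≤ (∑-zero (λ w → ι-false (≢true (λ z → true≢false (∧-snd {fresh a b b′ v} (∧-fst (∧-snd {fresh a b b′ x ∧ (low x ∧ o x a)} z))) e)))) z≤n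

      enough-triples : 2 * (M * (M * (K * # W))) < ∑₃ (λ a b b′ → ι (P a b b′)) * L
      enough-triples = *-cancelˡ-< 16 _ _ (begin-strict
        16 * (2 * (M * (M * (K * # W)))) ≡⟨ l₁ M K (# W) ⟩
        32 * (M * (M * K)) * # W <⟨ *-monoˡ-< (# W) {{>-nonZero W>0}} enough ⟩
        γ * γ * L * # W ≡⟨ l₂ (γ * γ) L (# W) ⟩
        # W * (γ * γ) * L ≤⟨ *-monoˡ-≤ L (many-triples free) ⟩
        16 * T * L ≡⟨ *-assoc 16 T L ⟩
        16 * (T * L) ∎)
        where
        open ≤-Reasoning
        T = ∑₃ (λ a b b′ → ι (P a b b′))
        l₁ : ∀ m k w → 16 * (2 * (m * (m * (k * w)))) ≡ 32 * (m * (m * k)) * w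
        l₁ = solve-∀
        l₂ : ∀ g l w → g * l * w ≡ w * g * l
        l₂ = solve-∀

      P-≢ : ∀ {a b b′} → P a b b′ ≡ true → b ≢ b′
      P-≢ p = proj₂ (adj⁼-false (Parts.sep p))

      not-self : ∀ {a b} → Adj G a b → a ≢ b
      not-self {a} p refl = true≢false p (irrefl G a)

      impossible : ⊥
      impossible = finish (good-colouring M>0 (λ a b b′ p → not-self (P-adj {a} {b} {b′} p) , not-self (P-adj {a} {b′} {b} (P-sym {a} {b} {b′} p)) , P-≢ {a} {b} {b′} p)
          (λ a b b′ p → E-conflicts a b b′ M>0 (Bounds.bound₁ p) (Bounds.bound₂ p) (Bounds.bound₃ p) (Bounds.bound₄ p)) enough-triples)
        where
        finish : (∃[ c ] K * # (sampled c) < ∑₃ (λ a b b′ → ι (good c a b b′))) → ⊥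
        finish (c , many) = free (Chosen.contains c o-adj (proj₁ (proj₂ ori)) low⊆W αβ (λ p → Parts.Aa p) P-W P-adj P-≢
          (λ p → proj₁ (adj⁼-false (Parts.sep p))) P-sym H (s≤s z≤n) K-big many)

    absurd : ⊥
    absurd = go orientation (colour-class x₀ L L<M)
      where
      x₀ : Fin (κ * d)
      x₀ = fromℕ< {0} (≤-trans (s≤s z≤n) L<M)
      go : (∃[ o ] Orientation W (3 * d) o) → (Σ (VSet (κ * d)) λ α → (∀ x → α x ≡ true → x == x₀ ≡ true → ⊥) × # α ≡ L) → ⊥
      go (o , ori) (α , αβ , #α) = Oriented.impossible o ori x₀ α αβ #α

  -- Induction on the size supplies minimality: smaller dense sets are already refuted, so the
  -- present one may be taken as minimal.
  no-dense-set : ∀ r W → # W ≤ r → 0 < d → 0 < # W → 2 * d * # W ≤ D W → ⊥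
  no-dense-set zero W W≤0 d>0 W>0 _ = <⇒≱ W>0 W≤0
  no-dense-set (suc r) W W≤r d>0 W>0 dense = AtMinimal.absurd d>0 W W>0 dense
    (λ U U⊆W U<W U>0 → ≰⇒> (λ p → no-dense-set r U (≤-pred (≤-trans U<W W≤r)) d>0 U>0 p))

  degSum-bound : 0 < d → degSum G ≤ 2 * d * n
  degSum-bound d>0 = go (0 <? n)
    where
    all : VSet n
    all _ = true
    D-all : D all ≡ degSum G
    D-all = ∑-cong (λ x → cong (_* deg all x) (ι-true refl) ∙ +-identityʳ (deg all x) ∙ ∑-cong (λ y → cong ι (bool-ext (λ p → ∧-snd {true} p) (∧-intro refl)))) ∙ unfold
      where
      opaque
        unfolding ∑
        unfold : ∑ (λ x → ∑ (λ y → ι (adj G x y))) ≡ degSum G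
        unfold = refl
    go : Dec (0 < n) → degSum G ≤ 2 * d * n
    go (no p) = ≡≤ (≡-sym D-all) (≤-trans (D-≤ all) (≡≤ (cong (_* # all) (#-all n ∙ n≤0⇒n≡0 (≮⇒≥ p))) z≤n))
    go (yes n>0) = ≮⇒≥ (λ lt → no-dense-set n all (#≤n all) d>0 (≤-trans n>0 (≤-reflexive (≡-sym (#-all n))))
      (≡≤ (cong (2 * d *_) (#-all n)) (≤-trans (<⇒≤ lt) (≤-reflexive (≡-sym D-all)))))

-- Choice of the constants and the final exponent

≤-scaleˡ : ∀ {a} b → 0 < a → b ≤ a * b
≤-scaleˡ {a} b p = ≡≤ (≡-sym (+-identityʳ b)) (*-monoˡ-≤ b p)

≤-scaleʳ : ∀ a {b} → 0 < b → a ≤ a * b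
≤-scaleʳ a {b} p = ≤-trans (≤-scaleˡ a p) (≤-reflexive (*-comm b a))

opaque
  c₁ : ℕ
  c₁ = 8 * (432 * 33)

  c₁≥ : 8 * (432 * 33) ≤ c₁
  c₁≥ = ≤-refl

  1152≤c₁ : 1152 ≤ c₁
  1152≤c₁ = m≤m+n 1152 (c₁ ∸ 1152)

  144≤c₁ : 144 ≤ c₁
  144≤c₁ = m≤m+n 144 (c₁ ∸ 144)

module Constants (r : ℕ) where

  -- With d = qγ, having enough triples means L > 32 κ² q² K, and conflict (4) asks for 8 · 432 L ≤
  -- κ³. As `L` is only quadratic in κ, both hold with 33 for 32 and κ = 8 · 432 · 33 q² K.
  h h² q K κ L : ℕ
  h = suc r
  h² = h * h
  q = 2 ^ r
  K = 2 ^ h² * h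
  κ = c₁ * (q * q * K)
  L = 33 * (κ * κ) * (q * q * K)

  -- `c₀` collects the factors of 2d that depend on h alone. Besides, s has to exceed κ for conflict
  -- (3), h² for the dense case, and 16 so that 16s ≤ s².
  c₀ s₀ : ℕ
  c₀ = 2 * q * (8 * L) * (2 ^ h * 2 ^ h²) * (2 + h²)
  s₀ = c₀ + (κ + (h² + 16))

  q>0 : 0 < q
  q>0 = ^-pos (s≤s z≤n) r

  K>0 : 0 < K
  K>0 = *-pos (^-pos (s≤s z≤n) h²) (s≤s z≤n)

  qqK>0 : 0 < q * q * K
  qqK>0 = *-pos (*-pos q>0 q>0) K>0

  κ>0 : 0 < κ
  κ>0 = *-pos (≤-trans (s≤s z≤n) 144≤c₁) qqK>0

  L>0 : 0 < L
  L>0 = *-pos (*-pos {33} (s≤s z≤n) (*-pos κ>0 κ>0)) qqK>0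

  144≤κ : 144 ≤ κ
  144≤κ = ≤-trans 144≤c₁ (≤-scaleʳ c₁ qqK>0)

  1152qq≤κ : 1152 * (q * q) ≤ κ
  1152qq≤κ = *-mono-≤ 1152≤c₁ (≤-scaleʳ (q * q) K>0)

  κ³ : 8 * (432 * L) ≤ κ * κ * κ
  κ³ = begin
    8 * (432 * L) ≡⟨ l 8 432 33 (κ * κ) (q * q * K) ⟩
    8 * (432 * 33) * (q * q * K) * (κ * κ) ≤⟨ *-monoˡ-≤ (κ * κ) (*-monoˡ-≤ (q * q * K) c₁≥) ⟩
    κ * (κ * κ) ≡⟨ ≡-sym (*-assoc κ κ κ) ⟩
    κ * κ * κ ∎
    where
    open ≤-Reasoning
    l : ∀ a b e x y → a * (b * (e * x * y)) ≡ a * (b * e) * y * x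
    l = solve-∀

  sκ² : ∀ s → κ ≤ s → 8 * (288 * L) ≤ s * (κ * κ)
  sκ² s κ≤s = ≤-trans (*-monoʳ-≤ 8 (*-monoˡ-≤ L (m≤m+n 288 144))) (≤-trans κ³ (≡≤ (*-assoc κ κ κ) (*-monoˡ-≤ (κ * κ) κ≤s)))

  24q≤L : 24 * q ≤ L
  24q≤L = *-mono-≤ (≤-trans (m≤m+n 24 9) (≤-scaleʳ 33 (*-pos κ>0 κ>0))) (≤-trans (≤-scaleʳ q q>0) (≤-scaleʳ (q * q) K>0))

  h≤L : h ≤ L
  h≤L = ≤-trans (≤-scaleˡ h (^-pos (s≤s z≤n) h²)) (≤-trans (≤-scaleˡ K (*-pos q>0 q>0)) (≤-scaleˡ (q * q * K) (*-pos {33} (s≤s z≤n) (*-pos κ>0 κ>0))))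

  module Bound (s : ℕ) (s₀≤s : s₀ ≤ s) {n : ℕ} (G : Graph n) (H : Graph h) (bip : Bipartite H)
    (no-Kss : ¬ ContainsKss s G) (free : ¬ ContainsInducedSubdivision H G) where

    c₀≤s : c₀ ≤ s
    c₀≤s = ≤-trans (m≤m+n c₀ _) s₀≤s

    rest≤s : κ + (h² + 16) ≤ s
    rest≤s = ≤-trans (m≤n+m _ c₀) s₀≤s

    κ≤s : κ ≤ s
    κ≤s = ≤-trans (m≤m+n κ _) rest≤s

    h²+16≤s : h² + 16 ≤ s
    h²+16≤s = ≤-trans (m≤n+m _ κ) rest≤s

    16≤s : 16 ≤ s
    16≤s = ≤-trans (m≤n+m 16 h²) h²+16≤s

    h²<s : h² < s
    h²<s = ≤-trans (≡≤ (+-comm 1 h²) (+-monoʳ-≤ h² (s≤s z≤n))) h²+16≤s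

    s>0 : 0 < s
    s>0 = ≤-trans (s≤s z≤n) 16≤s

    -- `S` = s² serves the dense case both as β and as γ. The local parameters are then read off in
    -- turn: β from T₂ ≤ β and h²T₁ < β, t from the richness of the patterns, γ from 8tL ≤ κd, and d
    -- from 2^r γ ≤ d.
    S T₁ B T₂ β t γ d : ℕ
    S = s * s
    T₁ = (2 * s) ^ h * ((2 * (8 * s)) ^ r * S)
    B = (2 * s) ^ h * ((2 * s) ^ h * S)
    T₂ = 2 * s * suc T₁ * B
    β = T₂ + (h² * T₁ + 1)
    t = 2 ^ h * (2 ^ h² * β)
    γ = 8 * L * t
    d = q * γ

    2s>0 : 0 < 2 * s
    2s>0 = *-pos {2} (s≤s z≤n) s>0

    S>0 : 0 < S
    S>0 = *-pos s>0 s>0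

    B>0 : 0 < B
    B>0 = *-pos (^-pos 2s>0 h) (*-pos (^-pos 2s>0 h) S>0)

    T₁>0 : 0 < T₁
    T₁>0 = *-pos (^-pos 2s>0 h) (*-pos (^-pos (*-pos {2} (s≤s z≤n) (*-pos {8} (s≤s z≤n) s>0)) r) S>0)

    sucT₁≤T₂ : suc T₁ ≤ T₂
    sucT₁≤T₂ = ≤-trans (≤-scaleˡ (suc T₁) 2s>0) (≤-scaleʳ (2 * s * suc T₁) B>0)

    β≤t : β ≤ t
    β≤t = ≤-trans (≤-scaleˡ β (^-pos {2} (s≤s z≤n) h²)) (≤-scaleˡ (2 ^ h² * β) (^-pos {2} (s≤s z≤n) h))

    T₂≤β : T₂ ≤ β
    T₂≤β = m≤m+n T₂ _

    h²T₁<β : h² * T₁ < β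
    h²T₁<β = ≡≤ (+-comm 1 (h² * T₁)) (m≤n+m _ T₂)

    β>0 : 0 < β
    β>0 = ≤-<-trans z≤n h²T₁<β

    t>0 : 0 < t
    t>0 = ≤-trans β>0 β≤t

    γ>0 : 0 < γ
    γ>0 = *-pos (*-pos {8} (s≤s z≤n) L>0) t>0

    γ≤d : γ ≤ d
    γ≤d = ≤-scaleˡ γ q>0

    -- Where the two cases meet: a violation yields an induced copy of `H`, a subdivision with all
    -- paths of length one.
    few-dense : ∀ Y → T₂ ≤ # Y → # (λ x → not (s * # (Y ∩ adj G x) <ᵇ # Y)) ≤ T₁
    few-dense Y T₂≤Y = ≮⇒≥ (λ lt → free (induced⇒contains H G
      (dense⇒induced (λ x → not (s * # (Y ∩ adj G x) <ᵇ # Y)) Y (<⇒≤ lt) T₂≤Y (λ x p → <ᵇ-false (not-elim p)))))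
      where
      32≤s² : 32 ≤ s * s
      32≤s² = ≤-trans (m≤m+n 32 224) (*-mono-≤ 16≤s 16≤s)
      l : ∀ s → 2 * (16 * s * s) ≡ 32 * (s * s)
      l = solve-∀
      open DenseSpot G {r} H bip {s} {S} {S} {T₁} s>0 no-Kss (*-monoˡ-≤ s (≤-trans (m≤m+n 4 12) 16≤s))
        (*-monoˡ-< s {{>-nonZero s>0}} (≤-trans (s≤s (≤-scaleʳ h (s≤s z≤n))) h²<s))
        (≡≤ (l s) (*-monoˡ-≤ S 32≤s²))
        (≡≤ (cong suc (≡-sym (*-assoc h h s))) (*-monoˡ-< s {{>-nonZero s>0}} h²<s)) ≤-refl using (dense⇒induced)

    bound : degSum G ≤ 2 * d * n
    bound = degSum-bound (≤-trans γ>0 γ≤d)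
      where
      1+2T₁≤2t : 1 + 2 * T₁ ≤ 2 * t
      1+2T₁≤2t = ≤-trans (n≤1+n _) (≡≤ (l T₁) (*-monoʳ-≤ 2 (≤-trans sucT₁≤T₂ (≤-trans T₂≤β β≤t))))
        where l : ∀ x → suc (1 + 2 * x) ≡ 2 * suc x
              l = solve-∀
      γ-sq : 8 * (12 * d * (1 + 2 * T₁)) ≤ γ * γ
      γ-sq = begin
        8 * (12 * d * (1 + 2 * T₁)) ≤⟨ *-monoʳ-≤ 8 (*-monoʳ-≤ (12 * d) 1+2T₁≤2t) ⟩
        8 * (12 * d * (2 * t)) ≡⟨ l q γ t ⟩
        8 * (24 * q) * t * γ ≤⟨ *-monoˡ-≤ γ (*-monoˡ-≤ t (*-monoʳ-≤ 8 24q≤L)) ⟩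
        γ * γ ∎
        where
        open ≤-Reasoning
        l : ∀ q g t → 8 * (12 * (q * g) * (2 * t)) ≡ 8 * (24 * q) * t * g
        l = solve-∀
      s-big : 8 * (144 * d * d) ≤ s * (γ * γ)
      s-big = ≡≤ (l q γ) (*-monoˡ-≤ (γ * γ) (≤-trans 1152qq≤κ κ≤s))
        where l : ∀ q g → 8 * (144 * (q * g) * (q * g)) ≡ 1152 * (q * q) * (g * g)
              l = solve-∀
      2t≤d : 2 * t ≤ d
      2t≤d = ≤-trans (*-monoˡ-≤ t (≤-trans (m≤m+n 2 6) (≤-scaleʳ 8 L>0))) γ≤d
      h²hT₁<γ : h² * (h * T₁) < γ
      h²hT₁<γ = begin-strict
        h² * (h * T₁) ≡⟨ l h² h T₁ ⟩
        h * (h² * T₁) <⟨ *-monoʳ-< h {{>-nonZero {h} (s≤s z≤n)}} h²T₁<β ⟩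
        h * β ≤⟨ *-mono-≤ h≤L β≤t ⟩
        L * t ≤⟨ *-monoˡ-≤ t (≤-scaleˡ {8} L (s≤s z≤n)) ⟩
        γ ∎
        where
        open ≤-Reasoning
        l = *-swap
      tL : 8 * (t * L) ≤ κ * d
      tL = ≡≤ (l t L) (≤-trans γ≤d (≤-scaleˡ d κ>0))
        where l : ∀ t l → 8 * (t * l) ≡ 8 * l * t
              l = solve-∀
      L<N : L < κ * d
      L<N = begin-strict
        L <⟨ m<n+m L {n = L} L>0 ⟩
        L + L ≡⟨ l L ⟩
        2 * L ≤⟨ *-monoˡ-≤ L (m≤m+n 2 6) ⟩
        8 * L ≤⟨ ≤-scaleʳ (8 * L) t>0 ⟩
        γ ≤⟨ γ≤d ⟩
        d ≤⟨ ≤-scaleˡ d κ>0 ⟩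
        κ * d ∎
        where
        open ≤-Reasoning
        l : ∀ x → x + x ≡ 2 * x
        l = solve-∀
      enough : 32 * (κ * d * (κ * d * K)) < γ * γ * L
      enough = begin-strict
        32 * (κ * d * (κ * d * K)) ≡⟨ l κ q γ K ⟩
        32 * X <⟨ *-monoˡ-< X {{>-nonZero X>0}} {32} {33} ≤-refl ⟩
        33 * X ≡⟨ l′ κ q γ K ⟩
        γ * γ * L ∎
        where
        open ≤-Reasoning
        X : ℕ
        X = κ * κ * (q * q * K) * (γ * γ)
        X>0 : 0 < X
        X>0 = *-pos (*-pos (*-pos κ>0 κ>0) qqK>0) (*-pos γ>0 γ>0)
        l : ∀ k q g K → 32 * (k * (q * g) * (k * (q * g) * K)) ≡ 32 * (k * k * (q * q * K) * (g * g))
        l = solve-∀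
        l′ : ∀ k q g K → 33 * (k * k * (q * q * K) * (g * g)) ≡ g * g * (33 * (k * k) * (q * q * K))
        l′ = solve-∀
      open SparseCase {n} {r} G H free {s} {d} {γ} {T₁} {T₂} {t} {β} {κ} {L} {K} few-dense (≤-trans (m≤m+n 3 13) 16≤s)
        (≤-trans (s≤s T₁>0) sucT₁≤T₂) T₂≤β h²T₁<β ≤-refl 2t≤d ≤-refl h²hT₁<γ γ-sq s-big 144≤κ tL (sκ² s κ≤s) κ³ L<N enough ≤-refl using (degSum-bound)

    2s≤S : 2 * s ≤ S
    2s≤S = *-monoˡ-≤ s (≤-trans (m≤m+n 2 14) 16≤s)

    T₁≤ : T₁ ≤ S ^ h * S ^ h
    T₁≤ = *-mono-≤ (^-monoˡ-≤ h 2s≤S) (≤-trans (*-monoˡ-≤ S (^-monoˡ-≤ r (≡≤ (≡-sym (*-assoc 2 8 s)) (*-monoˡ-≤ s 16≤s)))) (≤-reflexive (*-comm (S ^ r) S)))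

    B≤ : B ≤ S ^ h * (S ^ h * S)
    B≤ = *-mono-≤ (^-monoˡ-≤ h 2s≤S) (*-monoˡ-≤ S (^-monoˡ-≤ h 2s≤S))

    S≤S^h : S ≤ S ^ h
    S≤S^h = ≤-scaleʳ S (^-pos S>0 r)

    -- Three factors S^h come from 2s(T₁ + 1) and three from `B`.
    T₂≤ : T₂ ≤ S ^ (6 * h)
    T₂≤ = begin
      2 * s * suc T₁ * B ≤⟨ *-mono-≤ sucT₁-bound (≤-trans B≤ (*-monoʳ-≤ (S ^ h) (*-monoʳ-≤ (S ^ h) S≤S^h))) ⟩
      S ^ h * (S ^ h * S ^ h) * (S ^ h * (S ^ h * S ^ h)) ≡⟨ l (S ^ h) ⟩
      S ^ h * (S ^ h * (S ^ h * (S ^ h * (S ^ h * (S ^ h * 1))))) ≡⟨ power ⟩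
      S ^ (6 * h) ∎
      where
      open ≤-Reasoning
      l : ∀ x → x * (x * x) * (x * (x * x)) ≡ x * (x * (x * (x * (x * (x * 1)))))
      l = solve-∀
      power : S ^ h * (S ^ h * (S ^ h * (S ^ h * (S ^ h * (S ^ h * 1))))) ≡ S ^ (6 * h)
      power = ^-*-assoc S h 6 ∙ cong (S ^_) (*-comm h 6)
      sucT₁-bound : 2 * s * suc T₁ ≤ S ^ h * (S ^ h * S ^ h)
      sucT₁-bound = ≤-trans (*-monoʳ-≤ (2 * s) (≤-trans (+-monoˡ-≤ T₁ T₁>0) (≤-reflexive (l₁ T₁)))) (≡≤ (l₂ s T₁)
        (*-mono-≤ (≤-trans (*-monoˡ-≤ s (≤-trans (m≤m+n 4 12) 16≤s)) S≤S^h) T₁≤))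
        where l₁ : ∀ x → x + x ≡ 2 * x
              l₁ = solve-∀
              l₂ : ∀ s x → 2 * s * (2 * x) ≡ 4 * s * x
              l₂ = solve-∀

    β≤ : β ≤ (2 + h²) * T₂
    β≤ = ≤-trans (+-monoʳ-≤ T₂ (+-mono-≤ (*-monoʳ-≤ h² (≤-trans (n≤1+n T₁) sucT₁≤T₂)) (≤-trans (s≤s z≤n) sucT₁≤T₂))) (≤-reflexive (l T₂ h²))
      where l : ∀ x m → x + (m * x + x) ≡ (2 + m) * x
            l = solve-∀

    -- `c₀` takes up one more factor S^h; this gives S^(7h) with S = s², hence the constant 14.
    2d≤ : 2 * d ≤ s ^ (14 * h)
    2d≤ = begin
      2 * (q * (8 * L * (2 ^ h * (2 ^ h² * β)))) ≤⟨ *-monoʳ-≤ 2 (*-monoʳ-≤ q (*-monoʳ-≤ (8 * L) (*-monoʳ-≤ (2 ^ h) (*-monoʳ-≤ (2 ^ h²) β≤)))) ⟩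
      2 * (q * (8 * L * (2 ^ h * (2 ^ h² * ((2 + h²) * T₂))))) ≡⟨ l 2 q (8 * L) (2 ^ h) (2 ^ h²) (2 + h²) T₂ ⟩
      c₀ * T₂ ≤⟨ *-mono-≤ (≤-trans c₀≤s (≤-trans (≤-scaleʳ s s>0) S≤S^h)) T₂≤ ⟩
      S ^ h * S ^ (6 * h) ≡⟨ ≡-sym (^-distribˡ-+-* S h (6 * h)) ⟩
      S ^ (7 * h) ≡⟨ cong (_^ (7 * h)) (cong (s *_) (≡-sym (*-identityʳ s))) ∙ ^-*-assoc s 2 (7 * h) ∙ cong (s ^_) (≡-sym (*-assoc 2 7 h)) ⟩
      s ^ (14 * h) ∎
      where
      open ≤-Reasoning
      l : ∀ a b e x y z w → a * (b * (e * (x * (y * (z * w))))) ≡ a * b * e * (x * y) * z * w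
      l = solve-∀

    average-degree : degSum G ≤ s ^ (14 * h) * n
    average-degree = ≤-trans bound (*-monoˡ-≤ n 2d≤)

empty-contained : ∀ (H : Graph 0) {n} (G : Graph n) → ContainsInducedSubdivision H G
empty-contained H G = induced⇒contains H G ((λ ()) , (λ { {()} }) , (λ ()))

theorem1p7 : ∃[ C ] (0 < C ×
    (∀ (h : ℕ) (H : Graph h) → Bipartite H →
    ∃[ s₀ ] (∀ (s : ℕ) → s₀ ≤ s →
    ∀ (n : ℕ) (G : Graph n) →
    ¬ ContainsKss s G →
    ¬ ContainsInducedSubdivision H G →
    degSum G ≤ s ^ (C * h) * n)))
theorem1p7 = 14 , s≤s z≤n , λ where
  -- The graph without vertices is an induced subgraph of every `G`, against the hypothesis.
  zero H bip → 0 , λ s _ n G _ free → ⊥-elim (free (empty-contained H G))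
  (suc r) H bip → Constants.s₀ r , λ s s₀≤s n G no-Kss free → Constants.Bound.average-degree r s s₀≤s G H bip no-Kss free
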